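{- Let $A$ be a subarrangement of the $\mathcal{B}_n$ arrangement in $\mathbb{R}^n$, let $\chi_A(t)$ be the characteristic polynomial of $A$ viewed as a matroid, and let $r$ be the rank of this matroid. Define $h''_0,\dots,h''_{n-1}$ by $$h''_0+h''_1t+\cdots+h''_{n-1}t^{n-1}=(1-t)^n\sum_{j=0}^\infty\big[(2j+1)^n-\chi_A(2j+1)(2j+1)^{n-r}\big]t^j.$$ Then (1) $h''_0\le h''_1\le\cdots\le h''_{\lfloor (n-1)/2\rfloor}$; (2) for $i\le (n-1)/2$, $h''_i\le h''_{n-1-i}$; (3) $(h''_0,\,h''_1-h''_0,\,\dots,\,h''_{\lceil (n-1)/2\rceil}-h''_{\lceil (n-1)/2\rceil-1})$ is an M-vector.
   Context: The $\mathcal{B}_n$ arrangement in $\mathbb{R}^n$ consists of all hyperplanes $x_i=x_j$ ($i<j$) together with all coordinate hyperplanes $x_i=0$ (as stated in the paper). The characteristic polynomial of $A$ is that of the matroid on the hyperplanes of $A$ given by linear dependence of their normal vectors. A sequence of nonnegative integers $(m_0,\dots,m_d)$ is an M-vector if it is the Hilbert function of a homogeneous quotient of a polynomial ring (standard graded), equivalently the degree sequence of an order ideal of monomials; equivalently $m_0=1$ and $m_{i+1}\le m_i^{\langle i\rangle}$ for $1\le i\le d-1$, where writing $m_i=\binom{a_i}{i}+\cdots+\binom{a_j}{j}$ with $a_i>\cdots>a_j\ge j\ge1$, $m_i^{\langle i\rangle}=\binom{a_i+1}{i+1}+\cdots+\binom{a_j+1}{j+1}$.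
   Formalization: The all-zero vector (Hilbert function of the zero quotient) is also counted as an M-vector; this matters only for the empty arrangement, where all h''_i = 0 and so m_0 = 1 fails; for nonempty A, h''_0 = 1. -}

module Defs where

open import Data.Nat as ℕ using (ℕ; zero; suc; _∸_; _≤_; _<_)
open import Data.Nat.Combinatorics using (_C_)
open import Data.Integer as ℤ using (ℤ; +_)
open import Data.Rational as ℚ using (ℚ; 0ℚ)
open import Data.Fin as Fin using (Fin)
open import Data.List using (List; []; _∷_; _++_; map; length; lookup; foldr; upTo)
open import Data.List.Relation.Binary.Sublist.Propositional using (_⊆_)
open import Data.List.Relation.Unary.All using (All)
open import Data.Product using (Σ; _×_)
open import Data.Sum using (_⊎_)
open import Data.Unit using (⊤)
open import Relation.Binary.PropositionalEquality using (_≡_)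
open import Relation.Nullary using (¬_)

-- eqH i j : the hyperplane x_i = x_j (i < j);  coordH i : x_i = 0.
data Hyp (n : ℕ) : Set where
  eqH    : (i j : Fin n) → i Fin.< j → Hyp n
  coordH : Fin n → Hyp n

δ : {n : ℕ} → Fin n → Fin n → ℤ
δ i k with i Fin.≟ k
... | Relation.Nullary.yes _ = + 1
... | Relation.Nullary.no  _ = + 0

normal : {n : ℕ} → Hyp n → Fin n → ℤ
normal (eqH i j _) k = δ i k ℤ.- δ j k
normal (coordH i)  k = δ i k

-- Linear (in)dependence of normal vectors (over ℚ; the vectors are
-- integral, so this is the same as over ℝ) and the matroid rank.

sumℚ : List ℚ → ℚ
sumℚ = foldr ℚ._+_ 0ℚ

toℚ : ℤ → ℚ
toℚ z = z ℚ./ 1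

combo : {n : ℕ} (L : List (Hyp n)) → (Fin (length L) → ℚ) → Fin n → ℚ
combo L c m = sumℚ (map (λ k → c k ℚ.* toℚ (normal (lookup L k) m)) (Data.List.allFin (length L)))

Independent : {n : ℕ} → List (Hyp n) → Set
Independent L = (c : Fin (length L) → ℚ) → (∀ m → combo L c m ≡ 0ℚ) → ∀ k → c k ≡ 0ℚ

IsRank : {n : ℕ} → List (Hyp n) → ℕ → Set
IsRank S k =
  Σ (List _) (λ T → T ⊆ S × Independent T × length T ≡ k)
  × (∀ T → T ⊆ S → Independent T → length T ≤ k)

-- Characteristic polynomial (Whitney's subset expansion)
--   χ_A(t) = Σ_{S ⊆ A} (-1)^{|S|} t^{r(A) - r(S)}

subsets : {X : Set} → List X → List (List X)
subsets []       = [] ∷ []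
subsets (x ∷ xs) = subsets xs ++ map (x ∷_) (subsets xs)

sumℤ : List ℤ → ℤ
sumℤ = foldr ℤ._+_ (+ 0)

sign : ℕ → ℤ
sign k = (ℤ.- (+ 1)) ℤ.^ k

χ : {n : ℕ} → (rk : List (Hyp n) → ℕ) → List (Hyp n) → ℤ → ℤ
χ rk A x = sumℤ (map (λ S → sign (length S) ℤ.* (x ℤ.^ (rk A ∸ rk S))) (subsets A))

fval : (n : ℕ) → (rk : List (Hyp n) → ℕ) → List (Hyp n) → ℤ → ℤ
fval n rk A x = (x ℤ.^ n) ℤ.- (χ rk A x ℤ.* (x ℤ.^ (n ∸ rk A)))

-- h''_i = coefficient of t^i in (1-t)^n Σ_j f(2j+1) t^j
--       = Σ_{k=0}^{i} (-1)^k C(n,k) f(2(i-k)+1)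
h'' : (n : ℕ) → (rk : List (Hyp n) → ℕ) → List (Hyp n) → ℕ → ℤ
h'' n rk A i =
  sumℤ (map (λ k → sign k ℤ.* (+ (n C k)) ℤ.* fval n rk A (+ (2 ℕ.* (i ∸ k) ℕ.+ 1)))
            (upTo (suc i)))

-- Valid k as : as = [a_k, a_{k-1}, ..., a_j] with a_k > ... > a_j ≥ j ≥ 1
Valid : ℕ → List ℕ → Set
Valid k []           = ⊤
Valid k (a ∷ [])     = 1 ≤ k × k ≤ a
Valid k (a ∷ b ∷ as) = 1 ≤ k × k ≤ a × b < a × Valid (k ∸ 1) (b ∷ as)

binSum : ℕ → List ℕ → ℕ
binSum k []       = 0
binSum k (a ∷ as) = (a C k) ℕ.+ binSum (k ∸ 1) as

binSumUp : ℕ → List ℕ → ℕ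
binSumUp k []       = 0
binSumUp k (a ∷ as) = (suc a C suc k) ℕ.+ binSumUp (k ∸ 1) as

-- m' ≤ m^⟨i⟩ (via the (unique) i-binomial representation of m)
MacaulayBound : ℕ → ℕ → ℕ → Set
MacaulayBound i m m' = ∀ as → Valid i as → binSum i as ≡ m → m' ≤ binSumUp i as

at : List ℕ → ℕ → ℕ
at []       _       = 0
at (x ∷ xs) zero    = x
at (x ∷ xs) (suc i) = at xs i

-- (m_0,…,m_d) is an M-vector (Hilbert function of a standard graded
-- quotient of a polynomial ring).  The zero quotient gives the zero vector.
IsMVectorℕ : List ℕ → Set
IsMVectorℕ ms =
  All (_≡ 0) ms
  ⊎ (at ms 0 ≡ 1
     × (∀ i → 1 ≤ i → suc i < length ms → MacaulayBound i (at ms i) (at ms (suc i))))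

IsMVector : List ℤ → Set
IsMVector v = Σ (List ℕ) (λ ms → map +_ ms ≡ v × IsMVectorℕ ms)

-- subarrangements of B_n: duplicate-free lists of its hyperplanes
open import Data.List.Relation.Unary.Unique.Propositional using (Unique) public

diffVec : (ℕ → ℤ) → ℕ → List ℤ
diffVec h c = map (λ i → d i) (upTo (suc c))
  where
  d : ℕ → ℤ
  d zero    = h 0
  d (suc i) = h (suc i) ℤ.- h i

{-# OPTIONS --safe #-}
-- A point of {0,…,x-1}ⁿ is a coloring of a graph on n + 1 vertices, one of which (the ground)
-- has color 0, and f(x) = xⁿ - χ_A(x) x^(n-r) counts the colorings that are constant on some
-- edge.  Sorting these by their last constant edge writes f as a sum of proper-coloring counts
-- of contractions, one for each edge, and h'' as the sum of their h-polynomials.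
--
-- Orient the edges and cut a strict coloring at the color of a sink: this shows inductively
-- that the h-polynomial of a proper-coloring count in dimension n is a nonnegative combination
-- of polynomials t^k (1+t)^m with 2k + m ≥ n + 1.  Passing from all x to odd x multiplies by
-- (1+t)^(n+1) and keeps the odd coefficients.  Such polynomials increase up to the middle and
-- are top-heavy, which gives (1) and (2), and they satisfy the local LYM inequality.
--
-- For (3), LYM bounds g_i = h''_i - h''_{i-1} below by (n-2i)/(n-i) h''_i, and h''_i, h''_{i+1}
-- are compared with the Eulerian numbers of type B.  The resulting bound on g_{i+1} / g_i is
-- smaller than what g_i ≥ C(b+i-1,i) already allows in Macaulay's condition.
module Submission where

-- Macaulay's condition is not linear. Unlike monotonicity, top-heaviness and the LYM inequality, it
-- does not pass to a sum over contractions, so it has to come from numerical estimates. These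
-- depend on the number of edges: from `2i+1` edges on, `h_i` is large enough for the crude bound of
-- `g_(i+1)` by an Eulerian number; with fewer edges, `h_i` and `h_(i+1)` are both compared with the
-- number of edges times Eulerian numbers. The delicate point of the recursion on strict colorings
-- is the weight `n + 1`. A cut at a sink distributes the other `n - 1` vertices over a lower part
-- `S` and an upper part `T`, and the weights `|S| + 1` and `|T| + 1` add up to `n + 1`, but an
-- empty `S` supplies its share only if the sink cannot have the color 0. So the sink should be
-- joined to the ground or be the head of an arc. Without edges to the ground the sink may be
-- isolated, and the two extreme cuts have to be combined into a factor `1 + t`.

module Sequences where

  open import Data.Nat as ℕ using (ℕ; zero; suc; z≤n; s≤s)
  import Data.Nat.Properties as ℕₚ
  open import Data.Integer as ℤ using (ℤ; +_; _+_; _*_; _-_; _≤_; 0ℤ; 1ℤ; +≤+)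
  import Data.Integer.Properties as ℤₚ
  open import Data.Integer.Tactic.RingSolver using (solve-∀)
  open import Data.Nat.Tactic.RingSolver using () renaming (solve-∀ to ℕ-solve-∀)
  open import Function using (_∘_)
  open import Relation.Nullary using (yes; no)
  open import Relation.Binary.PropositionalEquality using (_≡_; _≗_; refl; sym; trans; cong; cong₂; subst; subst₂)

  -- Power series and the operators `t`, `1 - t`, `1 + t`.

  Seq : Set
  Seq = ℕ → ℤ

  δ₀ : Seq
  δ₀ zero    = 1ℤ
  δ₀ (suc _) = 0ℤ

  -- Sequences stand for power series in `t`: `shift` is multiplication by `t`, `Δ` by `1 - t`,
  -- `1+shift` by `1 + t`, and `conv` is the product.
  shift : Seq → Seq
  shift a zero    = 0ℤ
  shift a (suc i) = a i

  infixl 6 _⊕_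
  _⊕_ : Seq → Seq → Seq
  (a ⊕ b) i = a i + b i

  Δ : Seq → Seq
  Δ a i = a i - shift a i

  1+shift : Seq → Seq
  1+shift a = a ⊕ shift a

  iter : (Seq → Seq) → ℕ → Seq → Seq
  iter f zero    a = a
  iter f (suc n) a = f (iter f n a)

  shift-cong : ∀ {a b} → a ≗ b → shift a ≗ shift b
  shift-cong p zero    = refl
  shift-cong p (suc i) = p i

  Δ-cong : ∀ {a b} → a ≗ b → Δ a ≗ Δ b
  Δ-cong p i = cong₂ _-_ (p i) (shift-cong p i)

  1+shift-cong : ∀ {a b} → a ≗ b → 1+shift a ≗ 1+shift b
  1+shift-cong p i = cong₂ _+_ (p i) (shift-cong p i)

  iter-cong : ∀ {f : Seq → Seq} → (∀ {a b} → a ≗ b → f a ≗ f b) → ∀ n {a b} → a ≗ b → iter f n a ≗ iter f n b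
  iter-cong f-cong zero    p = p
  iter-cong f-cong (suc n) p = f-cong (iter-cong f-cong n p)

  iter-comm : ∀ {f g : Seq → Seq} → (∀ {a b} → a ≗ b → f a ≗ f b) → (∀ a → f (g a) ≗ g (f a)) →
              ∀ n a → iter f n (g a) ≗ g (iter f n a)
  iter-comm f-cong fg zero    a i = refl
  iter-comm f-cong fg (suc n) a i = trans (f-cong (iter-comm f-cong fg n a) i) (fg (iter _ n a) i)

  shift-⊕ : ∀ a b → shift (a ⊕ b) ≗ shift a ⊕ shift b
  shift-⊕ a b zero    = refl
  shift-⊕ a b (suc i) = refl

  Δ-⊕ : ∀ a b → Δ (a ⊕ b) ≗ Δ a ⊕ Δ b
  Δ-⊕ a b i rewrite shift-⊕ a b i = lemma (a i) (b i) (shift a i) (shift b i)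
    where
    lemma : ∀ x y z w → x + y - (z + w) ≡ x - z + (y - w)
    lemma = solve-∀

  iterΔ-⊕ : ∀ n a b → iter Δ n (a ⊕ b) ≗ iter Δ n a ⊕ iter Δ n b
  iterΔ-⊕ zero    a b i = refl
  iterΔ-⊕ (suc n) a b i = trans (Δ-cong (iterΔ-⊕ n a b) i) (Δ-⊕ (iter Δ n a) (iter Δ n b) i)

  iterΔ-0 : ∀ n → iter Δ n (λ _ → 0ℤ) ≗ (λ _ → 0ℤ)
  iterΔ-0 zero    i = refl
  iterΔ-0 (suc n) i rewrite Δ-cong (iterΔ-0 n) i = shift0 i
    where
    shift0 : Δ (λ _ → 0ℤ) ≗ (λ _ → 0ℤ)
    shift0 zero    = refl
    shift0 (suc i) = refl

  1+shift-⊕ : ∀ a b → 1+shift (a ⊕ b) ≗ 1+shift a ⊕ 1+shift b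
  1+shift-⊕ a b i rewrite shift-⊕ a b i = lemma (a i) (b i) (shift a i) (shift b i)
    where
    lemma : ∀ x y z w → x + y + (z + w) ≡ x + z + (y + w)
    lemma = solve-∀

  1+shift-shift : ∀ a → 1+shift (shift a) ≗ shift (1+shift a)
  1+shift-shift a zero    = refl
  1+shift-shift a (suc i) = refl

  conv : Seq → Seq → Seq
  conv a b zero    = a 0 * b 0
  conv a b (suc n) = a 0 * b (suc n) + conv (a ∘ suc) b n

  conv-cong : ∀ {a a' b b'} → a ≗ a' → b ≗ b' → conv a b ≗ conv a' b'
  conv-cong p q zero    = cong₂ _*_ (p 0) (q 0)
  conv-cong p q (suc n) = cong₂ _+_ (cong₂ _*_ (p 0) (q (suc n))) (conv-cong (p ∘ suc) q n)

  conv-⊕ˡ : ∀ a a' b → conv (a ⊕ a') b ≗ conv a b ⊕ conv a' b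
  conv-⊕ˡ a a' b zero    = ℤₚ.*-distribʳ-+ (b 0) (a 0) (a' 0)
  conv-⊕ˡ a a' b (suc n) rewrite conv-⊕ˡ (a ∘ suc) (a' ∘ suc) b n =
    lemma (a 0) (a' 0) (b (suc n)) (conv (a ∘ suc) b n) (conv (a' ∘ suc) b n)
    where
    lemma : ∀ x y z u v → (x + y) * z + (u + v) ≡ x * z + u + (y * z + v)
    lemma = solve-∀

  conv-⊕ʳ : ∀ a b b' → conv a (b ⊕ b') ≗ conv a b ⊕ conv a b'
  conv-⊕ʳ a b b' zero    = ℤₚ.*-distribˡ-+ (a 0) (b 0) (b' 0)
  conv-⊕ʳ a b b' (suc n) rewrite conv-⊕ʳ (a ∘ suc) b b' n =
    lemma (a 0) (b (suc n)) (b' (suc n)) (conv (a ∘ suc) b n) (conv (a ∘ suc) b' n)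
    where
    lemma : ∀ x y z u v → x * (y + z) + (u + v) ≡ x * y + u + (x * z + v)
    lemma = solve-∀

  conv-shiftˡ : ∀ a b → conv (shift a) b ≗ shift (conv a b)
  conv-shiftˡ a b zero    = refl
  conv-shiftˡ a b (suc n) = ℤₚ.+-identityˡ _

  conv-shiftʳ : ∀ a b → conv a (shift b) ≗ shift (conv a b)
  conv-shiftʳ a b zero          = ℤₚ.*-zeroʳ (a 0)
  conv-shiftʳ a b (suc zero)    = trans (cong (_+_ (a 0 * b 0)) (ℤₚ.*-zeroʳ (a 1))) (ℤₚ.+-identityʳ _)
  conv-shiftʳ a b (suc (suc n)) = cong (_+_ (a 0 * b (suc n))) (conv-shiftʳ (a ∘ suc) b (suc n))

  conv-0ˡ : ∀ b → conv (λ _ → 0ℤ) b ≗ (λ _ → 0ℤ)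
  conv-0ˡ b zero    = refl
  conv-0ˡ b (suc n) = trans (ℤₚ.+-identityˡ _) (conv-0ˡ b n)

  conv-δ₀ˡ : ∀ b → conv δ₀ b ≗ b
  conv-δ₀ˡ b zero    = ℤₚ.*-identityˡ (b 0)
  conv-δ₀ˡ b (suc n) = trans (cong₂ _+_ (ℤₚ.*-identityˡ (b (suc n))) (conv-0ˡ b n)) (ℤₚ.+-identityʳ _)

  -1ℤ : ℤ
  -1ℤ = ℤ.- 1ℤ

  scale : ℤ → Seq → Seq
  scale c a i = c * a i

  shift-scale : ∀ c a → shift (scale c a) ≗ scale c (shift a)
  shift-scale c a zero    = sym (ℤₚ.*-zeroʳ c)
  shift-scale c a (suc i) = refl

  Δ-scale : ∀ c a → Δ (scale c a) ≗ scale c (Δ a)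
  Δ-scale c a i rewrite shift-scale c a i = lemma c (a i) (shift a i)
    where
    lemma : ∀ c x y → c * x - c * y ≡ c * (x - y)
    lemma = solve-∀

  iterΔ-scale : ∀ n c a → iter Δ n (scale c a) ≗ scale c (iter Δ n a)
  iterΔ-scale zero    c a i = refl
  iterΔ-scale (suc n) c a i = trans (Δ-cong (iterΔ-scale n c a) i) (Δ-scale c _ i)

  conv-scaleˡ : ∀ c a b → conv (scale c a) b ≗ scale c (conv a b)
  conv-scaleˡ c a b zero    = ℤₚ.*-assoc c (a 0) (b 0)
  conv-scaleˡ c a b (suc n) rewrite conv-scaleˡ c (a ∘ suc) b n = lemma c (a 0) (b (suc n)) (conv (a ∘ suc) b n)
    where
    lemma : ∀ c x y z → c * x * y + c * z ≡ c * (x * y + z)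
    lemma = solve-∀

  conv-scaleʳ : ∀ c a b → conv a (scale c b) ≗ scale c (conv a b)
  conv-scaleʳ c a b zero    = lemma c (a 0) (b 0)
    where
    lemma : ∀ c x y → x * (c * y) ≡ c * (x * y)
    lemma = solve-∀
  conv-scaleʳ c a b (suc n) rewrite conv-scaleʳ c (a ∘ suc) b n = lemma c (a 0) (b (suc n)) (conv (a ∘ suc) b n)
    where
    lemma : ∀ c x y z → x * (c * y) + c * z ≡ c * (x * y + z)
    lemma = solve-∀

  Δ-as-⊕ : ∀ a → Δ a ≗ a ⊕ scale -1ℤ (shift a)
  Δ-as-⊕ a i = lemma (a i) (shift a i)
    where
    lemma : ∀ x y → x - y ≡ x + (ℤ.- 1ℤ) * y
    lemma = solve-∀

  conv-Δˡ : ∀ a b → conv (Δ a) b ≗ Δ (conv a b)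
  conv-Δˡ a b i =
    trans (conv-cong {b = b} (Δ-as-⊕ a) (λ _ → refl) i)
    (trans (conv-⊕ˡ a (scale -1ℤ (shift a)) b i)
    (trans (cong (_+_ (conv a b i)) (trans (conv-scaleˡ -1ℤ (shift a) b i) (cong (-1ℤ *_) (conv-shiftˡ a b i))))
    (sym (Δ-as-⊕ (conv a b) i))))

  conv-Δʳ : ∀ a b → conv a (Δ b) ≗ Δ (conv a b)
  conv-Δʳ a b i =
    trans (conv-cong {a = a} (λ _ → refl) (Δ-as-⊕ b) i)
    (trans (conv-⊕ʳ a b (scale -1ℤ (shift b)) i)
    (trans (cong (_+_ (conv a b i)) (trans (conv-scaleʳ -1ℤ a (shift b) i) (cong (-1ℤ *_) (conv-shiftʳ a b i))))
    (sym (Δ-as-⊕ (conv a b) i))))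

  -- Factors `1 - t` can be moved to either side of a product. Thus the numerator of a product of
  -- two counting series is the product of their numerators.
  iterΔ-conv : ∀ m n a b → iter Δ (m ℕ.+ n) (conv a b) ≗ conv (iter Δ m a) (iter Δ n b)
  iterΔ-conv zero    zero    a b i = refl
  iterΔ-conv zero    (suc n) a b i = trans (Δ-cong (iterΔ-conv zero n a b) i) (sym (conv-Δʳ a (iter Δ n b) i))
  iterΔ-conv (suc m) n       a b i = trans (Δ-cong (iterΔ-conv m n a b) i) (sym (conv-Δˡ (iter Δ m a) (iter Δ n b) i))

  -- The cone spanned by the polynomials `t^k (1+t)^m`.

  binom : ℕ → Seq
  binom m = iter 1+shift m δ₀

  -- The generator `t^k (1+t)^m` is palindromic about `(2k+m)/2`; the weight `d` is a lower bound
  -- for twice this center. `resp` is there because sequences are compared pointwise.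
  data Cone (d : ℕ) : Seq → Set where
    gen  : ∀ k m → d ℕ.≤ 2 ℕ.* k ℕ.+ m → Cone d (iter shift k (binom m))
    nil  : Cone d (λ _ → 0ℤ)
    add  : ∀ {a b} → Cone d a → Cone d b → Cone d (a ⊕ b)
    resp : ∀ {a b} → a ≗ b → Cone d a → Cone d b

  cone-weaken : ∀ {d e a} → d ℕ.≤ e → Cone e a → Cone d a
  cone-weaken d≤e (gen k m p) = gen k m (ℕₚ.≤-trans d≤e p)
  cone-weaken d≤e nil         = nil
  cone-weaken d≤e (add p q)   = add (cone-weaken d≤e p) (cone-weaken d≤e q)
  cone-weaken d≤e (resp e p)  = resp e (cone-weaken d≤e p)

  cone-shift : ∀ {d a} → Cone d a → Cone (2 ℕ.+ d) (shift a)
  cone-shift {d} (gen k m p) = gen (suc k) m (subst (2 ℕ.+ d ℕ.≤_) (lemma k m) (s≤s (s≤s p)))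
    where
    lemma : ∀ k m → 2 ℕ.+ (2 ℕ.* k ℕ.+ m) ≡ 2 ℕ.* (1 ℕ.+ k) ℕ.+ m
    lemma = ℕ-solve-∀
  cone-shift nil        = resp (λ { zero → refl ; (suc _) → refl }) nil
  cone-shift (add p q)  = resp (λ i → sym (shift-⊕ _ _ i)) (add (cone-shift p) (cone-shift q))
  cone-shift (resp e p) = resp (shift-cong e) (cone-shift p)

  cone-1+shift : ∀ {d a} → Cone d a → Cone (suc d) (1+shift a)
  cone-1+shift {d} (gen k m p) =
    resp (iter-comm {f = shift} {g = 1+shift} shift-cong (λ a i → sym (1+shift-shift a i)) k (binom m))
         (gen k (suc m) (subst (suc d ℕ.≤_) (sym (ℕₚ.+-suc (2 ℕ.* k) m)) (s≤s p)))
  cone-1+shift nil        = resp (λ { zero → refl ; (suc _) → refl }) nil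
  cone-1+shift (add {a} {b} p q) = resp (λ i → sym (1+shift-⊕ a b i)) (add (cone-1+shift p) (cone-1+shift q))
  cone-1+shift (resp e p) = resp (1+shift-cong e) (cone-1+shift p)

  cone-iter-1+shift : ∀ {d a} n → Cone d a → Cone (n ℕ.+ d) (iter 1+shift n a)
  cone-iter-1+shift zero    p = p
  cone-iter-1+shift (suc n) p = cone-1+shift (cone-iter-1+shift n p)

  cone-iter-shift : ∀ {d a} n → Cone d a → Cone (2 ℕ.* n ℕ.+ d) (iter shift n a)
  cone-iter-shift zero    p = p
  cone-iter-shift {d} {a} (suc n) p =
    subst (λ e → Cone e (iter shift (suc n) a)) (lemma n d) (cone-shift (cone-iter-shift n p))
    where
    lemma : ∀ n d → 2 ℕ.+ (2 ℕ.* n ℕ.+ d) ≡ 2 ℕ.* (1 ℕ.+ n) ℕ.+ d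
    lemma = ℕ-solve-∀

  conv-binom : ∀ m b → conv (binom m) b ≗ iter 1+shift m b
  conv-binom zero    b = conv-δ₀ˡ b
  conv-binom (suc m) b i =
    trans (conv-⊕ˡ (binom m) (shift (binom m)) b i)
    (trans (cong (_+_ (conv (binom m) b i)) (conv-shiftˡ (binom m) b i))
    (1+shift-cong (conv-binom m b) i))

  conv-iter-shift : ∀ k a b → conv (iter shift k a) b ≗ iter shift k (conv a b)
  conv-iter-shift zero    a b i = refl
  conv-iter-shift (suc k) a b i = trans (conv-shiftˡ (iter shift k a) b i) (shift-cong (conv-iter-shift k a b) i)

  -- Centers of symmetry add under multiplication: a factor `t` raises the weight by 2 and a factor
  -- `1 + t` raises it by 1.
  cone-conv : ∀ {d e a b} → Cone d a → Cone e b → Cone (d ℕ.+ e) (conv a b)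
  cone-conv {d} {e} {b = b} (gen k m p) q =
    resp (λ i → sym (trans (conv-iter-shift k (binom m) b i) (iter-cong shift-cong k (conv-binom m b) i)))
         (cone-weaken (subst (d ℕ.+ e ℕ.≤_) (ℕₚ.+-assoc (2 ℕ.* k) m e) (ℕₚ.+-monoˡ-≤ e p))
                      (cone-iter-shift k (cone-iter-1+shift m q)))
  cone-conv {b = b} nil q         = resp (λ i → sym (conv-0ˡ b i)) nil
  cone-conv {b = b} (add p p') q  = resp (λ i → sym (conv-⊕ˡ _ _ b i)) (add (cone-conv p q) (cone-conv p' q))
  cone-conv (resp e p) q          = resp (conv-cong e (λ _ → refl)) (cone-conv p q)

  binom-nonneg : ∀ m i → 0ℤ ≤ binom m i
  binom-nonneg zero    zero    = +≤+ z≤n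
  binom-nonneg zero    (suc i) = +≤+ z≤n
  binom-nonneg (suc m) zero    = ℤₚ.+-mono-≤ (binom-nonneg m zero) (+≤+ z≤n)
  binom-nonneg (suc m) (suc i) = ℤₚ.+-mono-≤ (binom-nonneg m (suc i)) (binom-nonneg m i)

  gen-nonneg : ∀ k m i → 0ℤ ≤ iter shift k (binom m) i
  gen-nonneg zero    m i       = binom-nonneg m i
  gen-nonneg (suc k) m zero    = +≤+ z≤n
  gen-nonneg (suc k) m (suc i) = gen-nonneg k m i

  cone-nonneg : ∀ {d a} → Cone d a → ∀ i → 0ℤ ≤ a i
  cone-nonneg (gen k m _) i = gen-nonneg k m i
  cone-nonneg nil         i = +≤+ z≤n
  cone-nonneg (add p q)   i = ℤₚ.+-mono-≤ (cone-nonneg p i) (cone-nonneg q i)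
  cone-nonneg (resp e p)  i = subst (0ℤ ≤_) (e i) (cone-nonneg p i)

  -- Pascal's rule gives two summands on each side. They are compared crosswise, `k+1` with `l` and
  -- `k` with `l+1`, which preserves the sum of the indices; this fails only for `k = l`, where
  -- nothing is to be shown.
  binom-mirror : ∀ m k l → k ℕ.≤ l → k ℕ.+ l ℕ.≤ m → binom m k ≤ binom m l
  binom-mirror zero    zero    zero    _         _ = ℤₚ.≤-refl
  binom-mirror (suc m) zero    zero    _         _ = ℤₚ.≤-refl
  binom-mirror (suc m) zero    (suc l) _         (s≤s l≤m) =
    subst (_≤ binom (suc m) (suc l)) (ℤₚ.+-comm 0ℤ (binom m 0))
      (ℤₚ.+-mono-≤ (binom-nonneg m (suc l)) (binom-mirror m 0 l z≤n l≤m))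
  binom-mirror (suc m) (suc k) (suc l) (s≤s k≤l) (s≤s p) with suc k ℕₚ.≤? l
  ... | yes k<l = subst (binom (suc m) (suc k) ≤_) (ℤₚ.+-comm (binom m l) (binom m (suc l)))
                    (ℤₚ.+-mono-≤ (binom-mirror m (suc k) l k<l (subst (ℕ._≤ m) (ℕₚ.+-suc k l) p))
                                 (binom-mirror m k (suc l) (ℕₚ.m≤n⇒m≤1+n k≤l) p))
  ... | no  k≮l with ℕₚ.≤-antisym k≤l (ℕₚ.≮⇒≥ k≮l)
  ...   | refl = ℤₚ.≤-refl

  gen-mirror : ∀ j m k l → k ℕ.≤ l → k ℕ.+ l ℕ.≤ 2 ℕ.* j ℕ.+ m →
               iter shift j (binom m) k ≤ iter shift j (binom m) l
  gen-mirror zero    m k       l       k≤l       p = binom-mirror m k l k≤l p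
  gen-mirror (suc j) m zero    l       k≤l       p = gen-nonneg (suc j) m l
  gen-mirror (suc j) m (suc k) (suc l) (s≤s k≤l) p =
    gen-mirror j m k l k≤l (ℕ.s≤s⁻¹ (ℕ.s≤s⁻¹ (subst₂ ℕ._≤_ (lhs k l) (rhs j m) p)))
    where
    lhs : ∀ k l → (1 ℕ.+ k) ℕ.+ (1 ℕ.+ l) ≡ 2 ℕ.+ (k ℕ.+ l)
    lhs = ℕ-solve-∀
    rhs : ∀ j m → 2 ℕ.* (1 ℕ.+ j) ℕ.+ m ≡ 2 ℕ.+ (2 ℕ.* j ℕ.+ m)
    rhs = ℕ-solve-∀

  cone-mirror : ∀ {d a} → Cone d a → ∀ k l → k ℕ.≤ l → k ℕ.+ l ℕ.≤ d → a k ≤ a l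
  cone-mirror (gen j m q) k l k≤l p = gen-mirror j m k l k≤l (ℕₚ.≤-trans p q)
  cone-mirror nil         k l k≤l p = ℤₚ.≤-refl
  cone-mirror (add q r)   k l k≤l p = ℤₚ.+-mono-≤ (cone-mirror q k l k≤l p) (cone-mirror r k l k≤l p)
  cone-mirror (resp e q)  k l k≤l p = subst₂ _≤_ (e k) (e l) (cone-mirror q k l k≤l p)

  -- Over the integers the identity persists beyond the top degree, where `m - i` is not positive
  -- and both sides vanish.
  binom-step : ∀ m i → + suc i * binom m (suc i) ≡ (+ m - + i) * binom m i
  binom-step zero zero    = refl
  binom-step zero (suc i) = trans (ℤₚ.*-zeroʳ (+ suc (suc i))) (sym (ℤₚ.*-zeroʳ (0ℤ - + suc i)))
  binom-step (suc m) zero = lemma (+ m) (binom m 1) (binom m 0) (binom-step m 0)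
    where
    expand : ∀ m p₀ → 1ℤ * p₀ + (m - 0ℤ) * p₀ ≡ (1ℤ + m - 0ℤ) * (p₀ + 0ℤ)
    expand = solve-∀
    lemma : ∀ m p₁ p₀ → 1ℤ * p₁ ≡ (m - 0ℤ) * p₀ → 1ℤ * (p₁ + p₀) ≡ (1ℤ + m - 0ℤ) * (p₀ + 0ℤ)
    lemma m p₁ p₀ e = trans (ℤₚ.*-distribˡ-+ 1ℤ p₁ p₀)
      (trans (ℤₚ.+-comm (1ℤ * p₁) (1ℤ * p₀)) (trans (cong (_+_ (1ℤ * p₀)) e) (expand m p₀)))
  binom-step (suc m) (suc i) = lemma (+ m) (+ i) (binom m (2 ℕ.+ i)) (binom m (suc i)) (binom m i)
                                 (binom-step m (suc i)) (binom-step m i)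
    where
    expand₁ : ∀ m i p₁ → (m - (1ℤ + i)) * p₁ + (1ℤ + (1ℤ + i)) * p₁ ≡ (m - i) * p₁ + (1ℤ + i) * p₁
    expand₁ = solve-∀
    expand₂ : ∀ m i p₁ p₀ → (m - i) * p₁ + (m - i) * p₀ ≡ (1ℤ + m - (1ℤ + i)) * (p₁ + p₀)
    expand₂ = solve-∀
    lemma : ∀ m i p₂ p₁ p₀ → (1ℤ + (1ℤ + i)) * p₂ ≡ (m - (1ℤ + i)) * p₁ → (1ℤ + i) * p₁ ≡ (m - i) * p₀ →
            (1ℤ + (1ℤ + i)) * (p₂ + p₁) ≡ (1ℤ + m - (1ℤ + i)) * (p₁ + p₀)
    lemma m i p₂ p₁ p₀ e₂ e₁ = trans (ℤₚ.*-distribˡ-+ (1ℤ + (1ℤ + i)) p₂ p₁)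
      (trans (cong (_+ ((1ℤ + (1ℤ + i)) * p₁)) e₂)
      (trans (expand₁ m i p₁) (trans (cong (_+_ ((m - i) * p₁)) e₁) (expand₂ m i p₁ p₀))))

  -- Local LYM inequality, in the form y_{x+1}/y_x ≥ (d - x)/(x + 1).
  gen-lym : ∀ k m d → d ℕ.≤ 2 ℕ.* k ℕ.+ m → ∀ x → 2 ℕ.* x ℕ.+ 1 ℕ.≤ d →
            (+ d - + x) * iter shift k (binom m) x ≤ + suc x * iter shift k (binom m) (suc x)
  gen-lym zero m d d≤m x _ = ℤₚ.≤-trans
    (ℤₚ.*-monoʳ-≤-nonNeg (binom m x) {{ℤ.nonNegative (binom-nonneg m x)}} (ℤₚ.+-monoˡ-≤ (ℤ.- + x) (+≤+ d≤m)))
    (ℤₚ.≤-reflexive (sym (binom-step m x)))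
  gen-lym (suc k) m d d≤ zero p =
    subst (_≤ 1ℤ * iter shift k (binom m) 0) (sym (ℤₚ.*-zeroʳ (+ d - + 0)))
      (subst (0ℤ ≤_) (sym (ℤₚ.*-identityˡ _)) (gen-nonneg k m 0))
  -- A factor `t` raises `d` by 2 and `x` by 1, so both coefficients of the inequality grow by 1.
  -- The extra terms compare two neighbors below the center, which is `gen-mirror`.
  gen-lym (suc k) m (suc (suc d)) d≤ (suc x) p =
    subst₂ _≤_ (lhs (+ d) (+ x) y₀) (rhs (+ x) y₁)
      (ℤₚ.+-mono-≤ (gen-lym k m d d≤′ x p′) (gen-mirror k m x (suc x) (ℕₚ.n≤1+n x) (ℕₚ.≤-trans (ℕₚ.≤-reflexive (idx x)) (ℕₚ.≤-trans p′ d≤′))))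
    where
    y₀ = iter shift k (binom m) x
    y₁ = iter shift k (binom m) (suc x)
    rhsN : ∀ k m → 2 ℕ.* (1 ℕ.+ k) ℕ.+ m ≡ 2 ℕ.+ (2 ℕ.* k ℕ.+ m)
    rhsN = ℕ-solve-∀
    lhsN : ∀ x → 2 ℕ.* (1 ℕ.+ x) ℕ.+ 1 ≡ 2 ℕ.+ (2 ℕ.* x ℕ.+ 1)
    lhsN = ℕ-solve-∀
    d≤′ : d ℕ.≤ 2 ℕ.* k ℕ.+ m
    d≤′ = ℕ.s≤s⁻¹ (ℕ.s≤s⁻¹ (subst (2 ℕ.+ d ℕ.≤_) (rhsN k m) d≤))
    p′ : 2 ℕ.* x ℕ.+ 1 ℕ.≤ d
    p′ = ℕ.s≤s⁻¹ (ℕ.s≤s⁻¹ (subst (ℕ._≤ 2 ℕ.+ d) (lhsN x) p))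
    idx : ∀ x → x ℕ.+ (1 ℕ.+ x) ≡ 2 ℕ.* x ℕ.+ 1
    idx = ℕ-solve-∀
    lhs : ∀ d x y → (d - x) * y + y ≡ (1ℤ + (1ℤ + d) - (1ℤ + x)) * y
    lhs = solve-∀
    rhs : ∀ x y → (1ℤ + x) * y + y ≡ (1ℤ + (1ℤ + x)) * y
    rhs = solve-∀
  gen-lym (suc k) m (suc zero) d≤ (suc x) (s≤s p) with subst (ℕ._≤ 0) (lemma x) p
    where
    lemma : ∀ x → x ℕ.+ (1 ℕ.+ x ℕ.+ 0) ℕ.+ 1 ≡ 2 ℕ.+ (2 ℕ.* x)
    lemma = ℕ-solve-∀
  ... | ()

  cone-lym : ∀ {d a} → Cone d a → ∀ x → 2 ℕ.* x ℕ.+ 1 ℕ.≤ d → (+ d - + x) * a x ≤ + suc x * a (suc x)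
  cone-lym {d} (gen k m q) x p = gen-lym k m d q x p
  cone-lym {d} nil         x p = ℤₚ.≤-reflexive (trans (ℤₚ.*-zeroʳ (+ d - + x)) (sym (ℤₚ.*-zeroʳ (+ suc x))))
  cone-lym {d} (add {a} {b} q r) x p =
    subst₂ _≤_ (sym (ℤₚ.*-distribˡ-+ (+ d - + x) (a x) (b x))) (sym (ℤₚ.*-distribˡ-+ (+ suc x) (a (suc x)) (b (suc x))))
      (ℤₚ.+-mono-≤ (cone-lym q x p) (cone-lym r x p))
  cone-lym {d} (resp e q)  x p =
    subst₂ _≤_ (cong ((+ d - + x) *_) (e x)) (cong (+ suc x *_) (e (suc x))) (cone-lym q x p)

-- Sums over colorings and over splittings of the vertex set.

module ColoringSums where

  open Sequences
  open import Data.Nat as ℕ using (ℕ; zero; suc; z≤n; s≤s; _∸_; _<_)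
  open import Data.Integer using (ℤ; _+_; _*_; 0ℤ; 1ℤ)
  import Data.Integer.Properties as ℤₚ
  open import Data.Integer.Tactic.RingSolver using (solve-∀)
  open import Data.Empty using (⊥-elim)
  open import Data.Product using (∃; _×_; _,_; proj₁; proj₂)
  open import Data.List using (List; []; _∷_; _++_; map)
  open import Data.List.Relation.Unary.Any using (here; there)
  open import Data.List.Membership.Propositional using (_∈_)
  open import Data.List.Relation.Binary.Permutation.Propositional using (_↭_; ↭-refl; ↭-sym; ↭-trans; prep; swap)
  import Data.List.Relation.Binary.Permutation.Propositional as Perm
  open import Data.List.Relation.Binary.Permutation.Propositional.Properties using () renaming (shift to ↭-shift)
  open import Function using (_∘_)
  open import Relation.Nullary using (Dec; yes; no; ¬_)
  open import Relation.Nullary.Decidable using (_×-dec_)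
  open import Relation.Binary.PropositionalEquality using (_≡_; _≗_; refl; sym; trans; cong; cong₂; module ≡-Reasoning)

  ind : ∀ {P : Set} → Dec P → ℤ
  ind (yes _) = 1ℤ
  ind (no _)  = 0ℤ

  ind-cong : ∀ {P Q : Set} (p? : Dec P) (q? : Dec Q) → (P → Q) → (Q → P) → ind p? ≡ ind q?
  ind-cong (yes p) (yes q) f g = refl
  ind-cong (yes p) (no ¬q) f g = ⊥-elim (¬q (f p))
  ind-cong (no ¬p) (yes q) f g = ⊥-elim (¬p (g q))
  ind-cong (no ¬p) (no ¬q) f g = refl

  ind-no : ∀ {P : Set} (p? : Dec P) → ¬ P → ind p? ≡ 0ℤ
  ind-no (yes p) ¬p = ⊥-elim (¬p p)
  ind-no (no _)  ¬p = refl

  ind-yes : ∀ {P : Set} (p? : Dec P) → P → ind p? ≡ 1ℤ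
  ind-yes (yes _) p = refl
  ind-yes (no ¬p) p = ⊥-elim (¬p p)

  ind-× : ∀ {P Q : Set} (p? : Dec P) (q? : Dec Q) → ind (p? ×-dec q?) ≡ ind p? * ind q?
  ind-× (yes p) (yes q) = refl
  ind-× (yes p) (no ¬q) = refl
  ind-× (no ¬p) q?      = refl

  sum< : ℕ → Seq → ℤ
  sum< zero    φ = 0ℤ
  sum< (suc x) φ = φ 0 + sum< x (φ ∘ suc)

  sum<-cong : ∀ x {φ ψ : Seq} → (∀ y → y < x → φ y ≡ ψ y) → sum< x φ ≡ sum< x ψ
  sum<-cong zero    p = refl
  sum<-cong (suc x) p = cong₂ _+_ (p 0 (s≤s z≤n)) (sum<-cong x (λ y y<x → p (suc y) (s≤s y<x)))

  sum<-+ : ∀ x (φ ψ : Seq) → sum< x (φ ⊕ ψ) ≡ sum< x φ + sum< x ψ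
  sum<-+ zero    φ ψ = refl
  sum<-+ (suc x) φ ψ rewrite sum<-+ x (φ ∘ suc) (ψ ∘ suc) = lemma (φ 0) (ψ 0) (sum< x (φ ∘ suc)) (sum< x (ψ ∘ suc))
    where
    lemma : ∀ a b c d → a + b + (c + d) ≡ a + c + (b + d)
    lemma = solve-∀

  sum<-0 : ∀ x → sum< x (λ _ → 0ℤ) ≡ 0ℤ
  sum<-0 zero    = refl
  sum<-0 (suc x) = trans (ℤₚ.+-identityˡ _) (sum<-0 x)

  sum<-*ˡ : ∀ x c (φ : Seq) → sum< x (λ y → c * φ y) ≡ c * sum< x φ
  sum<-*ˡ zero    c φ = sym (ℤₚ.*-zeroʳ c)
  sum<-*ˡ (suc x) c φ = trans (cong (_+_ (c * φ 0)) (sum<-*ˡ x c (φ ∘ suc))) (sym (ℤₚ.*-distribˡ-+ c (φ 0) _))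

  sum<-swap : ∀ x y (φ : ℕ → ℕ → ℤ) → sum< x (λ i → sum< y (φ i)) ≡ sum< y (λ j → sum< x (λ i → φ i j))
  sum<-swap zero    y φ = sym (sum<-0 y)
  sum<-swap (suc x) y φ = trans (cong (_+_ (sum< y (φ 0))) (sum<-swap x y (φ ∘ suc)))
                                (sym (sum<-+ y (φ 0) (λ j → sum< x (λ i → φ (suc i) j))))

  sum<-split : ∀ x y (φ : Seq) → sum< (x ℕ.+ y) φ ≡ sum< x φ + sum< y (λ z → φ (x ℕ.+ z))
  sum<-split zero    y φ = sym (ℤₚ.+-identityˡ _)
  sum<-split (suc x) y φ = trans (cong (_+_ (φ 0)) (sum<-split x y (φ ∘ suc))) (sym (ℤₚ.+-assoc (φ 0) _ _))

  -- Discards the constant term. For counts of colorings this matters only without vertices, where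
  -- the empty coloring is counted even with no colors. It appears in `sum<-conv` because `y < x`
  -- makes `x ∸ y` positive.
  positivePart : Seq → Seq
  positivePart a zero    = 0ℤ
  positivePart a (suc i) = a (suc i)

  sum<-conv : ∀ f g x → sum< x (λ y → f y * g (x ∸ y)) ≡ conv f (positivePart g) x
  sum<-conv f g zero    = sym (ℤₚ.*-zeroʳ (f 0))
  sum<-conv f g (suc x) = cong (_+_ (f 0 * g (suc x))) (sum<-conv (f ∘ suc) g x)

  conv-δ₀ʳ : ∀ a → conv a δ₀ ≗ a
  conv-δ₀ʳ a zero    = ℤₚ.*-identityʳ (a 0)
  conv-δ₀ʳ a (suc n) = trans (cong₂ _+_ (ℤₚ.*-zeroʳ (a 0)) (conv-δ₀ʳ (a ∘ suc) n)) (ℤₚ.+-identityˡ _)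

  module _ {X : Set} where

    Coloring : Set
    Coloring = List (X × ℕ)

    sumCol : List X → ℕ → (Coloring → ℤ) → ℤ
    sumCol []      x φ = φ []
    sumCol (v ∷ L) x φ = sum< x (λ y → sumCol L x (λ c → φ ((v , y) ∷ c)))

    data Colored (x : ℕ) : List X → Coloring → Set where
      []  : Colored x [] []
      _∷_ : ∀ {v y L c} → y < x → Colored x L c → Colored x (v ∷ L) ((v , y) ∷ c)

    colored-bound : ∀ {x L c v y} → Colored x L c → (v , y) ∈ c → v ∈ L × y < x
    colored-bound (y<x ∷ C) (here refl) = here refl , y<x
    colored-bound (y<x ∷ C) (there p)   = there (proj₁ (colored-bound C p)) , proj₂ (colored-bound C p)

    colored-color : ∀ {x L c v} → Colored x L c → v ∈ L → ∃ λ y → (v , y) ∈ c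
    colored-color (y<x ∷ C) (here refl) = _ , here refl
    colored-color (y<x ∷ C) (there p)   = proj₁ (colored-color C p) , there (proj₂ (colored-color C p))

    sumCol-cong : ∀ L x {φ ψ : Coloring → ℤ} → (∀ c → Colored x L c → φ c ≡ ψ c) → sumCol L x φ ≡ sumCol L x ψ
    sumCol-cong []      x p = p [] []
    sumCol-cong (v ∷ L) x p = sum<-cong x (λ y y<x → sumCol-cong L x (λ c C → p ((v , y) ∷ c) (y<x ∷ C)))

    sumCol-0 : ∀ L x → sumCol L x (λ _ → 0ℤ) ≡ 0ℤ
    sumCol-0 []      x = refl
    sumCol-0 (v ∷ L) x = trans (sum<-cong x (λ _ _ → sumCol-0 L x)) (sum<-0 x)

    sumCol-*ˡ : ∀ L x k φ → sumCol L x (λ c → k * φ c) ≡ k * sumCol L x φ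
    sumCol-*ˡ []      x k φ = refl
    sumCol-*ˡ (v ∷ L) x k φ = trans (sum<-cong x (λ y _ → sumCol-*ˡ L x k (λ c → φ ((v , y) ∷ c)))) (sum<-*ˡ x k _)

    sum<-sumCol : ∀ w L x (φ : ℕ → Coloring → ℤ) →
                  sum< w (λ y → sumCol L x (φ y)) ≡ sumCol L x (λ c → sum< w (λ y → φ y c))
    sum<-sumCol w []      x φ = refl
    sum<-sumCol w (v ∷ L) x φ = trans (sum<-swap w x _) (sum<-cong x (λ y _ → sum<-sumCol w L x _))

    Symmetric : (Coloring → ℤ) → Set
    Symmetric φ = ∀ {c c′} → c ↭ c′ → φ c ≡ φ c′

    sumCol-↭ : ∀ {L L′} x {φ} → Symmetric φ → L ↭ L′ → sumCol L x φ ≡ sumCol L′ x φ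
    sumCol-↭ x φ-sym Perm.refl = refl
    sumCol-↭ x φ-sym (prep v p) = sum<-cong x (λ y _ → sumCol-↭ x (φ-sym ∘ prep (v , y)) p)
    sumCol-↭ {L = u ∷ v ∷ L} {L′ = _ ∷ _ ∷ L′} x {φ} φ-sym (swap u v p) =
      trans (sum<-swap x x _)
            (sum<-cong x (λ y _ → sum<-cong x (λ z _ →
              trans (sumCol-↭ x (φ-sym ∘ prep (u , z) ∘ prep (v , y)) p)
                    (sumCol-cong L′ x (λ c _ → φ-sym (swap (u , z) (v , y) ↭-refl))))))
    sumCol-↭ x φ-sym (Perm.trans p q) = trans (sumCol-↭ x φ-sym p) (sumCol-↭ x φ-sym q)

    sumSplit : List X → (List X → List X → ℤ) → ℤ
    sumSplit []      φ = φ [] []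
    sumSplit (u ∷ L) φ = sumSplit L (λ S T → φ (u ∷ S) T) + sumSplit L (λ S T → φ S (u ∷ T))

    sumSplit-cong : ∀ L {φ ψ : List X → List X → ℤ} → (∀ S T → S ++ T ↭ L → φ S T ≡ ψ S T) → sumSplit L φ ≡ sumSplit L ψ
    sumSplit-cong []      p = p [] [] ↭-refl
    sumSplit-cong (u ∷ L) p =
      cong₂ _+_ (sumSplit-cong L (λ S T q → p (u ∷ S) T (prep u q)))
                (sumSplit-cong L (λ S T q → p S (u ∷ T) (↭-trans (↭-shift u S T) (prep u q))))

    sum<-sumSplit : ∀ w L (φ : ℕ → List X → List X → ℤ) →
                    sum< w (λ y → sumSplit L (φ y)) ≡ sumSplit L (λ S T → sum< w (λ y → φ y S T))
    sum<-sumSplit w []      φ = refl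
    sum<-sumSplit w (u ∷ L) φ = trans (sum<-+ w _ _) (cong₂ _+_ (sum<-sumSplit w L _) (sum<-sumSplit w L _))

    iterΔ-sumSplit : ∀ n L (φ : List X → List X → Seq) →
                     iter Δ n (λ x → sumSplit L (λ S T → φ S T x)) ≗ (λ x → sumSplit L (λ S T → iter Δ n (φ S T) x))
    iterΔ-sumSplit n []      φ x = refl
    iterΔ-sumSplit n (u ∷ L) φ x = trans (iterΔ-⊕ n _ _ x)
      (cong₂ _+_ (iterΔ-sumSplit n L (λ S T → φ (u ∷ S) T) x) (iterΔ-sumSplit n L (λ S T → φ S (u ∷ T)) x))

    cone-sumSplit : ∀ {d} L (φ : List X → List X → Seq) → (∀ S T → S ++ T ↭ L → Cone d (φ S T)) →
                    Cone d (λ x → sumSplit L (λ S T → φ S T x))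
    cone-sumSplit []      φ p = p [] [] ↭-refl
    cone-sumSplit (u ∷ L) φ p =
      add (cone-sumSplit L (λ S T → φ (u ∷ S) T) (λ S T q → p (u ∷ S) T (prep u q)))
          (cone-sumSplit L (λ S T → φ S (u ∷ T)) (λ S T q → p S (u ∷ T) (↭-trans (↭-shift u S T) (prep u q))))

    nonemptyˡ : (List X → List X → ℤ) → List X → List X → ℤ
    nonemptyˡ φ []      T = 0ℤ
    nonemptyˡ φ (s ∷ S) T = φ (s ∷ S) T

    nonemptyʳ : (List X → List X → ℤ) → List X → List X → ℤ
    nonemptyʳ φ S []      = 0ℤ
    nonemptyʳ φ S (t ∷ T) = φ S (t ∷ T)

    -- With `sumSplit-nonemptyʳ` it isolates the extreme splittings: in `cone-hPoly-∅` the one with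
    -- empty `S` has too small a weight by itself and is paired with the one with empty `T`.
    sumSplit-nonemptyˡ : ∀ L φ → sumSplit L φ ≡ φ [] L + sumSplit L (nonemptyˡ φ)
    sumSplit-nonemptyˡ []      φ = sym (ℤₚ.+-identityʳ _)
    sumSplit-nonemptyˡ (u ∷ L) φ = begin
      p + sumSplit L ψ ≡⟨ cong (_+_ p) (sumSplit-nonemptyˡ L ψ) ⟩
      p + (ψ [] L + sumSplit L (nonemptyˡ ψ)) ≡⟨ cong (λ q → p + (ψ [] L + q)) (sumSplit-cong L same) ⟩
      p + (ψ [] L + q) ≡⟨ lemma p (ψ [] L) q ⟩
      ψ [] L + (p + q) ∎
      where
      open ≡-Reasoning
      ψ : List X → List X → ℤ
      ψ S T = φ S (u ∷ T)
      p = sumSplit L (λ S T → φ (u ∷ S) T)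
      q = sumSplit L (λ S T → nonemptyˡ φ S (u ∷ T))
      same : ∀ S T → S ++ T ↭ L → nonemptyˡ ψ S T ≡ nonemptyˡ φ S (u ∷ T)
      same []      T _ = refl
      same (s ∷ S) T _ = refl
      lemma : ∀ a b c → a + (b + c) ≡ b + (a + c)
      lemma = solve-∀

    sumSplit-nonemptyʳ : ∀ L φ → sumSplit L φ ≡ φ L [] + sumSplit L (nonemptyʳ φ)
    sumSplit-nonemptyʳ []      φ = sym (ℤₚ.+-identityʳ _)
    sumSplit-nonemptyʳ (u ∷ L) φ = begin
      sumSplit L ψ + p ≡⟨ cong (_+ p) (sumSplit-nonemptyʳ L ψ) ⟩
      ψ L [] + sumSplit L (nonemptyʳ ψ) + p ≡⟨ cong (λ q → ψ L [] + q + p) (sumSplit-cong L same) ⟩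
      ψ L [] + q + p ≡⟨ ℤₚ.+-assoc (ψ L []) q p ⟩
      ψ L [] + (q + p) ∎
      where
      open ≡-Reasoning
      ψ : List X → List X → ℤ
      ψ S T = φ (u ∷ S) T
      p = sumSplit L (λ S T → φ S (u ∷ T))
      q = sumSplit L (λ S T → nonemptyʳ φ (u ∷ S) T)
      same : ∀ S T → S ++ T ↭ L → nonemptyʳ ψ S T ≡ nonemptyʳ φ (u ∷ S) T
      same S []      _ = refl
      same S (t ∷ T) _ = refl

    raise : ℕ → Coloring → Coloring
    raise y = map (λ p → proj₁ p , y ℕ.+ proj₂ p)

    -- `S` collects the vertices with colors below `y` and `T` the others, whose colors are lowered
    -- by `y`. Symmetry of `φ` is used because the two parts are concatenated instead of interleaved
    -- in the order of `L`.
    sumCol-split : ∀ L y z φ → Symmetric φ →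
      sumCol L (y ℕ.+ z) φ ≡ sumSplit L (λ S T → sumCol S y (λ a → sumCol T z (λ b → φ (a ++ raise y b))))
    sumCol-split []      y z φ φ-sym = refl
    sumCol-split (u ∷ L) y z φ φ-sym = begin
      sum< (y ℕ.+ z) f ≡⟨ sum<-split y z f ⟩
      sum< y f + sum< z (λ w → f (y ℕ.+ w)) ≡⟨ cong₂ _+_ low high ⟩
      _ ∎
      where
      open ≡-Reasoning
      f : ℕ → ℤ
      f w = sumCol L (y ℕ.+ z) (λ c → φ ((u , w) ∷ c))
      low : sum< y f ≡ sumSplit L (λ S T → sumCol (u ∷ S) y (λ a → sumCol T z (λ b → φ (a ++ raise y b))))
      low = trans (sum<-cong y (λ w _ → sumCol-split L y z _ (φ-sym ∘ prep (u , w)))) (sum<-sumSplit y L _)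
      high : sum< z (λ w → f (y ℕ.+ w)) ≡ sumSplit L (λ S T → sumCol S y (λ a → sumCol (u ∷ T) z (λ b → φ (a ++ raise y b))))
      high = trans (sum<-cong z (λ w _ → sumCol-split L y z _ (φ-sym ∘ prep (u , y ℕ.+ w))))
        (trans (sum<-sumSplit z L _)
        (sumSplit-cong L (λ S T _ → trans (sum<-sumCol z S y _)
          (sumCol-cong S y (λ a _ → sum<-cong z (λ w _ → sumCol-cong T z (λ b _ →
            φ-sym (↭-sym (↭-shift (u , y ℕ.+ w) a (raise y b))))))))))

-- Strict colorings of a digraph and the recursion at a sink.

module StrictColorings where

  open Sequences
  open ColoringSums
  open import Data.Nat as ℕ using (ℕ; zero; suc; z≤n; s≤s; _∸_; _<_)
  import Data.Nat.Properties as ℕₚ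
  open import Data.Integer using (ℤ; _+_; _*_; 0ℤ; 1ℤ)
  import Data.Integer.Properties as ℤₚ
  open import Data.Empty using (⊥; ⊥-elim)
  open import Data.Product using (∃; _×_; _,_; proj₁; proj₂)
  open import Data.Sum using (_⊎_; inj₁; inj₂)
  open import Data.List using (List; []; _∷_; _++_; length)
  import Data.List.Properties as Listₚ
  open import Data.List.Relation.Unary.All as All using (all?)
  open import Data.List.Relation.Unary.Any as Any using (here; there; any?)
  open import Data.List.Membership.Propositional using (_∈_; find; lose)
  open import Data.List.Membership.Propositional.Properties using (∈-++⁺ˡ; ∈-++⁺ʳ; ∈-++⁻; ∈-map⁺; ∈-map⁻; ∈-∃++)
  open import Data.List.Relation.Binary.Permutation.Propositional using (_↭_; ↭-sym; ↭-trans; prep)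
  open import Data.List.Relation.Binary.Permutation.Propositional.Properties using (∈-resp-↭; ↭-length) renaming (shift to ↭-shift)
  open import Function using (_∘_)
  open import Relation.Nullary using (Dec; yes; no; ¬_; ¬?)
  open import Relation.Nullary.Decidable using (map′; _×-dec_; _→-dec_; _⊎-dec_)
  open import Relation.Binary.PropositionalEquality using (_≡_; _≗_; refl; sym; trans; cong; cong₂; subst; module ≡-Reasoning)

  ∀∈? : ∀ {Y : Set} {P : Y → Set} → (∀ y → Dec (P y)) → (L : List Y) → Dec (∀ {y} → y ∈ L → P y)
  ∀∈? P? L = map′ All.lookup (λ f → All.tabulate f) (all? P? L)

  -- A decidable set of vertices. A marked vertex may not have the color 0, which encodes an edge to
  -- the ground.
  record Marked (X : Set) : Set₁ where
    field
      Mem  : X → Set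
      mem? : ∀ v → Dec (Mem v)

  open Marked

  module Strict {X : Set} (R : X → X → Set) (R? : ∀ u v → Dec (R u v)) where

    Marks : Set₁
    Marks = Marked X

    Increasing : Coloring → Set
    Increasing c = ∀ {p} → p ∈ c → ∀ {q} → q ∈ c → R (proj₁ p) (proj₁ q) → proj₂ p < proj₂ q

    Nonzero : Marks → Coloring → Set
    Nonzero U c = ∀ {p} → p ∈ c → Mem U (proj₁ p) → 1 ℕ.≤ proj₂ p

    Legal : Marks → Coloring → Set
    Legal U c = Increasing c × Nonzero U c

    abstract
     Legal? : ∀ U c → Dec (Legal U c)
     Legal? U c = ∀∈? (λ p → ∀∈? (λ q → R? (proj₁ p) (proj₁ q) →-dec (proj₂ p ℕₚ.<? proj₂ q)) c) c
                 ×-dec ∀∈? (λ p → mem? U (proj₁ p) →-dec (1 ℕₚ.≤? proj₂ p)) c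

    Legal-↭ : ∀ {U c c′} → c ↭ c′ → Legal U c → Legal U c′
    Legal-↭ π (inc , pos) = (λ p∈ q∈ → inc (∈-resp-↭ (↭-sym π) p∈) (∈-resp-↭ (↭-sym π) q∈)) , (λ p∈ → pos (∈-resp-↭ (↭-sym π) p∈))

    legalInd : Marks → Coloring → ℤ
    legalInd U c = ind (Legal? U c)

    legalInd-sym : ∀ (U : Marks) → Symmetric (legalInd U)
    legalInd-sym U π = ind-cong (Legal? U _) (Legal? U _) (Legal-↭ {U} π) (Legal-↭ {U} (↭-sym π))

    count : Marks → List X → Seq
    count U L x = sumCol L x (legalInd U)

    count⁺ : Marks → List X → Seq
    count⁺ U L = positivePart (count U L)

    count-↭ : ∀ (U : Marks) {L L′} → L ↭ L′ → count U L ≗ count U L′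
    count-↭ U π x = sumCol-↭ x (legalInd-sym U) π

    ∅ : Marks
    ∅ = record { Mem = λ _ → ⊥ ; mem? = λ _ → no λ () }

    -- An arc from `T` to `v` or to `S` would lead from a color at least `y` to a color at most `y`.
    -- Arcs from `S` to `v` or `T` increase automatically and a sink has no outgoing arcs, so the
    -- condition depends on the splitting alone.
    Compatible : X → List X → List X → Set
    Compatible v S T = (∀ {u} → u ∈ T → ¬ R u v) × (∀ {u} → u ∈ T → ∀ {w} → w ∈ S → ¬ R u w)

    abstract
     Compatible? : ∀ v S T → Dec (Compatible v S T)
     Compatible? v S T = ∀∈? (λ u → ¬? (R? u v)) T ×-dec ∀∈? (λ u → ∀∈? (λ w → ¬? (R? u w)) S) T

    Sink : X → List X → Set
    Sink v L = ∀ {w} → w ∈ L → ¬ R v w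

    -- If v is a sink, a strict coloring is cut by the color y of v into the colorings of
    -- S = {c < y} and T = {c ≥ y}; the weak inequality on T needs no independence condition.
    module _ {U : Marks} {v : X} {y z : ℕ} {S T a b} (A : Colored y S a) (B : Colored z T b)
             (sink : Sink v (v ∷ (S ++ T))) (U⇒ : ∀ u → Mem U u → 1 ℕ.≤ y) where

      whole : Coloring
      whole = (v , y) ∷ (a ++ raise y b)

      data Part : X × ℕ → Set where
        pivot : Part (v , y)
        below : ∀ {u c} → (u , c) ∈ a → Part (u , c)
        above : ∀ {u c} → (u , c) ∈ b → Part (u , y ℕ.+ c)

      part : ∀ {p} → p ∈ whole → Part p
      part (here refl) = pivot
      part (there p) with ∈-++⁻ a p
      ... | inj₁ q = below q
      ... | inj₂ q with ∈-map⁻ _ q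
      ...   | (u , c) , r , refl = above r

      part⁻¹ : ∀ {p} → Part p → p ∈ whole
      part⁻¹ pivot     = here refl
      part⁻¹ (below q) = there (∈-++⁺ˡ q)
      part⁻¹ (above q) = there (∈-++⁺ʳ a (∈-map⁺ _ q))

      legal-split : Legal U whole → Compatible v S T × Legal U a × Legal ∅ b
      legal-split (inc , pos) =
        ((λ u∈T r → let (c , m) = colored-color B u∈T in
            ℕₚ.m+n≮m y c (inc (part⁻¹ (above m)) (part⁻¹ pivot) r))
        , (λ u∈T w∈S r → let (c , m) = colored-color B u∈T ; (d , m′) = colored-color A w∈S in
            ℕₚ.m+n≮m y c (ℕₚ.<-trans (inc (part⁻¹ (above m)) (part⁻¹ (below m′)) r) (proj₂ (colored-bound A m′)))))
        , ((λ p∈ q∈ → inc (part⁻¹ (below p∈)) (part⁻¹ (below q∈))) , (λ p∈ → pos (part⁻¹ (below p∈))))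
        , ((λ p∈ q∈ r → ℕₚ.+-cancelˡ-< y _ _ (inc (part⁻¹ (above p∈)) (part⁻¹ (above q∈)) r)) , (λ _ ()))

      legal-glue : Compatible v S T × Legal U a × Legal ∅ b → Legal U whole
      legal-glue ((T↛v , T↛S) , (inc-a , pos-a) , (inc-b , _)) =
        (λ p∈ q∈ r → inc (part p∈) (part q∈) r) , (λ p∈ u → pos (part p∈) u)
        where
        inc : ∀ {p q} → Part p → Part q → R (proj₁ p) (proj₁ q) → proj₂ p < proj₂ q
        inc pivot     pivot     r = ⊥-elim (sink (here refl) r)
        inc pivot     (below q) r = ⊥-elim (sink (there (∈-++⁺ˡ (proj₁ (colored-bound A q)))) r)
        inc pivot     (above q) r = ⊥-elim (sink (there (∈-++⁺ʳ S (proj₁ (colored-bound B q)))) r)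
        inc (below p) pivot     r = proj₂ (colored-bound A p)
        inc (below p) (below q) r = inc-a p q r
        inc (below p) (above q) r = ℕₚ.≤-trans (proj₂ (colored-bound A p)) (ℕₚ.m≤m+n y _)
        inc (above p) pivot     r = ⊥-elim (T↛v (proj₁ (colored-bound B p)) r)
        inc (above p) (below q) r = ⊥-elim (T↛S (proj₁ (colored-bound B p)) (proj₁ (colored-bound A q)) r)
        inc (above p) (above q) r = ℕₚ.+-monoʳ-< y (inc-b p q r)
        pos : ∀ {p} → Part p → Mem U (proj₁ p) → 1 ℕ.≤ proj₂ p
        pos pivot     u = U⇒ _ u
        pos (below p) u = pos-a p u
        pos (above p) u = ℕₚ.≤-trans (U⇒ _ u) (ℕₚ.m≤m+n y _)

    compatInd : X → List X → List X → ℤ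
    compatInd v S T = ind (Compatible? v S T)

    splitTerm : ∀ (U : Marks) → X → ℕ → ℕ → List X → List X → ℤ
    splitTerm U v y z S T = sumCol S y (λ a → sumCol T z (λ b → legalInd U ((v , y) ∷ (a ++ raise y b))))

    -- The upper part carries no marks: its actual colors are at least `y`, and `y` is positive as
    -- soon as any vertex is marked.
    splitTerm-factor : ∀ (U : Marks) v y z S T → Sink v (v ∷ (S ++ T)) → (∀ u → Mem U u → 1 ℕ.≤ y) →
      splitTerm U v y z S T ≡ compatInd v S T * (count U S y * count ∅ T z)
    splitTerm-factor U v y z S T sink U⇒ = begin
      splitTerm U v y z S T
        ≡⟨ sumCol-cong S y (λ a A → sumCol-cong T z (λ b B → trans
             (ind-cong (Legal? U _) (Compatible? v S T ×-dec (Legal? U a ×-dec Legal? ∅ b))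
               (legal-split {U} A B sink U⇒) (legal-glue {U} A B sink U⇒))
             (trans (ind-× (Compatible? v S T) _) (cong (_*_ k) (ind-× (Legal? U a) (Legal? ∅ b)))))) ⟩
      sumCol S y (λ a → sumCol T z (λ b → k * (legalInd U a * legalInd ∅ b)))
        ≡⟨ sumCol-cong S y (λ a _ → trans (sumCol-*ˡ T z k _) (cong (_*_ k) (trans (sumCol-*ˡ T z (legalInd U a) _) (ℤₚ.*-comm (legalInd U a) _)))) ⟩
      sumCol S y (λ a → k * (count ∅ T z * legalInd U a))
        ≡⟨ trans (sumCol-*ˡ S y k _) (cong (_*_ k) (trans (sumCol-*ˡ S y (count ∅ T z) _) (ℤₚ.*-comm (count ∅ T z) _))) ⟩
      k * (count U S y * count ∅ T z) ∎
      where
      open ≡-Reasoning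
      k = compatInd v S T

    -- `G` is left open because the lower part needs different series: `count ∅` if `v` may have the
    -- color 0, and `count⁺ U` if it may not.
    count-pivot : ∀ (U : Marks) v L (G : List X → Seq) →
      (∀ y z S T → S ++ T ↭ L → splitTerm U v y z S T ≡ compatInd v S T * (G S y * count ∅ T z)) →
      count U (v ∷ L) ≗ (λ x → sumSplit L (λ S T → compatInd v S T * conv (G S) (count⁺ ∅ T) x))
    count-pivot U v L G term x = begin
      sum< x (λ y → sumCol L x (λ c → legalInd U ((v , y) ∷ c)))
        ≡⟨ sum<-cong x (λ y y<x → trans
             (cong (λ w → sumCol L w (λ c → legalInd U ((v , y) ∷ c))) (sym (ℕₚ.m+[n∸m]≡n (ℕₚ.<⇒≤ y<x))))
             (sumCol-split L y (x ∸ y) _ (legalInd-sym U ∘ prep (v , y)))) ⟩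
      sum< x (λ y → sumSplit L (splitTerm U v y (x ∸ y)))
        ≡⟨ sum<-sumSplit x L _ ⟩
      sumSplit L (λ S T → sum< x (λ y → splitTerm U v y (x ∸ y) S T))
        ≡⟨ sumSplit-cong L (λ S T π → trans (sum<-cong x (λ y _ → term y (x ∸ y) S T π))
             (trans (sum<-*ˡ x (compatInd v S T) _) (cong (_*_ (compatInd v S T)) (sum<-conv (G S) (count ∅ T) x)))) ⟩
      sumSplit L (λ S T → compatInd v S T * conv (G S) (count⁺ ∅ T) x) ∎
      where open ≡-Reasoning

    cone-ind : ∀ {d a} {P : Set} (p? : Dec P) → (P → Cone d a) → Cone d (scale (ind p?) a)
    cone-ind (yes p) f = resp (λ i → sym (ℤₚ.*-identityˡ _)) (f p)
    cone-ind (no _)  f = nil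

    -- From a vertex in `G` arcs can be followed forever, with strictly increasing colors, which
    -- contradicts the bound `x`. This covers directed cycles without exhibiting one.
    count-stuck : ∀ (U : Marks) L (G : X → Set) →
      (∀ {v} → v ∈ L → G v → ∃ λ w → w ∈ L × R v w × G w) → ∀ {v} → v ∈ L → G v → ∀ x → count U L x ≡ 0ℤ
    count-stuck U L G next v∈L g x =
      trans (sumCol-cong L x (λ c C → ind-no (Legal? U c) (λ leg → climb C leg x _ (proj₂ (colored-color C v∈L)) g (ℕₚ.m≤n+m x _))))
            (sumCol-0 L x)
      where
      climb : ∀ {c} → Colored x L c → Legal U c → ∀ k y {v} → (v , y) ∈ c → G v → x ℕ.≤ y ℕ.+ k → ⊥
      climb C leg zero    y m g x≤ = ℕₚ.<⇒≱ (proj₂ (colored-bound C m)) (subst (x ℕ.≤_) (ℕₚ.+-identityʳ y) x≤)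
      climb C leg (suc k) y m g x≤ with next (proj₁ (colored-bound C m)) g
      ... | w , w∈L , r , g′ with colored-color C w∈L
      ...   | y′ , m′ = climb C leg k y′ m′ g′ (ℕₚ.≤-trans (subst (x ℕ.≤_) (ℕₚ.+-suc y k) x≤)
                          (ℕₚ.+-monoˡ-≤ k (proj₁ leg m m′ r)))

    count-nonempty : ∀ (U : Marks) v L → count U (v ∷ L) ≗ count⁺ U (v ∷ L)
    count-nonempty U v L zero    = refl
    count-nonempty U v L (suc x) = refl

    count⁺-cong : ∀ (U V : Marks) {L L′} → count U L ≗ count V L′ → count⁺ U L ≗ count⁺ V L′
    count⁺-cong U V e zero    = refl
    count⁺-cong U V e (suc x) = e (suc x)

    count-[] : ∀ (U : Marks) → count U [] ≗ (λ _ → 1ℤ)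
    count-[] U x = ind-yes (Legal? U []) ((λ ()) , (λ ()))

    Δ-count-[] : ∀ (U : Marks) → Δ (count U []) ≗ δ₀
    Δ-count-[] U zero    rewrite count-[] U 0 = refl
    Δ-count-[] U (suc x) rewrite count-[] U (suc x) = refl

    -- Discarding zero colors changes the numerator of the empty list from `1`, of weight 0, to `t`,
    -- of weight 2. This is the weight gained when the pivot cannot have the color 0.
    Δ-count⁺-[] : ∀ (U : Marks) → Δ (count⁺ U []) ≗ shift δ₀
    Δ-count⁺-[] U zero          = refl
    Δ-count⁺-[] U (suc zero)    rewrite count-[] U 1 = refl
    Δ-count⁺-[] U (suc (suc x)) rewrite count-[] U (suc (suc x)) = refl

    hPoly : Marks → List X → Seq
    hPoly U L = iter Δ (suc (length L)) (count⁺ U L)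

    hPoly-↭ : ∀ (U : Marks) {L L′} → L ↭ L′ → hPoly U L ≗ hPoly U L′
    hPoly-↭ U {L} {L′} π i = trans (cong (λ n → iter Δ (suc n) (count⁺ U L) i) (↭-length π))
      (iter-cong Δ-cong (suc (length L′)) (count⁺-cong U U {L} {L′} (count-↭ U π)) i)

    lengths : ∀ {v : X} {L} S T → S ++ T ↭ L → suc (length (v ∷ L)) ≡ suc (length S) ℕ.+ suc (length T)
    lengths S T π = cong suc (trans (cong suc (trans (sym (↭-length π)) (Listₚ.length-++ S))) (sym (ℕₚ.+-suc (length S) (length T))))

    extract : ∀ {v : X} {L} → v ∈ L → ∃ λ L′ → L ↭ v ∷ L′
    extract v∈L with ∈-∃++ v∈L
    ... | A , B , refl = A ++ B , ↭-shift _ A B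

    hPoly-pivot : ∀ (U : Marks) v L (G : List X → Seq) →
      (∀ y z S T → S ++ T ↭ L → splitTerm U v y z S T ≡ compatInd v S T * (G S y * count ∅ T z)) →
      hPoly U (v ∷ L) ≗ (λ x → sumSplit L (λ S T → compatInd v S T * conv (iter Δ (suc (length S)) (G S)) (hPoly ∅ T) x))
    hPoly-pivot U v L G term i = begin
      iter Δ n (count⁺ U (v ∷ L)) i
        ≡⟨ iter-cong Δ-cong n (λ x → trans (sym (count-nonempty U v L x)) (count-pivot U v L G term x)) i ⟩
      iter Δ n (λ x → sumSplit L (λ S T → compatInd v S T * conv (G S) (count⁺ ∅ T) x)) i
        ≡⟨ iterΔ-sumSplit n L _ i ⟩
      sumSplit L (λ S T → iter Δ n (scale (compatInd v S T) (conv (G S) (count⁺ ∅ T))) i)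
        ≡⟨ sumSplit-cong L (λ S T π → trans (iterΔ-scale n (compatInd v S T) _ i)
             (cong (_*_ (compatInd v S T)) (trans (cong (λ m → iter Δ m (conv (G S) (count⁺ ∅ T)) i) (lengths {v} S T π))
               (iterΔ-conv (suc (length S)) (suc (length T)) (G S) (count⁺ ∅ T) i)))) ⟩
      _ ∎
      where
      open ≡-Reasoning
      n = suc (length (v ∷ L))

    sublengths : ∀ {m} {L : List X} S T → S ++ T ↭ L → length L ℕ.≤ m → length S ℕ.≤ m × length T ℕ.≤ m
    sublengths S T π l = ℕₚ.≤-trans (ℕₚ.m≤m+n _ _) l′ , ℕₚ.≤-trans (ℕₚ.m≤n+m _ (length S)) l′
      where l′ = subst (ℕ._≤ _) (trans (sym (↭-length π)) (Listₚ.length-++ S)) l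

    -- At a sink `v`, splittings with both parts nonempty have the weight `(|S|+1) + (|T|+1)` by
    -- induction. With `w` the numerator of `L`, empty `S` contributes `w` if `v` is isolated and
    -- nothing otherwise, and empty `T` contributes `t w`. The sum is `(1+t) w` or `t w`, and both
    -- are heavy enough. `m` bounds the number of vertices for the recursion.
    cone-hPoly-∅ : ∀ m L → length L ℕ.≤ m → Cone (suc (length L)) (hPoly ∅ L)
    cone-hPoly-∅ m [] _ = resp (λ i → sym (Δ-count⁺-[] ∅ i)) (cone-weaken (s≤s z≤n) (gen 1 0 ℕₚ.≤-refl))
    cone-hPoly-∅ (suc m) (u ∷ L₀) (s≤s l) with any? (λ v → ∀∈? (λ w → ¬? (R? v w)) (u ∷ L₀)) (u ∷ L₀)
    ... | no ¬sink = resp (λ i → sym (trans (iter-cong Δ-cong (suc (length (u ∷ L₀))) zero-count i) (iterΔ-0 (suc (length (u ∷ L₀))) i))) nil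
      where
      -- The predicate handed to `count-stuck` is the constant `X`, inhabited by `v` itself: without
      -- a sink every vertex has an outgoing arc.
      next : ∀ {v} → v ∈ u ∷ L₀ → X → ∃ λ w → w ∈ u ∷ L₀ × R v w × X
      next {v} v∈ _ with any? (R? v) (u ∷ L₀)
      ... | yes a = let (w , w∈ , r) = find a in w , w∈ , r , v
      ... | no ¬a = ⊥-elim (¬sink (lose v∈ (λ w∈ r → ¬a (lose w∈ r))))
      zero-count : count⁺ ∅ (u ∷ L₀) ≗ (λ _ → 0ℤ)
      zero-count x = trans (sym (count-nonempty ∅ u L₀ x)) (count-stuck ∅ (u ∷ L₀) (λ _ → X) next (here refl) u x)
    ... | yes a with find a
    ...   | v , v∈ , sink with extract v∈
    ...     | L , π = resp (λ i → sym (hPoly-↭ ∅ π i))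
                       (subst (λ n → Cone (suc n) (hPoly ∅ (v ∷ L))) (sym (↭-length π)) (pivotCone L refl))
      where
      term : ∀ y z S T → S ++ T ↭ L → splitTerm ∅ v y z S T ≡ compatInd v S T * (count ∅ S y * count ∅ T z)
      term y z S T ρ = splitTerm-factor ∅ v y z S T (λ w∈ → sink (∈-resp-↭ (↭-sym (↭-trans π (prep v (↭-sym ρ)))) w∈)) (λ _ ())
      l′ : length L ℕ.≤ m
      l′ = subst (ℕ._≤ m) (ℕₚ.suc-injective (↭-length π)) l
      φ : List X → List X → Seq
      φ S T = scale (compatInd v S T) (conv (iter Δ (suc (length S)) (count ∅ S)) (hPoly ∅ T))
      count≗ : ∀ s S → iter Δ (suc (length (s ∷ S))) (count ∅ (s ∷ S)) ≗ hPoly ∅ (s ∷ S)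
      count≗ s S = iter-cong Δ-cong (suc (length (s ∷ S))) (count-nonempty ∅ s S)
      inner : ∀ s S T → (s ∷ S) ++ T ↭ L → Cone (suc (length (v ∷ L))) (φ (s ∷ S) T)
      inner s S T ρ = subst (λ d → Cone d (φ (s ∷ S) T)) (sym (lengths {v} (s ∷ S) T ρ))
        (cone-ind (Compatible? v (s ∷ S) T) (λ _ → cone-conv
          (resp (λ i → sym (count≗ s S i)) (cone-hPoly-∅ m (s ∷ S) (proj₁ (sublengths (s ∷ S) T ρ l′))))
          (cone-hPoly-∅ m T (proj₂ (sublengths (s ∷ S) T ρ l′)))))
      -- For empty `L` the two extreme splittings coincide and contribute `t`.
      pivotCone : ∀ M → M ≡ L → Cone (suc (length (v ∷ L))) (hPoly ∅ (v ∷ L))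
      pivotCone [] refl = resp (λ i → sym (trans (hPoly-pivot ∅ v [] (count ∅) term i) (cong (_*_ (compatInd v [] []))
          (trans (conv-cong (Δ-count-[] ∅) (Δ-count⁺-[] ∅) i) (conv-δ₀ˡ (shift δ₀) i)))))
        (cone-ind (Compatible? v [] []) (λ _ → gen 1 0 ℕₚ.≤-refl))
      pivotCone (s ∷ M) refl = resp (λ i → sym (trans (hPoly-pivot ∅ v L (count ∅) term i) (rearrange i)))
          (add (ends (Compatible? v [] L)) (cone-sumSplit L middle middle-cone))
        where
        w = hPoly ∅ L
        middle : List X → List X → Seq
        middle S T i = nonemptyʳ (nonemptyˡ (λ S T → φ S T i)) S T
        middle-cone : ∀ S T → S ++ T ↭ L → Cone (suc (length (v ∷ L))) (middle S T)
        middle-cone S       []      ρ = nil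
        middle-cone []      (t ∷ T) ρ = nil
        middle-cone (s ∷ S) (t ∷ T) ρ = inner s S (t ∷ T) ρ
        compatL[] : compatInd v L [] ≡ 1ℤ
        compatL[] = ind-yes (Compatible? v L []) ((λ ()) , (λ ()))
        first : ∀ i → φ [] L i ≡ compatInd v [] L * w i
        first i = cong (_*_ (compatInd v [] L)) (trans (conv-cong {b = w} (Δ-count-[] ∅) (λ _ → refl) i) (conv-δ₀ˡ w i))
        last : ∀ i → φ L [] i ≡ shift w i
        last i = trans (cong (_* conv (iter Δ (suc (length L)) (count ∅ L)) (hPoly ∅ []) i) compatL[])
          (trans (ℤₚ.*-identityˡ _) (trans (conv-cong (count≗ s M) (Δ-count⁺-[] ∅) i)
          (trans (conv-shiftʳ w δ₀ i) (shift-cong (conv-δ₀ʳ w) i))))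
        rearrange : ∀ i → sumSplit L (λ S T → φ S T i) ≡ (scale (compatInd v [] L) w ⊕ shift w) i + sumSplit L (λ S T → middle S T i)
        rearrange i = trans (sumSplit-nonemptyˡ L (λ S T → φ S T i))
          (trans (cong (_+_ (φ [] L i)) (sumSplit-nonemptyʳ L (nonemptyˡ (λ S T → φ S T i))))
          (trans (sym (ℤₚ.+-assoc (φ [] L i) _ _))
          (cong (_+ sumSplit L (λ S T → middle S T i)) (cong₂ _+_ (first i) (last i)))))
        ends : (d : Dec (Compatible v [] L)) → Cone (suc (length (v ∷ L))) (scale (ind d) w ⊕ shift w)
        ends (yes _) = resp (λ i → cong (_+ shift w i) (sym (ℤₚ.*-identityˡ (w i)))) (cone-1+shift (cone-hPoly-∅ m L l′))
        ends (no _)  = resp (λ i → sym (ℤₚ.+-identityˡ _)) (cone-weaken (ℕₚ.n≤1+n _) (cone-shift (cone-hPoly-∅ m L l′)))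

    -- The pivot is a sink that is marked or the head of an arc, so it cannot have the color 0. The
    -- lower part is then counted by `count⁺ U`, and every splitting, also the extreme ones, has the
    -- full weight. If there is no such sink, either some vertex is marked, and from it arcs can be
    -- followed forever, or no vertex is marked and `cone-hPoly-∅` applies.
    cone-hPoly : ∀ (U : Marks) m L → length L ℕ.≤ m → Cone (suc (length L)) (hPoly U L)
    cone-hPoly U m [] _ = resp (λ i → sym (Δ-count⁺-[] U i)) (cone-weaken (s≤s z≤n) (gen 1 0 ℕₚ.≤-refl))
    cone-hPoly U (suc m) (u ∷ L₀) (s≤s l)
      with any? (λ v → ∀∈? (λ w → ¬? (R? v w)) (u ∷ L₀) ×-dec (mem? U v ⊎-dec any? (λ w → R? w v) (u ∷ L₀))) (u ∷ L₀)
    ... | no ¬sink = noSink (any? (mem? U) (u ∷ L₀))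
      where
      Grounded : X → Set
      Grounded v = Mem U v ⊎ Any.Any (λ w → R w v) (u ∷ L₀)
      next : ∀ {v} → v ∈ u ∷ L₀ → Grounded v → ∃ λ w → w ∈ u ∷ L₀ × R v w × Grounded w
      next {v} v∈ g with any? (R? v) (u ∷ L₀)
      ... | yes a = let (w , w∈ , r) = find a in w , w∈ , r , inj₂ (lose v∈ r)
      ... | no ¬a = ⊥-elim (¬sink (lose v∈ ((λ w∈ r → ¬a (lose w∈ r)) , g)))
      noSink : Dec (Any.Any (Mem U) (u ∷ L₀)) → Cone (suc (length (u ∷ L₀))) (hPoly U (u ∷ L₀))
      noSink (yes a) = let (v , v∈ , Uv) = find a in
        resp (λ i → sym (trans (iter-cong Δ-cong (suc (length (u ∷ L₀)))
               (λ x → trans (sym (count-nonempty U u L₀ x)) (count-stuck U (u ∷ L₀) Grounded next v∈ (inj₁ Uv) x)) i)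
               (iterΔ-0 (suc (length (u ∷ L₀))) i))) nil
      noSink (no ¬a) = resp (iter-cong Δ-cong (suc (length (u ∷ L₀))) (count⁺-cong ∅ U {u ∷ L₀} {u ∷ L₀} same))
                            (cone-hPoly-∅ (suc m) (u ∷ L₀) (s≤s l))
        where
        same : count ∅ (u ∷ L₀) ≗ count U (u ∷ L₀)
        same x = sumCol-cong (u ∷ L₀) x (λ c C → ind-cong (Legal? ∅ c) (Legal? U c)
          (λ leg → proj₁ leg , (λ p∈ Up → ⊥-elim (¬a (lose (proj₁ (colored-bound C p∈)) Up))))
          (λ leg → proj₁ leg , (λ _ ())))
    ... | yes a with find a
    ...   | v , v∈ , sink , grounded with extract v∈
    ...     | L , π = resp (λ i → sym (trans (hPoly-↭ U π i) (hPoly-pivot U v L (count⁺ U) term i)))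
                       (subst (λ n → Cone (suc n) (λ x → sumSplit L (λ S T → φ S T x))) (sym (↭-length π)) (cone-sumSplit L φ inner))
      where
      φ : List X → List X → Seq
      φ S T = scale (compatInd v S T) (conv (hPoly U S) (hPoly ∅ T))
      l′ : length L ℕ.≤ m
      l′ = subst (ℕ._≤ m) (ℕₚ.suc-injective (↭-length π)) l
      inner : ∀ S T → S ++ T ↭ L → Cone (suc (length (v ∷ L))) (φ S T)
      inner S T ρ = subst (λ d → Cone d (φ S T)) (sym (lengths {v} S T ρ))
        (cone-ind (Compatible? v S T) (λ _ → cone-conv
          (cone-hPoly U m S (proj₁ (sublengths S T ρ l′))) (cone-hPoly-∅ m T (proj₂ (sublengths S T ρ l′)))))
      zero-illegal : Mem U v ⊎ Any.Any (λ w → R w v) (u ∷ L₀) →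
                     ∀ z T → T ↭ L → ∀ b → Colored z T b → ¬ Legal U ((v , 0) ∷ raise 0 b)
      zero-illegal (inj₁ Uv) z T ρ b B (inc , pos) = ℕₚ.1+n≰n (pos (here refl) Uv)
      zero-illegal (inj₂ p)  z T ρ b B (inc , pos) with find p
      ... | w , w∈ , r with ∈-resp-↭ (↭-trans π (prep v (↭-sym ρ))) w∈
      ...   | here refl = sink v∈ r
      ...   | there w∈T with colored-color B w∈T
      ...     | c , mem with inc (there (∈-map⁺ _ mem)) (here refl) r
      ...       | ()
      term : ∀ y z S T → S ++ T ↭ L → splitTerm U v y z S T ≡ compatInd v S T * (count⁺ U S y * count ∅ T z)
      term (suc y) z S T ρ = splitTerm-factor U v (suc y) z S T (λ w∈ → sink (∈-resp-↭ (↭-sym (↭-trans π (prep v (↭-sym ρ)))) w∈)) (λ _ _ → s≤s z≤n)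
      -- At `y = 0` the right side vanishes. On the left, a nonempty `S` has no colors available,
      -- and for empty `S` the pivot would have the forbidden color 0.
      term zero z (s ∷ S) T ρ = sym (ℤₚ.*-zeroʳ (compatInd v (s ∷ S) T))
      term zero z [] T ρ = trans
        (trans (sumCol-cong T z (λ b B → ind-no (Legal? U _) (zero-illegal grounded z T ρ b B))) (sumCol-0 T z))
        (sym (ℤₚ.*-zeroʳ (compatInd v [] T)))

-- Eulerian numbers of type B and their growth.

module Eulerian where

  open import Data.Nat
  open import Data.Nat.Properties
  open import Data.Nat.DivMod using (m≡m%n+[m/n]*n; m%n<n)
  open import Data.Nat.Tactic.RingSolver using (solve-∀)
  open import Data.Product using (∃; _×_; _,_)
  open import Data.Unit using (tt)
  open import Relation.Binary.PropositionalEquality using (_≡_; refl; sym; trans; cong; cong₂; subst; module ≡-Reasoning)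

  -- Eulerian numbers of type B: Σ_j (2j+1)ⁿ t^j = Σ_k B n k t^k / (1-t)^(n+1).
  B : ℕ → ℕ → ℕ
  B zero    zero    = 1
  B zero    (suc k) = 0
  B (suc n) zero    = B n zero
  B (suc n) (suc k) = (2 * suc k + 1) * B n (suc k) + (2 * (n ∸ k) + 1) * B n k

  B-above : ∀ n k → n < k → B n k ≡ 0
  B-above zero    (suc k) _         = refl
  B-above (suc n) (suc k) (s≤s n<k)
    rewrite B-above n (suc k) (m≤n⇒m≤1+n n<k) | B-above n k n<k
          | *-zeroʳ (2 * suc k + 1) | *-zeroʳ (2 * (n ∸ k) + 1) = refl

  B-bottom : ∀ n → B n 0 ≡ 1
  B-bottom zero    = refl
  B-bottom (suc n) = B-bottom n

  B-top : ∀ n → B n n ≡ 1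
  B-top zero    = refl
  B-top (suc n) rewrite B-above n (suc n) ≤-refl | *-zeroʳ (2 * suc n + 1) | n∸n≡0 n | +-identityʳ (B n n) = B-top n

  B-sym : ∀ n k l → k + l ≡ n → B n k ≡ B n l
  B-sym n zero    l       p = trans (B-bottom n) (trans (sym (B-top n)) (cong (B n) (sym p)))
  B-sym n (suc k) zero    p = trans (cong (B n) (trans (sym (+-identityʳ (suc k))) p)) (trans (B-top n) (sym (B-bottom n)))
  B-sym (suc n) (suc k) (suc l) p = begin
    (2 * suc k + 1) * B n (suc k) + (2 * (n ∸ k) + 1) * B n k
      ≡⟨ cong₂ (λ x y → (2 * suc k + 1) * x + (2 * (n ∸ k) + 1) * y) (B-sym n (suc k) l q′) (B-sym n k (suc l) q) ⟩
    (2 * suc k + 1) * B n l + (2 * (n ∸ k) + 1) * B n (suc l)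
      ≡⟨ cong₂ (λ x y → (2 * x + 1) * B n l + (2 * y + 1) * B n (suc l)) (sym n∸l) n∸k ⟩
    (2 * (n ∸ l) + 1) * B n l + (2 * suc l + 1) * B n (suc l)
      ≡⟨ +-comm ((2 * (n ∸ l) + 1) * B n l) _ ⟩
    (2 * suc l + 1) * B n (suc l) + (2 * (n ∸ l) + 1) * B n l ∎
    where
    open ≡-Reasoning
    q : k + suc l ≡ n
    q = suc-injective p
    q′ : suc k + l ≡ n
    q′ = trans (sym (+-suc k l)) q
    n∸k : n ∸ k ≡ suc l
    n∸k = trans (cong (_∸ k) (sym q)) (m+n∸m≡n k (suc l))
    n∸l : n ∸ l ≡ suc k
    n∸l = trans (cong (_∸ l) (sym q′)) (m+n∸n≡m (suc k) l)

  B-grow : ∀ n k → (2 * k + 1) * B n k ≤ B (suc n) k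
  B-grow n zero    = ≤-reflexive (+-identityʳ (B n 0))
  B-grow n (suc k) = m≤m+n _ _

  private
    index : ∀ s i → (s + suc (2 * i)) ∸ i ≡ suc (s + i)
    index s i = trans (cong (_∸ i) (lemma s i)) (m+n∸n≡m (suc (s + i)) i)
      where
      lemma : ∀ s i → s + (1 + 2 * i) ≡ 1 + (s + i) + i
      lemma = solve-∀

  -- Rows are indexed by the distance `s` from row `2i+1`, in which columns `i` and `i+1` are the
  -- two central ones and equal. This starts the induction in `B-ratio`.
  B-rec : ∀ s i → B (suc (s + suc (2 * i))) (suc i) ≡
          (2 * i + 3) * B (s + suc (2 * i)) (suc i) + (2 * i + 3 + 2 * s) * B (s + suc (2 * i)) i
  B-rec s i rewrite index s i = cong₂ (λ p q → p * B (s + suc (2 * i)) (suc i) + q * B (s + suc (2 * i)) i) (c₁ i) (c₂ s i)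
    where
    c₁ : ∀ i → 2 * (1 + i) + 1 ≡ 2 * i + 3
    c₁ = solve-∀
    c₂ : ∀ s i → 2 * (1 + (s + i)) + 1 ≡ 2 * i + 3 + 2 * s
    c₂ = solve-∀

  -- For positive `a` this is `1 + 2s/(a+2) ≤ (1 + 2/a)^s`, a weak form of Bernoulli's inequality
  -- without denominators.
  bernoulli : ∀ a s → a ^ s * (a + 2 + 2 * s) ≤ (a + 2) ^ suc s
  bernoulli a zero    = ≤-reflexive (lemma a)
    where
    lemma : ∀ a → 1 * (a + 2 + 2 * 0) ≡ (a + 2) * 1
    lemma = solve-∀
  bernoulli a (suc s) = begin
    a * a ^ s * (a + 2 + 2 * suc s) ≤⟨ m≤m+n _ (a ^ s * (4 + 4 * s)) ⟩
    a * a ^ s * (a + 2 + 2 * suc s) + a ^ s * (4 + 4 * s) ≡⟨ lemma a s (a ^ s) ⟩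
    (a + 2) * (a ^ s * (a + 2 + 2 * s)) ≤⟨ *-monoʳ-≤ (a + 2) (bernoulli a s) ⟩
    (a + 2) ^ suc (suc s) ∎
    where
    open ≤-Reasoning
    lemma : ∀ a s p → a * p * (a + 2 + 2 * (1 + s)) + p * (4 + 4 * s) ≡ (a + 2) * (p * (a + 2 + 2 * s))
    lemma = solve-∀

  module _ (i : ℕ) where
    private
      a = 2 * i + 1
      a+2 : a + 2 ≡ 2 * i + 3
      a+2 = +-assoc (2 * i) 1 2

      row : ℕ → ℕ
      row s = s + suc (2 * i)

      bernoulli′ : ∀ s → a ^ s * (2 * i + 3 + 2 * s) ≤ (2 * i + 3) ^ suc s
      bernoulli′ s = subst (λ c → a ^ s * (c + 2 * s) ≤ c ^ suc s) a+2 (bernoulli a s)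

      step : ∀ s x y → a ^ s * x ≤ suc s * (2 * i + 3) ^ s * y →
             a ^ s * ((2 * i + 3) * x + (2 * i + 3 + 2 * s) * y) ≤ (2 + s) * (2 * i + 3) ^ suc s * y
      step s x y p = begin
        a ^ s * (c * x + (c + 2 * s) * y) ≡⟨ lemma₁ (a ^ s) c x (c + 2 * s) y ⟩
        c * (a ^ s * x) + a ^ s * (c + 2 * s) * y ≤⟨ +-mono-≤ (*-monoʳ-≤ c p) (*-monoˡ-≤ y (bernoulli′ s)) ⟩
        c * (suc s * c ^ s * y) + c * c ^ s * y ≡⟨ lemma₂ c s (c ^ s) y ⟩
        (2 + s) * c ^ suc s * y ∎
        where
        open ≤-Reasoning
        c = 2 * i + 3
        lemma₁ : ∀ p c x q y → p * (c * x + q * y) ≡ c * (p * x) + p * q * y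
        lemma₁ = solve-∀
        lemma₂ : ∀ c s p y → c * ((1 + s) * p * y) + c * p * y ≡ (2 + s) * (c * p) * y
        lemma₂ = solve-∀

    -- From one row to the next, column `i+1` gains the factor `2i+3` and column `i` at least
    -- `2i+1`. The second term of the recurrence, with its coefficient `2i+3+2s`, is absorbed by
    -- `bernoulli` and turns the factor `s+1` into `s+2`.
    B-ratio : ∀ s → (2 * i + 1) ^ s * B (s + suc (2 * i)) (suc i) ≤ suc s * (2 * i + 3) ^ s * B (s + suc (2 * i)) i
    B-ratio zero    = ≤-reflexive (cong (_+ 0) (B-sym (suc (2 * i)) (suc i) i (cong suc (cong (i +_) (sym (+-identityʳ i))))))
    B-ratio (suc s) = begin
      a ^ suc s * B (row (suc s)) (suc i) ≡⟨ cong (a ^ suc s *_) (B-rec s i) ⟩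
      a * a ^ s * ((2 * i + 3) * B (row s) (suc i) + (2 * i + 3 + 2 * s) * B (row s) i) ≡⟨ *-assoc a (a ^ s) _ ⟩
      a * (a ^ s * ((2 * i + 3) * B (row s) (suc i) + (2 * i + 3 + 2 * s) * B (row s) i)) ≤⟨ *-monoʳ-≤ a (step s _ _ (B-ratio s)) ⟩
      a * ((2 + s) * (2 * i + 3) ^ suc s * B (row s) i) ≡⟨ lemma a ((2 + s) * (2 * i + 3) ^ suc s) (B (row s) i) ⟩
      (2 + s) * (2 * i + 3) ^ suc s * (a * B (row s) i) ≤⟨ *-monoʳ-≤ ((2 + s) * (2 * i + 3) ^ suc s) (B-grow (row s) i) ⟩
      (2 + s) * (2 * i + 3) ^ suc s * B (row (suc s)) i ∎
      where
      open ≤-Reasoning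
      lemma : ∀ a p y → a * (p * y) ≡ p * (a * y)
      lemma = solve-∀

    B-next-ratio : ∀ s → (2 * i + 1) ^ s * B (suc (s + suc (2 * i))) (suc i) ≤ (2 + s) * (2 * i + 3) ^ suc s * B (s + suc (2 * i)) i
    B-next-ratio s = subst (λ w → a ^ s * w ≤ (2 + s) * (2 * i + 3) ^ suc s * B (row s) i) (sym (B-rec s i)) (step s _ _ (B-ratio s))

    -- The right side is that of `B-next-ratio`, so that few and many edges lead to the same bound.
    B-sum-ratio : ∀ s → (2 * i + 2) * ((2 * i + 1) ^ s * (B (s + suc (2 * i)) (suc i) + B (s + suc (2 * i)) i)) ≤
                        (2 + s) * (2 * i + 3) ^ suc s * B (s + suc (2 * i)) i
    B-sum-ratio s = begin
      (2 * i + 2) * (a ^ s * (x + y)) ≤⟨ *-monoˡ-≤ _ (+-monoʳ-≤ (2 * i) (n≤1+n 2)) ⟩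
      c * (a ^ s * (x + y)) ≡⟨ cong (c *_) (*-distribˡ-+ (a ^ s) x y) ⟩
      c * (a ^ s * x + a ^ s * y) ≤⟨ *-monoʳ-≤ c (+-mono-≤ (B-ratio s) (*-monoˡ-≤ y (^-monoˡ-≤ s (+-monoʳ-≤ (2 * i) (s≤s z≤n))))) ⟩
      c * (suc s * c ^ s * y + c ^ s * y) ≡⟨ lemma c s (c ^ s) y ⟩
      (2 + s) * c ^ suc s * y ∎
      where
      open ≤-Reasoning
      c = 2 * i + 3
      x = B (row s) (suc i)
      y = B (row s) i
      lemma : ∀ c s p y → c * ((1 + s) * p * y + p * y) ≡ (2 + s) * (c * p) * y
      lemma = solve-∀

  -- Estimates for rising factorials.

  -- The rising factorial `b (b+1) ... (b+k-1)`, which is `k!` times the binomial coefficient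
  -- `C(b+k-1, k)`.
  rising : ℕ → ℕ → ℕ
  rising b zero    = 1
  rising b (suc k) = rising b k * (b + k)

  -- If `b′` is at most `q/p` times `b` and `q/p ≥ 1`, the same factor bounds every `b′ + j` by
  -- `b + j`.
  rising-scale : ∀ {p q b b′} → p ≤ q → p * b′ ≤ q * b → ∀ k → p ^ k * rising b′ k ≤ q ^ k * rising b k
  rising-scale p≤q h zero    = ≤-refl
  rising-scale {p} {q} {b} {b′} p≤q h (suc k) = begin
    p * p ^ k * (rising b′ k * (b′ + k)) ≡⟨ lemma p (p ^ k) (rising b′ k) b′ k ⟩
    p ^ k * rising b′ k * (p * b′ + p * k) ≤⟨ *-mono-≤ (rising-scale {p} {q} {b} {b′} p≤q h k) (+-mono-≤ h (*-monoˡ-≤ k p≤q)) ⟩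
    q ^ k * rising b k * (q * b + q * k) ≡⟨ sym (lemma q (q ^ k) (rising b k) b k) ⟩
    q * q ^ k * (rising b k * (b + k)) ∎
    where
    open ≤-Reasoning
    lemma : ∀ p P r b k → p * P * (r * (b + k)) ≡ P * r * (p * b + p * k)
    lemma = solve-∀

  -- (1 + 1/m)^k ≤ 1 + k/m + (k/m)² for k ≤ m.
  pow-quadratic : ∀ m k → k ≤ m → m * m * suc m ^ k ≤ m ^ k * (m * m + k * m + k * k)
  pow-quadratic m zero    _   = ≤-reflexive (lemma m)
    where
    lemma : ∀ m → m * m * 1 ≡ 1 * (m * m + 0 * m + 0 * 0)
    lemma = solve-∀
  pow-quadratic m (suc k) k<m = begin
    m * m * (suc m * suc m ^ k) ≡⟨ lemma₁ m (suc m ^ k) ⟩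
    suc m * (m * m * suc m ^ k) ≤⟨ *-monoʳ-≤ (suc m) (pow-quadratic m k (<⇒≤ k<m)) ⟩
    suc m * (m ^ k * (m * m + k * m + k * k)) ≡⟨ lemma₂ m k (m ^ k) ⟩
    m ^ k * (m * (m * m + m + k * m + k * k) + k * m + k * k) ≤⟨ *-monoʳ-≤ (m ^ k) (≤-trans (+-monoʳ-≤ _ (*-monoʳ-≤ k (<⇒≤ k<m))) (m≤m+n _ m)) ⟩
    m ^ k * (m * (m * m + m + k * m + k * k) + k * m + k * m + m) ≡⟨ lemma₃ m k (m ^ k) ⟩
    m * m ^ k * (m * m + suc k * m + suc k * suc k) ∎
    where
    open ≤-Reasoning
    lemma₁ : ∀ m p → m * m * ((1 + m) * p) ≡ (1 + m) * (m * m * p)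
    lemma₁ = solve-∀
    lemma₂ : ∀ m k p → (1 + m) * (p * (m * m + k * m + k * k)) ≡ p * (m * (m * m + m + k * m + k * k) + k * m + k * k)
    lemma₂ = solve-∀
    lemma₃ : ∀ m k p → p * (m * (m * m + m + k * m + k * k) + k * m + k * m + m) ≡ m * p * (m * m + (1 + k) * m + (1 + k) * (1 + k))
    lemma₃ = solve-∀

  -- In `pow-quadratic` all three summands are at most 1; the 3 is a crude substitute for `e`.
  pow≤3 : ∀ m k → k ≤ suc m → suc (suc m) ^ k ≤ 3 * suc m ^ k
  pow≤3 m k k≤ = *-cancelˡ-≤ (M * M) (begin
    M * M * suc M ^ k ≤⟨ pow-quadratic M k k≤ ⟩
    M ^ k * (M * M + k * M + k * k) ≤⟨ *-monoʳ-≤ (M ^ k) (+-mono-≤ (+-monoʳ-≤ (M * M) (*-monoˡ-≤ M k≤)) (*-mono-≤ k≤ k≤)) ⟩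
    M ^ k * (M * M + M * M + M * M) ≡⟨ lemma M (M ^ k) ⟩
    M * M * (3 * M ^ k) ∎)
    where
    open ≤-Reasoning
    M = suc m
    lemma : ∀ M p → p * (M * M + M * M + M * M) ≡ M * M * (3 * p)
    lemma = solve-∀

  ^-distribʳ-* : ∀ k x y → (x * y) ^ k ≡ x ^ k * y ^ k
  ^-distribʳ-* zero    x y = refl
  ^-distribʳ-* (suc k) x y = trans (cong (x * y *_) (^-distribʳ-* k x y)) (lemma x y (x ^ k) (y ^ k))
    where
    lemma : ∀ x y p q → x * y * (p * q) ≡ x * p * (y * q)
    lemma = solve-∀

  -- From `i (i+2) ≤ (i+1)²` follows `(1 + 2/i)^i ≤ (1 + 1/i)^(2i) ≤ 9`, and `9 ≤ 2i+1` from `i = 4`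
  -- on. Smaller `i` are computed.
  pow-bound : ∀ j → let i = suc j in (i + 2) ^ i ≤ (2 * i + 1) * i ^ i
  pow-bound 0 = ≤ᵇ⇒≤ _ _ tt
  pow-bound 1 = ≤ᵇ⇒≤ _ _ tt
  pow-bound 2 = ≤ᵇ⇒≤ _ _ tt
  pow-bound (suc (suc (suc j))) = *-cancelˡ-≤ (i ^ i) {{m^n≢0 i i}} (begin
    i ^ i * (i + 2) ^ i ≡⟨ sym (^-distribʳ-* i i (i + 2)) ⟩
    (i * (i + 2)) ^ i ≤⟨ ^-monoˡ-≤ i (≤-trans (n≤1+n _) (≤-reflexive (square i))) ⟩
    (suc i * suc i) ^ i ≡⟨ ^-distribʳ-* i (suc i) (suc i) ⟩
    suc i ^ i * suc i ^ i ≤⟨ *-mono-≤ (pow≤3 (3 + j) i ≤-refl) (pow≤3 (3 + j) i ≤-refl) ⟩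
    3 * i ^ i * (3 * i ^ i) ≡⟨ lemma (i ^ i) ⟩
    i ^ i * (9 * i ^ i) ≤⟨ *-monoʳ-≤ (i ^ i) (*-monoˡ-≤ (i ^ i) (≤-trans (m≤m+n 9 (2 * j)) (≤-reflexive (nine j)))) ⟩
    i ^ i * ((2 * i + 1) * i ^ i) ∎)
    where
    open ≤-Reasoning
    i = 4 + j
    square : ∀ i → 1 + i * (i + 2) ≡ (1 + i) * (1 + i)
    square = solve-∀
    lemma : ∀ p → 3 * p * (3 * p) ≡ p * (9 * p)
    lemma = solve-∀
    nine : ∀ j → 9 + 2 * j ≡ 2 * (4 + j) + 1
    nine = solve-∀

  private
    base₀ : ℕ → ℕ
    base₀ i = (2 * i + 3) * (i + 2)

  -- Two steps of the recurrence. In row `2i+2`, column `i+1` is `2 (2i+3) z` by symmetry and column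
  -- `i` is at least `(2i+1) z`; the coefficient is `2 (2i+3)² + (2i+5)(2i+1)`.
  B-central-grow : ∀ i → (12 * (i * i) + 36 * i + 23) * B (suc (2 * i)) i ≤ B (suc (2 * suc i)) (suc i)
  B-central-grow i = begin
    (12 * (i * i) + 36 * i + 23) * z ≡⟨ lemma i z ⟩
    (2 * i + 3) * ((2 * i + 3) * z + (2 * i + 3) * z) + (2 * i + 5) * ((2 * i + 1) * z)
      ≤⟨ +-monoʳ-≤ _ (*-monoʳ-≤ (2 * i + 5) (B-grow (suc (2 * i)) i)) ⟩
    (2 * i + 3) * ((2 * i + 3) * z + (2 * i + 3) * z) + (2 * i + 5) * B (suc (suc (2 * i))) i
      ≡⟨ cong₂ (λ p q → (2 * i + 3) * p + q * B (suc (suc (2 * i))) i) (sym mid) (five i) ⟩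
    (2 * i + 3) * B (suc (suc (2 * i))) (suc i) + (2 * i + 3 + 2 * 1) * B (suc (suc (2 * i))) i ≡⟨ sym (B-rec 1 i) ⟩
    B (suc (suc (suc (2 * i)))) (suc i) ≡⟨ cong (λ n → B n (suc i)) (idx i) ⟩
    B (suc (2 * suc i)) (suc i) ∎
    where
    open ≤-Reasoning
    z = B (suc (2 * i)) i
    lemma : ∀ i z → (12 * (i * i) + 36 * i + 23) * z ≡ (2 * i + 3) * ((2 * i + 3) * z + (2 * i + 3) * z) + (2 * i + 5) * ((2 * i + 1) * z)
    lemma = solve-∀
    five : ∀ i → 2 * i + 5 ≡ 2 * i + 3 + 2 * 1
    five = solve-∀
    idx : ∀ i → 3 + 2 * i ≡ 1 + 2 * (1 + i)
    idx = solve-∀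
    mid : B (suc (suc (2 * i))) (suc i) ≡ (2 * i + 3) * z + (2 * i + 3) * z
    mid = trans (B-rec 0 i) (cong₂ _+_ (cong ((2 * i + 3) *_) (B-sym (suc (2 * i)) (suc i) i (cong suc (cong (i +_) (sym (+-identityʳ i))))))
                                       (cong (_* z) (+-identityʳ (2 * i + 3))))

  -- This is `growth-witness` at `s = 0`. From `i` to `i+1` the base grows by at most
  -- `((i+2)/(i+1))²`, which multiplies the first `i` factors by at most 9, and one factor `b′ + i`
  -- is new; `B-central-grow` outweighs both. The inequality `poly` holds from `i = 3` but fails at
  -- `i = 2`, hence three computed cases.
  central-bound : ∀ j → let i = suc j in (i + 2) * rising (base₀ i) i ≤ 2 * (i ! * B (suc (2 * i)) i)
  central-bound 0 = ≤ᵇ⇒≤ _ _ tt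
  central-bound 1 = ≤ᵇ⇒≤ _ _ tt
  central-bound 2 = ≤ᵇ⇒≤ _ _ tt
  central-bound (suc (suc (suc j))) = *-cancelˡ-≤ (i + 2) {{>-nonZero (m≤n⇒m≤o+n i (s≤s z≤n))}} (begin
    (i + 2) * ((suc i + 2) * (rising b′ i * (b′ + i))) ≤⟨ *-monoʳ-≤ (i + 2) (*-monoʳ-≤ (suc i + 2) (*-monoˡ-≤ (b′ + i) rising≤)) ⟩
    (i + 2) * ((suc i + 2) * (9 * rising b i * (b′ + i)))  ≡⟨ lemma₁ (i + 2) (suc i + 2) (rising b i) (b′ + i) ⟩
    9 * (b′ + i) * (suc i + 2) * ((i + 2) * rising b i) ≤⟨ *-monoʳ-≤ (9 * (b′ + i) * (suc i + 2)) (central-bound (suc (suc j))) ⟩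
    9 * (b′ + i) * (suc i + 2) * (2 * (i ! * z)) ≤⟨ *-monoˡ-≤ (2 * (i ! * z)) poly ⟩
    (i + 2) * suc i * (12 * (i * i) + 36 * i + 23) * (2 * (i ! * z)) ≡⟨ lemma₂ (i + 2) (suc i) (12 * (i * i) + 36 * i + 23) (i !) z ⟩
    (i + 2) * (2 * (suc i * i ! * ((12 * (i * i) + 36 * i + 23) * z))) ≤⟨ *-monoʳ-≤ (i + 2) (*-monoʳ-≤ 2 (*-monoʳ-≤ (suc i * i !) (B-central-grow i))) ⟩
    (i + 2) * (2 * (suc i ! * B (suc (2 * suc i)) (suc i))) ∎)
    where
    open ≤-Reasoning
    i = 3 + j
    b = base₀ i
    b′ = base₀ (suc i)
    z = B (suc (2 * i)) i
    lemma₁ : ∀ x y r c → x * (y * (9 * r * c)) ≡ 9 * c * y * (x * r)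
    lemma₁ = solve-∀
    lemma₂ : ∀ x y w f z → x * y * w * (2 * (f * z)) ≡ x * (2 * (y * f * (w * z)))
    lemma₂ = solve-∀
    poly-id : ∀ j → let i = 3 + j in
      9 * ((2 * (1 + i) + 3) * (1 + i + 2) + i) * (1 + i + 2) + (12 * (j * j * j * j) + 198 * (j * j * j) + 1127 * (j * j) + 2394 * j + 1054)
      ≡ (i + 2) * (1 + i) * (12 * (i * i) + 36 * i + 23)
    poly-id = solve-∀
    poly : 9 * (b′ + i) * (suc i + 2) ≤ (i + 2) * suc i * (12 * (i * i) + 36 * i + 23)
    poly = ≤-trans (m≤m+n _ _) (≤-reflexive (poly-id j))
    scale-id : ∀ i → (1 + i) * (1 + i) * ((2 * (1 + i) + 3) * (1 + i + 2)) + (3 * (i * i) + 11 * i + 9) ≡ (2 + i) * (2 + i) * ((2 * i + 3) * (i + 2))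
    scale-id = solve-∀
    q : ℕ
    q = suc i ^ i
    rising≤ : rising b′ i ≤ 9 * rising b i
    rising≤ = *-cancelˡ-≤ (q * q) {{m*n≢0 q q {{m^n≢0 (suc i) i}} {{m^n≢0 (suc i) i}}}} (begin
      q * q * rising b′ i ≡⟨ cong (_* rising b′ i) (sym (^-distribʳ-* i (suc i) (suc i))) ⟩
      (suc i * suc i) ^ i * rising b′ i ≤⟨ rising-scale {suc i * suc i} {suc (suc i) * suc (suc i)} {b} {b′}
                                                          (*-mono-≤ (n≤1+n (suc i)) (n≤1+n (suc i))) (≤-trans (m≤m+n _ _) (≤-reflexive (scale-id i))) i ⟩
      (suc (suc i) * suc (suc i)) ^ i * rising b i ≡⟨ cong (_* rising b i) (^-distribʳ-* i (suc (suc i)) (suc (suc i))) ⟩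
      suc (suc i) ^ i * suc (suc i) ^ i * rising b i  ≤⟨ *-monoˡ-≤ (rising b i) (*-mono-≤ (pow≤3 i i (n≤1+n i)) (pow≤3 i i (n≤1+n i))) ⟩
      3 * q * (3 * q) * rising b i ≡⟨ lemma q (rising b i) ⟩
      q * q * (9 * rising b i) ∎)
      where
      lemma : ∀ q r → 3 * q * (3 * q) * r ≡ q * q * (9 * r)
      lemma = solve-∀

  -- From s to s + 1 the witness grows by a factor at most 1 + 2/i, which multiplies rising b i by
  -- at most (1 + 2/i)^i ≤ 2i + 1, and B (n+1) i ≥ (2i+1) B n i.
  growth-witness : ∀ j s → let i = suc j in ∃ λ b →
    (2 * i + 3) ^ suc s * (i + 2 + s) ≤ b * (2 * i + 1) ^ s ×
    (i + 2 + s) * rising b i ≤ (2 + s) * (i ! * B (s + suc (2 * i)) i)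
  growth-witness j zero = base₀ i , ≤-reflexive (lemma i) ,
      subst (λ c → c * rising (base₀ i) i ≤ 2 * (i ! * B (suc (2 * i)) i)) (sym (+-identityʳ (i + 2))) (central-bound j)
    where
    i = suc j
    lemma : ∀ i → (2 * i + 3) * 1 * (i + 2 + 0) ≡ (2 * i + 3) * (i + 2) * 1
    lemma = solve-∀
  growth-witness j (suc s) with growth-witness j s
  ... | b , ratio , size = b′ , ratio′ , size′
    where
    open ≤-Reasoning
    i = suc j
    t = i + 2 + s
    a = 2 * i + 1
    c = 2 * i + 3
    -- This makes `b′` the integer part of `b (1 + 2/i)`.
    q = (2 * b) / i
    b′ = b + q
    a≤c : a ≤ c
    a≤c = +-monoʳ-≤ (2 * i) (s≤s z≤n)
    div-lo : i * q ≤ 2 * b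
    div-lo = ≤-trans (m≤n+m (i * q) ((2 * b) % i)) (≤-reflexive (trans (cong ((2 * b) % i +_) (*-comm i q)) (sym (m≡m%n+[m/n]*n (2 * b) i))))
    div-hi : 2 * b ≤ i + i * q
    div-hi = ≤-trans (≤-reflexive (m≡m%n+[m/n]*n (2 * b) i)) (+-mono-≤ (<⇒≤ (m%n<n (2 * b) i)) (≤-reflexive (*-comm q i)))
    b-large : a * t ≤ b
    b-large = *-cancelˡ-≤ (a ^ s) {{m^n≢0 a s {{>-nonZero (m≤n⇒m≤o+n (2 * i) (s≤s z≤n))}}}} (begin
      a ^ s * (a * t) ≡⟨ lemma (a ^ s) a t ⟩
      a * a ^ s * t ≤⟨ *-monoˡ-≤ t (^-monoˡ-≤ (suc s) a≤c) ⟩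
      c ^ suc s * t ≤⟨ ratio ⟩
      b * a ^ s ≡⟨ *-comm b (a ^ s) ⟩
      a ^ s * b ∎)
      where
      lemma : ∀ p a t → p * (a * t) ≡ a * p * t
      lemma = solve-∀
    -- The required growth `c (1+t) / (a t)` is below `1 + 2/i` by a margin; `b-large` ensures that
    -- the margin covers what rounding loses in `q`.
    slack : b * (c * (1 + t)) ≤ b′ * (a * t)
    slack = *-cancelˡ-≤ i (+-cancelʳ-≤ (i * (a * t)) _ _ (begin
      i * (b * (c * (1 + t))) + i * (a * t) ≤⟨ +-monoʳ-≤ _ (≤-trans (*-monoʳ-≤ i b-large) (≤-trans (m≤m+n (i * b) _) (≤-reflexive (slack-id i s b)))) ⟩
      i * (b * (c * (1 + t))) + b * (3 * i + 4 + 2 * i * s + 2 * s) ≡⟨ expand i s b ⟩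
      i * (b * (a * t)) + 2 * b * (a * t) ≤⟨ +-monoʳ-≤ _ (*-monoˡ-≤ (a * t) div-hi) ⟩
      i * (b * (a * t)) + (i + i * q) * (a * t) ≡⟨ collect i b q (a * t) ⟩
      i * (b′ * (a * t)) + i * (a * t) ∎))
      where
      slack-id : ∀ i s b → i * b + b * (2 * i + 4 + 2 * i * s + 2 * s) ≡ b * (3 * i + 4 + 2 * i * s + 2 * s)
      slack-id = solve-∀
      expand : ∀ i s b → i * (b * ((2 * i + 3) * (1 + (i + 2 + s)))) + b * (3 * i + 4 + 2 * i * s + 2 * s)
                       ≡ i * (b * ((2 * i + 1) * (i + 2 + s))) + 2 * b * ((2 * i + 1) * (i + 2 + s))
      expand = solve-∀
      collect : ∀ i b q w → i * (b * w) + (i + i * q) * w ≡ i * ((b + q) * w) + i * w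
      collect = solve-∀
    ratio′ : c ^ suc (suc s) * (i + 2 + suc s) ≤ b′ * a ^ suc s
    ratio′ = *-cancelˡ-≤ t (begin
      t * (c ^ suc (suc s) * (i + 2 + suc s)) ≡⟨ cong (λ w → t * (c ^ suc (suc s) * w)) (+-suc (i + 2) s) ⟩
      t * (c * c ^ suc s * (1 + t)) ≡⟨ lemma₁ t c (c ^ suc s) ⟩
      c ^ suc s * t * (c * (1 + t)) ≤⟨ *-monoˡ-≤ (c * (1 + t)) ratio ⟩
      b * a ^ s * (c * (1 + t)) ≡⟨ lemma₂ b (a ^ s) (c * (1 + t)) ⟩
      a ^ s * (b * (c * (1 + t))) ≤⟨ *-monoʳ-≤ (a ^ s) slack ⟩
      a ^ s * (b′ * (a * t)) ≡⟨ lemma₃ (a ^ s) b′ a t ⟩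
      t * (b′ * a ^ suc s) ∎)
      where
      lemma₁ : ∀ t c p → t * (c * p * (1 + t)) ≡ p * t * (c * (1 + t))
      lemma₁ = solve-∀
      lemma₂ : ∀ b p w → b * p * w ≡ p * (b * w)
      lemma₂ = solve-∀
      lemma₃ : ∀ p b a t → p * (b * (a * t)) ≡ t * (b * (a * p))
      lemma₃ = solve-∀
    rising≤ : rising b′ i ≤ a * rising b i
    rising≤ = *-cancelˡ-≤ (i ^ i) {{m^n≢0 i i}} (begin
      i ^ i * rising b′ i ≤⟨ rising-scale {i} {i + 2} {b} {b′} (m≤m+n i 2) scaled i ⟩
      (i + 2) ^ i * rising b i ≤⟨ *-monoˡ-≤ (rising b i) (pow-bound j) ⟩
      a * i ^ i * rising b i ≡⟨ lemma a (i ^ i) (rising b i) ⟩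
      i ^ i * (a * rising b i) ∎)
      where
      lemma : ∀ a p r → a * p * r ≡ p * (a * r)
      lemma = solve-∀
      scaled : i * b′ ≤ (i + 2) * b
      scaled = begin
        i * (b + q) ≡⟨ *-distribˡ-+ i b q ⟩
        i * b + i * q ≤⟨ +-monoʳ-≤ (i * b) div-lo ⟩
        i * b + 2 * b ≡⟨ sym (*-distribʳ-+ b i 2) ⟩
        (i + 2) * b ∎
    size′ : (i + 2 + suc s) * rising b′ i ≤ (2 + suc s) * (i ! * B (suc s + suc (2 * i)) i)
    size′ = *-cancelˡ-≤ (2 + s) (begin
      (2 + s) * ((i + 2 + suc s) * r′) ≤⟨ m≤m+n _ (i * r′) ⟩
      (2 + s) * ((i + 2 + suc s) * r′) + i * r′  ≡⟨ lemma₁ i s r′ ⟩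
      (3 + s) * (t * r′) ≤⟨ *-monoʳ-≤ (3 + s) (*-monoʳ-≤ t rising≤) ⟩
      (3 + s) * (t * (a * rising b i)) ≡⟨ lemma₂ (3 + s) t a (rising b i) ⟩
      (3 + s) * (a * (t * rising b i)) ≤⟨ *-monoʳ-≤ (3 + s) (*-monoʳ-≤ a size) ⟩
      (3 + s) * (a * ((2 + s) * (i ! * y))) ≡⟨ lemma₃ (3 + s) a (2 + s) (i !) y ⟩
      (2 + s) * ((3 + s) * (i ! * (a * y))) ≤⟨ *-monoʳ-≤ (2 + s) (*-monoʳ-≤ (3 + s) (*-monoʳ-≤ (i !) (B-grow (s + suc (2 * i)) i))) ⟩
      (2 + s) * ((3 + s) * (i ! * B (suc s + suc (2 * i)) i)) ∎)
      where
      r′ = rising b′ i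
      y = B (s + suc (2 * i)) i
      lemma₁ : ∀ i s r → (2 + s) * ((i + 2 + (1 + s)) * r) + i * r ≡ (3 + s) * ((i + 2 + s) * r)
      lemma₁ = solve-∀
      lemma₂ : ∀ x t a r → x * (t * (a * r)) ≡ x * (a * (t * r))
      lemma₂ = solve-∀
      lemma₃ : ∀ x a w f y → x * (a * (w * (f * y))) ≡ w * (x * (f * (a * y)))
      lemma₃ = solve-∀

-- Graphs with a ground vertex, contraction and proper colorings.

module GraphColorings where

  open Sequences
  open ColoringSums
  open StrictColorings
  open import Data.Nat as ℕ using (ℕ; zero; suc; z≤n; s≤s; _<_)
  import Data.Nat.Properties as ℕₚ
  open import Data.Integer as ℤ using (ℤ; +_; _+_; _*_; _-_; 0ℤ; 1ℤ)
  import Data.Integer.Properties as ℤₚ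
  open import Data.Integer.Tactic.RingSolver using (solve-∀)
  open import Data.Empty using (⊥-elim)
  open import Data.Product using (∃; _×_; _,_; proj₁; proj₂)
  import Data.Product.Properties as Productₚ
  open import Data.Sum using (_⊎_; inj₁; inj₂)
  open import Data.Fin as Fin using (Fin; zero; suc; punchIn; punchOut)
  import Data.Fin.Properties as Finₚ
  open import Data.Vec using (Vec; []; _∷_; lookup; insertAt)
  import Data.Vec.Properties as Vecₚ
  open import Data.List using (List; []; _∷_; map; length; tabulate; allFin)
  import Data.List.Properties as Listₚ
  open import Data.List.Relation.Unary.Any using (here; there)
  open import Data.List.Membership.Propositional using (_∈_)
  open import Data.List.Membership.DecPropositional using (_∈?_)
  open import Function using (_∘_; id)
  open import Relation.Nullary using (Dec; yes; no)
  open import Relation.Binary.Definitions using (tri<; tri≈; tri>)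
  open import Relation.Nullary.Decidable using (_×-dec_)
  open import Relation.Binary.PropositionalEquality using (_≡_; _≢_; _≗_; refl; sym; trans; cong; cong₂; subst; module ≡-Reasoning)

  sumVec : ∀ n → ℕ → (Vec ℕ n → ℤ) → ℤ
  sumVec zero    x φ = φ []
  sumVec (suc n) x φ = sum< x (λ y → sumVec n x (λ c → φ (y ∷ c)))

  Bounded : ∀ {n} → ℕ → Vec ℕ n → Set
  Bounded x c = ∀ i → lookup c i < x

  sumVec-cong : ∀ n x {φ ψ : Vec ℕ n → ℤ} → (∀ c → Bounded x c → φ c ≡ ψ c) → sumVec n x φ ≡ sumVec n x ψ
  sumVec-cong zero    x p = p [] (λ ())
  sumVec-cong (suc n) x p = sum<-cong x (λ y y<x → sumVec-cong n x (λ c b → p (y ∷ c) (λ { zero → y<x ; (suc i) → b i })))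

  sumVec-+ : ∀ n x (φ ψ : Vec ℕ n → ℤ) → sumVec n x (λ c → φ c + ψ c) ≡ sumVec n x φ + sumVec n x ψ
  sumVec-+ zero    x φ ψ = refl
  sumVec-+ (suc n) x φ ψ = trans (sum<-cong x (λ y _ → sumVec-+ n x _ _)) (sum<-+ x _ _)

  sumVec-*ˡ : ∀ n x k (φ : Vec ℕ n → ℤ) → sumVec n x (λ c → k * φ c) ≡ k * sumVec n x φ
  sumVec-*ˡ zero    x k φ = refl
  sumVec-*ˡ (suc n) x k φ = trans (sum<-cong x (λ y _ → sumVec-*ˡ n x k _)) (sum<-*ˡ x k _)

  sumVec-0 : ∀ n x → sumVec n x (λ _ → 0ℤ) ≡ 0ℤ
  sumVec-0 zero    x = refl
  sumVec-0 (suc n) x = trans (sum<-cong x (λ _ _ → sumVec-0 n x)) (sum<-0 x)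

  sum<-sumVec : ∀ w n x (φ : ℕ → Vec ℕ n → ℤ) → sum< w (λ y → sumVec n x (φ y)) ≡ sumVec n x (λ c → sum< w (λ y → φ y c))
  sum<-sumVec w zero    x φ = refl
  sum<-sumVec w (suc n) x φ = trans (sum<-swap w x _) (sum<-cong x (λ y _ → sum<-sumVec w n x _))

  sumVec-insert : ∀ n x (r : Fin (suc n)) (φ : Vec ℕ (suc n) → ℤ) →
                  sumVec (suc n) x φ ≡ sumVec n x (λ c → sum< x (λ y → φ (insertAt c r y)))
  sumVec-insert n       x zero    φ = sum<-sumVec x n x _
  sumVec-insert (suc n) x (suc r) φ = sum<-cong x (λ y _ → sumVec-insert n x r (λ c → φ (y ∷ c)))

  sum<-1 : ∀ x → sum< x (λ _ → 1ℤ) ≡ + x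
  sum<-1 zero    = refl
  sum<-1 (suc x) = cong (_+_ 1ℤ) (sum<-1 x)

  sumVec-1 : ∀ n x → sumVec n x (λ _ → 1ℤ) ≡ (+ x) ℤ.^ n
  sumVec-1 zero    x = refl
  sumVec-1 (suc n) x = begin
    sum< x (λ _ → sumVec n x (λ _ → 1ℤ)) ≡⟨ sum<-cong x (λ _ _ → trans (sumVec-1 n x) (sym (ℤₚ.*-identityʳ _))) ⟩
    sum< x (λ _ → (+ x) ℤ.^ n * 1ℤ) ≡⟨ sum<-*ˡ x ((+ x) ℤ.^ n) (λ _ → 1ℤ) ⟩
    (+ x) ℤ.^ n * sum< x (λ _ → 1ℤ) ≡⟨ cong (_*_ ((+ x) ℤ.^ n)) (sum<-1 x) ⟩
    (+ x) ℤ.^ n * + x ≡⟨ ℤₚ.*-comm ((+ x) ℤ.^ n) (+ x) ⟩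
    (+ x) ℤ.^ suc n ∎
    where open ≡-Reasoning

  sum<-pick : ∀ x t (ψ : Seq) → t < x → sum< x (λ y → ind (t ℕₚ.≟ y) * ψ y) ≡ ψ t
  sum<-pick (suc x) zero    ψ _ = trans (cong₂ _+_ (ℤₚ.*-identityˡ (ψ 0)) (sum<-0′ x)) (ℤₚ.+-identityʳ _)
    where
    sum<-0′ : ∀ x → sum< x (λ y → ind (0 ℕₚ.≟ suc y) * ψ (suc y)) ≡ 0ℤ
    sum<-0′ x = sum<-0 x
  sum<-pick (suc x) (suc t) ψ (s≤s t<x) = trans (ℤₚ.+-identityˡ _)
    (trans (sum<-cong x (λ y _ → cong (_* ψ (suc y)) (ind-cong (suc t ℕₚ.≟ suc y) (t ℕₚ.≟ y) ℕₚ.suc-injective (cong suc))))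
           (sum<-pick x t (ψ ∘ suc) t<x))

  -- Vertex zero is the ground vertex, which carries the color 0; an edge {suc i, suc j} stands
  -- for x_i = x_j and an edge {suc i, zero} for x_i = 0.
  Edge : ℕ → Set
  Edge n = Fin (suc n) × Fin (suc n)

  color : ∀ {n} → Vec ℕ n → Fin (suc n) → ℕ
  color c u = lookup (0 ∷ c) u

  equal : ∀ {n} → Edge n → Vec ℕ n → ℤ
  equal (u , v) c = ind (color c u ℕₚ.≟ color c v)

  proper : ∀ {n} → List (Edge n) → Vec ℕ n → ℤ
  proper []      c = 1ℤ
  proper (e ∷ E) c = (1ℤ - equal e c) * proper E c

  properCount : ∀ n → List (Edge n) → Seq
  properCount n E x = sumVec n x (proper E)

  -- The quotient map of a contraction: `suc r` is identified with `t` and deleted. As the deleted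
  -- vertex is a successor, the ground survives and stays `zero`.
  merge : ∀ {n} (t : Fin (2 ℕ.+ n)) (r : Fin (suc n)) → t ≢ suc r → Fin (2 ℕ.+ n) → Fin (suc n)
  merge t r t≢r w with suc r Fin.≟ w
  ... | yes _   = punchOut (t≢r ∘ sym)
  ... | no  r≢w = punchOut r≢w

  merge-removed : ∀ {n} t (r : Fin (suc n)) t≢r → merge t r t≢r (suc r) ≡ punchOut {i = suc r} (t≢r ∘ sym)
  merge-removed t r t≢r with suc r Fin.≟ suc r
  ... | yes _   = refl
  ... | no  r≢r = ⊥-elim (r≢r refl)

  merge-kept : ∀ {n} t (r : Fin (suc n)) t≢r w (r≢w : suc r ≢ w) → merge t r t≢r w ≡ punchOut r≢w
  merge-kept t r t≢r w r≢w with suc r Fin.≟ w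
  ... | yes r≡w = ⊥-elim (r≢w r≡w)
  ... | no  r≢w′ = Finₚ.punchOut-cong (suc r) {w} {w} {r≢w′} {r≢w} refl

  merge-target : ∀ {n} t (r : Fin (suc n)) t≢r → merge t r t≢r t ≡ merge t r t≢r (suc r)
  merge-target t r t≢r = trans (merge-kept t r t≢r t (t≢r ∘ sym)) (sym (merge-removed t r t≢r))

  merge-fiber : ∀ {n} t (r : Fin (suc n)) t≢r a b → merge t r t≢r a ≡ merge t r t≢r b →
                a ≡ b ⊎ (a ≡ t × b ≡ suc r) ⊎ (a ≡ suc r × b ≡ t)
  merge-fiber t r t≢r a b p with suc r Fin.≟ a | suc r Fin.≟ b
  ... | yes refl | yes refl = inj₁ refl
  ... | yes refl | no  r≢b  = inj₂ (inj₂ (refl , sym (Finₚ.punchOut-injective (t≢r ∘ sym) r≢b p)))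
  ... | no  r≢a  | yes refl = inj₂ (inj₁ (Finₚ.punchOut-injective r≢a (t≢r ∘ sym) p , refl))
  ... | no  r≢a  | no  r≢b  = inj₁ (Finₚ.punchOut-injective r≢a r≢b p)

  -- Every edge that is not a loop has an end other than the ground; `link` singles out such an end
  -- `suc r` for deletion, wherever it stands in the pair.
  data Kind : ∀ {n} → Edge n → Set where
    loop : ∀ {n} {e : Edge n} → proj₁ e ≡ proj₂ e → Kind e
    link : ∀ {n} {e : Edge (suc n)} t r → t ≢ suc r → e ≡ (t , suc r) ⊎ e ≡ (suc r , t) → Kind e

  kind : ∀ {n} (e : Edge n) → Kind e
  kind {zero}  (zero , zero) = loop refl
  kind {suc n} (u , v) with u Fin.≟ v
  ... | yes u≡v = loop u≡v
  kind {suc n} (u , suc v)    | no u≢v = link u v u≢v (inj₁ refl)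
  kind {suc n} (zero , zero)  | no u≢v = ⊥-elim (u≢v refl)
  kind {suc n} (suc u , zero) | no u≢v = link zero u (λ ()) (inj₂ refl)

  mapEdge : ∀ {m n} → (Fin (suc m) → Fin (suc n)) → Edge m → Edge n
  mapEdge f (u , v) = f u , f v

  contract : ∀ {n} t (r : Fin (suc n)) → t ≢ suc r → List (Edge (suc n)) → List (Edge n)
  contract t r t≢r = map (mapEdge (merge t r t≢r))

  equal-loop : ∀ {n} (e : Edge n) c → proj₁ e ≡ proj₂ e → equal e c ≡ 1ℤ
  equal-loop (u , .u) c refl = ind-yes (color c u ℕₚ.≟ color c u) refl

  equal-swap : ∀ {n} u v (c : Vec ℕ n) → equal (u , v) c ≡ equal (v , u) c
  equal-swap u v c = ind-cong _ _ sym sym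

  module _ {n} (t : Fin (2 ℕ.+ n)) (r : Fin (suc n)) (t≢r : t ≢ suc r) where
    private
      π = merge t r t≢r

    color-removed : ∀ (c : Vec ℕ n) y → color (insertAt c r y) (suc r) ≡ y
    color-removed c y = Vecₚ.insertAt-lookup c r y

    color-kept : ∀ (c : Vec ℕ n) y w → suc r ≢ w → color (insertAt c r y) w ≡ color c (π w)
    color-kept c y w r≢w = begin
      lookup (insertAt (0 ∷ c) (suc r) y) w ≡⟨ cong (lookup (insertAt (0 ∷ c) (suc r) y)) (sym (Finₚ.punchIn-punchOut r≢w)) ⟩
      lookup (insertAt (0 ∷ c) (suc r) y) (punchIn (suc r) (punchOut r≢w))  ≡⟨ Vecₚ.insertAt-punchIn (0 ∷ c) (suc r) y (punchOut r≢w) ⟩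
      lookup (0 ∷ c) (punchOut r≢w) ≡⟨ cong (lookup (0 ∷ c)) (sym (merge-kept t r t≢r w r≢w)) ⟩
      color c (π w) ∎
      where open ≡-Reasoning

    color-merge : ∀ (c : Vec ℕ n) w → color (insertAt c r (color c (π t))) w ≡ color c (π w)
    color-merge c w with suc r Fin.≟ w
    ... | no r≢w   = trans (color-kept c _ w r≢w) (cong (color c) (merge-kept t r t≢r w r≢w))
    ... | yes refl = trans (color-removed c _) (cong (color c) (trans (merge-target t r t≢r) (merge-removed t r t≢r)))

    proper-merge : ∀ E (c : Vec ℕ n) → proper E (insertAt c r (color c (π t))) ≡ proper (contract t r t≢r E) c
    proper-merge []            c = refl
    proper-merge ((u , v) ∷ E) c = cong₂ (λ p q → (1ℤ - p) * q)
      (cong₂ (λ a b → ind (a ℕₚ.≟ b)) (color-merge c u) (color-merge c v)) (proper-merge E c)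

    color-bounded : ∀ {x} (c : Vec ℕ n) → Bounded (suc x) c → ∀ w → color c w < suc x
    color-bounded c b zero    = s≤s z≤n
    color-bounded c b (suc i) = b i

    -- A coloring that is constant on the edge is determined by its restriction to the other
    -- vertices. The number of colors is positive because `t` may be the ground, whose color 0 must
    -- be available.
    sumVec-equal : ∀ x (φ : Vec ℕ (suc n) → ℤ) →
      sumVec (suc n) (suc x) (λ c → equal (t , suc r) c * φ c) ≡ sumVec n (suc x) (λ c → φ (insertAt c r (color c (π t))))
    sumVec-equal x φ = trans (sumVec-insert n (suc x) r (λ c → equal (t , suc r) c * φ c)) (sumVec-cong n (suc x) (λ c b → begin
      sum< (suc x) (λ y → equal (t , suc r) (insertAt c r y) * φ (insertAt c r y))
        ≡⟨ sum<-cong (suc x) (λ y _ → cong (_* φ (insertAt c r y))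
             (cong₂ (λ a b → ind (a ℕₚ.≟ b)) (color-kept c y t (t≢r ∘ sym)) (color-removed c y))) ⟩
      sum< (suc x) (λ y → ind (color c (π t) ℕₚ.≟ y) * φ (insertAt c r y))
        ≡⟨ sum<-pick (suc x) (color c (π t)) (λ y → φ (insertAt c r y)) (color-bounded c b (π t)) ⟩
      φ (insertAt c r (color c (π t))) ∎))
      where open ≡-Reasoning

    sumVec-contract : ∀ E x → sumVec (suc n) (suc x) (λ c → equal (t , suc r) c * proper E c) ≡ properCount n (contract t r t≢r E) (suc x)
    sumVec-contract E x = trans (sumVec-equal x (proper E)) (sumVec-cong n (suc x) (λ c _ → proper-merge E c))

  equal-link : ∀ {n} {e : Edge (suc n)} {t r} → e ≡ (t , suc r) ⊎ e ≡ (suc r , t) → ∀ c → equal e c ≡ equal (t , suc r) c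
  equal-link         (inj₁ refl) c = refl
  equal-link {t = t} {r} (inj₂ refl) c = equal-swap (suc r) t c

  properCount-loop : ∀ n e E x → proj₁ e ≡ proj₂ e → properCount n (e ∷ E) x ≡ 0ℤ
  properCount-loop n e E x p = trans (sumVec-cong n x (λ c _ → cong (λ w → (1ℤ - w) * proper E c) (equal-loop e c p))) (sumVec-0 n x)

  -- Deletion and contraction: among the colorings proper on `E`, those constant on `e` are the
  -- proper colorings of the contraction.
  properCount-link : ∀ n e t (r : Fin (suc n)) t≢r → e ≡ (t , suc r) ⊎ e ≡ (suc r , t) → ∀ E x →
    properCount (suc n) (e ∷ E) (suc x) ≡ properCount (suc n) E (suc x) - properCount n (contract t r t≢r E) (suc x)
  properCount-link n e t r t≢r e≡ E x = begin
    sumVec (suc n) (suc x) (λ c → (1ℤ - equal e c) * proper E c)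
      ≡⟨ sumVec-cong (suc n) (suc x) (λ c _ → trans (cong (λ w → (1ℤ - w) * proper E c) (equal-link e≡ c)) (lemma (equal (t , suc r) c) (proper E c))) ⟩
    sumVec (suc n) (suc x) (λ c → proper E c + -1ℤ * (equal (t , suc r) c * proper E c))
      ≡⟨ sumVec-+ (suc n) (suc x) (proper E) (λ c → -1ℤ * (equal (t , suc r) c * proper E c)) ⟩
    properCount (suc n) E (suc x) + sumVec (suc n) (suc x) (λ c → -1ℤ * (equal (t , suc r) c * proper E c))
      ≡⟨ cong (_+_ (properCount (suc n) E (suc x))) (trans (sumVec-*ˡ (suc n) (suc x) -1ℤ (λ c → equal (t , suc r) c * proper E c))
           (trans (cong (_*_ -1ℤ) (sumVec-contract t r t≢r E x)) (ℤₚ.-1*i≡-i _))) ⟩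
    properCount (suc n) E (suc x) - properCount n (contract t r t≢r E) (suc x) ∎
    where
    open ≡-Reasoning
    lemma : ∀ p q → (1ℤ - p) * q ≡ q + (ℤ.- 1ℤ) * (p * q)
    lemma = solve-∀

  -- From proper colorings to strict colorings of orientations.

  module Orientation {n : ℕ} where

    Arcs : Set
    Arcs = List (Fin n × Fin n)

    Respects : Arcs → List (Fin n) → Vec ℕ n → Set
    Respects A M c = (∀ {a} → a ∈ A → lookup c (proj₁ a) < lookup c (proj₂ a)) × (∀ {i} → i ∈ M → 1 ℕ.≤ lookup c i)

    abstract
      Respects? : ∀ A M c → Dec (Respects A M c)
      Respects? A M c = ∀∈? (λ a → lookup c (proj₁ a) ℕₚ.<? lookup c (proj₂ a)) A ×-dec ∀∈? (λ i → 1 ℕₚ.≤? lookup c i) M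

    respects : Arcs → List (Fin n) → Vec ℕ n → ℤ
    respects A M c = ind (Respects? A M c)

    respects-arc : ∀ i j A M c → respects ((i , j) ∷ A) M c ≡ ind (lookup c i ℕₚ.<? lookup c j) * respects A M c
    respects-arc i j A M c = trans
      (ind-cong (Respects? ((i , j) ∷ A) M c) ((lookup c i ℕₚ.<? lookup c j) ×-dec Respects? A M c)
        (λ (p , q) → p (here refl) , (p ∘ there) , q)
        (λ (l , p , q) → (λ { (here refl) → l ; (there a∈) → p a∈ }) , q))
      (ind-× (lookup c i ℕₚ.<? lookup c j) (Respects? A M c))

    respects-mark : ∀ j A M c → respects A (j ∷ M) c ≡ ind (1 ℕₚ.≤? lookup c j) * respects A M c
    respects-mark j A M c = trans
      (ind-cong (Respects? A (j ∷ M) c) ((1 ℕₚ.≤? lookup c j) ×-dec Respects? A M c)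
        (λ (p , q) → q (here refl) , p , (q ∘ there))
        (λ (l , p , q) → p , (λ { (here refl) → l ; (there a∈) → q a∈ })))
      (ind-× (1 ℕₚ.≤? lookup c j) (Respects? A M c))

    assoc : ∀ {k} → (Fin k → Fin n) → Vec ℕ k → Coloring {Fin n}
    assoc g []      = []
    assoc g (y ∷ c) = (g zero , y) ∷ assoc (g ∘ suc) c

    assoc⁺ : ∀ {k} (g : Fin k → Fin n) c i → (g i , lookup c i) ∈ assoc g c
    assoc⁺ g (y ∷ c) zero    = here refl
    assoc⁺ g (y ∷ c) (suc i) = there (assoc⁺ (g ∘ suc) c i)

    assoc⁻ : ∀ {k} (g : Fin k → Fin n) c {p} → p ∈ assoc g c → ∃ λ i → p ≡ (g i , lookup c i)
    assoc⁻ g (y ∷ c) (here refl) = zero , refl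
    assoc⁻ g (y ∷ c) (there p∈) with assoc⁻ (g ∘ suc) c p∈
    ... | i , refl = suc i , refl

    sumCol-assoc : ∀ {k} (g : Fin k → Fin n) x φ → sumCol (tabulate g) x φ ≡ sumVec k x (λ c → φ (assoc g c))
    sumCol-assoc {zero}  g x φ = refl
    sumCol-assoc {suc k} g x φ = sum<-cong x (λ y _ → sumCol-assoc (g ∘ suc) x _)

    arcs-cone : ∀ A M → Cone (suc n) (iter Δ (suc n) (positivePart (λ x → sumVec n x (respects A M))))
    arcs-cone A M = subst (λ k → Cone (suc k) (iter Δ (suc k) (positivePart (λ x → sumVec n x (respects A M))))) (Listₚ.length-tabulate {n = n} id)
      (resp (iter-cong Δ-cong (suc (length (allFin n))) same) (cone-hPoly marks (length (allFin n)) (allFin n) ℕₚ.≤-refl))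
      where
      R : Fin n → Fin n → Set
      R i j = (i , j) ∈ A
      R? : ∀ i j → Dec (R i j)
      R? i j = _∈?_ (Productₚ.≡-dec Fin._≟_ Fin._≟_) (i , j) A
      open Strict R R?
      marks : Marks
      marks = record { Mem = _∈ M ; mem? = λ i → _∈?_ Fin._≟_ i M }
      legal⇒ : ∀ c → Legal marks (assoc id c) → Respects A M c
      legal⇒ c (p , q) = (λ a∈ → p (assoc⁺ id c _) (assoc⁺ id c _) a∈) , (λ i∈ → q (assoc⁺ id c _) i∈)
      legal⇐ : ∀ c → Respects A M c → Legal marks (assoc id c)
      legal⇐ c (p , q) =
        (λ p∈ q∈ r → inc (assoc⁻ id c p∈) (assoc⁻ id c q∈) r) , (λ p∈ m → pos (assoc⁻ id c p∈) m)
        where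
        inc : ∀ {p q : Fin n × ℕ} → (∃ λ i → p ≡ (i , lookup c i)) → (∃ λ i → q ≡ (i , lookup c i)) → R (proj₁ p) (proj₁ q) → proj₂ p < proj₂ q
        inc (i , refl) (j , refl) r = p r
        pos : ∀ {p : Fin n × ℕ} → (∃ λ i → p ≡ (i , lookup c i)) → proj₁ p ∈ M → 1 ℕ.≤ proj₂ p
        pos (i , refl) m = q m
      same : count⁺ marks (allFin n) ≗ positivePart (λ x → sumVec n x (respects A M))
      same zero    = refl
      same (suc x) = trans (sumCol-assoc id (suc x) (legalInd marks))
        (sumVec-cong n (suc x) (λ c _ → ind-cong (Legal? marks (assoc id c)) (Respects? A M c) (legal⇒ c) (legal⇐ c)))

    neq : Edge n → Vec ℕ n → ℤ
    neq e c = 1ℤ - equal e c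

    neq-ground : ∀ j c → neq (zero , suc j) c ≡ ind (1 ℕₚ.≤? lookup c j)
    neq-ground j c with lookup c j
    ... | zero  = refl
    ... | suc y = refl

    neq-order : ∀ i j c → neq (suc i , suc j) c ≡ ind (lookup c i ℕₚ.<? lookup c j) + ind (lookup c j ℕₚ.<? lookup c i)
    neq-order i j c = cases (lookup c i) (lookup c j)
      where
      cases : ∀ a b → 1ℤ - ind (a ℕₚ.≟ b) ≡ ind (a ℕₚ.<? b) + ind (b ℕₚ.<? a)
      cases a b with ℕₚ.<-cmp a b
      ... | tri< a<b a≢b b≮a rewrite ind-no (a ℕₚ.≟ b) a≢b | ind-yes (a ℕₚ.<? b) a<b | ind-no (b ℕₚ.<? a) b≮a = refl
      ... | tri≈ a≮b a≡b b≮a rewrite ind-yes (a ℕₚ.≟ b) a≡b | ind-no (a ℕₚ.<? b) a≮b | ind-no (b ℕₚ.<? a) b≮a = refl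
      ... | tri> a≮b a≢b b<a rewrite ind-no (a ℕₚ.≟ b) a≢b | ind-no (a ℕₚ.<? b) a≮b | ind-yes (b ℕₚ.<? a) b<a = refl

    weighted : List (Edge n) → Arcs → List (Fin n) → Seq
    weighted E A M x = sumVec n x (λ c → proper E c * respects A M c)

    W : List (Edge n) → Arcs → List (Fin n) → Set
    W E A M = Cone (suc n) (iter Δ (suc n) (positivePart (weighted E A M)))

    positivePart-cong : ∀ {a b : Seq} → a ≗ b → positivePart a ≗ positivePart b
    positivePart-cong p zero    = refl
    positivePart-cong p (suc i) = p (suc i)

    transport : ∀ {a b : Seq} → a ≗ b → Cone (suc n) (iter Δ (suc n) (positivePart a)) → Cone (suc n) (iter Δ (suc n) (positivePart b))
    transport p = resp (iter-cong Δ-cong (suc n) (positivePart-cong p))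

    mark-cone : ∀ e j → (∀ c → neq e c ≡ ind (1 ℕₚ.≤? lookup c j)) → ∀ E A M → W E A (j ∷ M) → W (e ∷ E) A M
    mark-cone e j p E A M = transport (λ x → sumVec-cong n x (λ c _ → sym (begin
      neq e c * proper E c * respects A M c ≡⟨ lemma (neq e c) (proper E c) (respects A M c) ⟩
      proper E c * (neq e c * respects A M c) ≡⟨ cong (λ w → proper E c * (w * respects A M c)) (p c) ⟩
      proper E c * (ind (1 ℕₚ.≤? lookup c j) * respects A M c) ≡⟨ cong (_*_ (proper E c)) (sym (respects-mark j A M c)) ⟩
      proper E c * respects A (j ∷ M) c ∎)))
      where
      open ≡-Reasoning
      lemma : ∀ a b c → a * b * c ≡ b * (a * c)
      lemma = solve-∀

    -- Edges are traded one by one. An edge to the ground says that its other end is nonzero and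
    -- becomes a mark; any other edge says that two colors differ, so one of its two orientations is
    -- increasing. Orientations with cycles admit no colorings and do no harm.
    oriented-cone : ∀ E A M → W E A M
    oriented-cone [] A M = transport (λ x → sumVec-cong n x (λ c _ → sym (ℤₚ.*-identityˡ _))) (arcs-cone A M)
    oriented-cone ((zero , zero) ∷ E) A M = transport
      (λ x → sym (trans (sumVec-cong n x (λ c _ → refl)) (sumVec-0 n x)))
      (resp (λ i → sym (trans (iter-cong Δ-cong (suc n) (λ { zero → refl ; (suc _) → refl }) i) (iterΔ-0 (suc n) i))) nil)
    oriented-cone ((zero , suc j) ∷ E) A M = mark-cone (zero , suc j) j (neq-ground j) E A M (oriented-cone E A (j ∷ M))
    oriented-cone ((suc j , zero) ∷ E) A M = mark-cone (suc j , zero) j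
      (λ c → trans (cong (_-_ 1ℤ) (equal-swap (suc j) zero c)) (neq-ground j c)) E A M (oriented-cone E A (j ∷ M))
    oriented-cone ((suc i , suc j) ∷ E) A M = resp
      (λ k → trans (sym (iterΔ-⊕ (suc n) (positivePart (weighted E ((i , j) ∷ A) M)) (positivePart (weighted E ((j , i) ∷ A) M)) k)) (iter-cong Δ-cong (suc n) (λ { zero → refl ; (suc x) → combine (suc x) }) k))
      (add (oriented-cone E ((i , j) ∷ A) M) (oriented-cone E ((j , i) ∷ A) M))
      where
      open ≡-Reasoning
      lemma : ∀ p a b r → p * (a * r) + p * (b * r) ≡ (a + b) * p * r
      lemma = solve-∀
      combine : ∀ x → weighted E ((i , j) ∷ A) M x + weighted E ((j , i) ∷ A) M x ≡ weighted ((suc i , suc j) ∷ E) A M x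
      combine x = trans (sym (sumVec-+ n x (λ c → proper E c * respects ((i , j) ∷ A) M c) (λ c → proper E c * respects ((j , i) ∷ A) M c))) (sumVec-cong n x (λ c _ → begin
        proper E c * respects ((i , j) ∷ A) M c + proper E c * respects ((j , i) ∷ A) M c
          ≡⟨ cong₂ (λ p q → proper E c * p + proper E c * q) (respects-arc i j A M c) (respects-arc j i A M c) ⟩
        proper E c * (ind (lookup c i ℕₚ.<? lookup c j) * respects A M c) + proper E c * (ind (lookup c j ℕₚ.<? lookup c i) * respects A M c)
          ≡⟨ lemma (proper E c) (ind (lookup c i ℕₚ.<? lookup c j)) (ind (lookup c j ℕₚ.<? lookup c i)) (respects A M c) ⟩
        (ind (lookup c i ℕₚ.<? lookup c j) + ind (lookup c j ℕₚ.<? lookup c i)) * proper E c * respects A M c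
          ≡⟨ cong (λ w → w * proper E c * respects A M c) (sym (neq-order i j c)) ⟩
        neq (suc i , suc j) c * proper E c * respects A M c ∎))

    properCount-cone : ∀ E → Cone (suc n) (iter Δ (suc n) (positivePart (properCount n E)))
    properCount-cone E = transport (λ x → sumVec-cong n x (λ c _ →
      trans (cong (_*_ (proper E c)) (ind-yes (Respects? [] [] c) ((λ ()) , (λ ())))) (ℤₚ.*-identityʳ _))) (oriented-cone E [] [])

-- Numerators at odd arguments, their sums `hVec`, and bounds by Eulerian numbers.

module HVectors where

  open Sequences
  open ColoringSums
  open Eulerian using (B; B-above; B-grow)
  open GraphColorings
  open import Data.Nat as ℕ using (ℕ; zero; suc; z≤n; s≤s; _∸_)
  import Data.Nat.Properties as ℕₚ
  open import Data.Nat.Tactic.RingSolver using () renaming (solve-∀ to ℕ-solve-∀)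
  open import Data.Integer as ℤ using (+_; _+_; _*_; _-_; _≤_; 0ℤ; 1ℤ; +≤+)
  import Data.Integer.Properties as ℤₚ
  open import Data.Integer.Tactic.RingSolver using (solve-∀)
  open import Data.Empty using (⊥-elim)
  open import Data.Product using (_×_; _,_; proj₁; proj₂; swap)
  open import Data.Sum using (_⊎_; inj₁; inj₂)
  open import Data.Fin using (Fin; zero; suc)
  open import Data.List using (List; []; _∷_; length)
  import Data.List.Properties as Listₚ
  open import Data.List.Relation.Unary.All as All using (All; []; _∷_)
  import Data.List.Relation.Unary.All.Properties as Allₚ
  open import Data.List.Relation.Unary.AllPairs using (AllPairs; []; _∷_)
  open import Function using (_∘_)
  open import Relation.Nullary using (yes; no)
  open import Relation.Binary.PropositionalEquality using (_≡_; _≢_; _≗_; refl; sym; trans; cong; cong₂; subst; subst₂; module ≡-Reasoning)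

  oddSample : Seq → Seq
  oddSample a j = a (2 ℕ.* j ℕ.+ 1)

  private
    odd≡ : ∀ j → 2 ℕ.* j ℕ.+ 1 ≡ suc (2 ℕ.* j)
    odd≡ j = ℕₚ.+-comm (2 ℕ.* j) 1

    odd-suc : ∀ j → 2 ℕ.* suc j ℕ.+ 1 ≡ suc (suc (suc (2 ℕ.* j)))
    odd-suc = lemma
      where
      lemma : ∀ j → 2 ℕ.* (1 ℕ.+ j) ℕ.+ 1 ≡ 3 ℕ.+ 2 ℕ.* j
      lemma = ℕ-solve-∀

  -- `(1+t)(1-t) = 1 - t²`, and `t²` acts on the odd coefficients as the shift.
  oddSample-step : ∀ a → oddSample (1+shift (Δ a)) ≗ Δ (oddSample a)
  oddSample-step a zero    = lemma (a 1) (a 0)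
    where
    lemma : ∀ x y → x - y + (y - 0ℤ) ≡ x - 0ℤ
    lemma = solve-∀
  oddSample-step a (suc j) = trans (cong (1+shift (Δ a)) (odd-suc j))
    (trans (lemma (a (3 ℕ.+ 2 ℕ.* j)) (a (2 ℕ.+ 2 ℕ.* j)) (a (1 ℕ.+ 2 ℕ.* j)))
           (sym (cong₂ (λ k l → a k - a l) (odd-suc j) (odd≡ j))))
    where
    lemma : ∀ x y z → x - y + (y - z) ≡ x - z
    lemma = solve-∀

  1+shift-Δ : ∀ a → 1+shift (Δ a) ≗ Δ (1+shift a)
  1+shift-Δ a zero          = lemma (a 0)
    where
    lemma : ∀ x → x - 0ℤ + 0ℤ ≡ x + 0ℤ - 0ℤ
    lemma = solve-∀
  1+shift-Δ a (suc zero)    = lemma (a 1) (a 0)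
    where
    lemma : ∀ x y → x - y + (y - 0ℤ) ≡ x + y - (y + 0ℤ)
    lemma = solve-∀
  1+shift-Δ a (suc (suc i)) = lemma (a (2 ℕ.+ i)) (a (1 ℕ.+ i)) (a i)
    where
    lemma : ∀ x y z → x - y + (y - z) ≡ x + y - (y + z)
    lemma = solve-∀

  oddSample-iter : ∀ m a → oddSample (iter 1+shift m (iter Δ m a)) ≗ iter Δ m (oddSample a)
  oddSample-iter zero    a j = refl
  oddSample-iter (suc m) a j = begin
    1+shift (iter 1+shift m (Δ (iter Δ m a))) (2 ℕ.* j ℕ.+ 1)
      ≡⟨ 1+shift-cong (iter-comm {f = 1+shift} {g = Δ} 1+shift-cong 1+shift-Δ m (iter Δ m a)) (2 ℕ.* j ℕ.+ 1) ⟩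
    1+shift (Δ (iter 1+shift m (iter Δ m a))) (2 ℕ.* j ℕ.+ 1)
      ≡⟨ oddSample-step (iter 1+shift m (iter Δ m a)) j ⟩
    Δ (oddSample (iter 1+shift m (iter Δ m a))) j
      ≡⟨ Δ-cong (oddSample-iter m a) j ⟩
    iter Δ (suc m) (oddSample a) j ∎
    where open ≡-Reasoning

  pVec : ∀ n → List (Edge n) → Seq
  pVec n E = iter Δ (suc n) (oddSample (properCount n E))

  module _ (n : ℕ) (E : List (Edge n)) where
    private
      y : Seq
      y = iter 1+shift (suc n) (iter Δ (suc n) (positivePart (properCount n E)))

      y-cone : Cone (suc n ℕ.+ suc n) y
      y-cone = cone-iter-1+shift (suc n) (Orientation.properCount-cone E)

      y≡p : ∀ i → y (suc (2 ℕ.* i)) ≡ pVec n E i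
      y≡p i = trans (cong y (sym (odd≡ i))) (trans (oddSample-iter (suc n) (positivePart (properCount n E)) i)
        (iter-cong Δ-cong (suc n) odd-positive i))
        where
        odd-positive : oddSample (positivePart (properCount n E)) ≗ oddSample (properCount n E)
        odd-positive j rewrite odd≡ j = refl

      double : suc n ℕ.+ suc n ≡ 2 ℕ.* n ℕ.+ 2
      double = lemma n
        where
        lemma : ∀ n → 1 ℕ.+ n ℕ.+ (1 ℕ.+ n) ≡ 2 ℕ.* n ℕ.+ 2
        lemma = ℕ-solve-∀

    pVec-nonneg : ∀ i → 0ℤ ≤ pVec n E i
    pVec-nonneg i = subst (0ℤ ≤_) (y≡p i) (cone-nonneg y-cone (suc (2 ℕ.* i)))

    pVec-mirror : ∀ i k → i ℕ.≤ k → i ℕ.+ k ℕ.≤ n → pVec n E i ≤ pVec n E k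
    pVec-mirror i k i≤k i+k≤n = subst₂ _≤_ (y≡p i) (y≡p k)
      (cone-mirror y-cone (suc (2 ℕ.* i)) (suc (2 ℕ.* k)) (s≤s (ℕₚ.*-monoʳ-≤ 2 i≤k))
        (subst₂ ℕ._≤_ (lemma i k) (sym double) (ℕₚ.+-monoˡ-≤ 2 (ℕₚ.*-monoʳ-≤ 2 i+k≤n))))
      where
      lemma : ∀ i k → 2 ℕ.* (i ℕ.+ k) ℕ.+ 2 ≡ 1 ℕ.+ 2 ℕ.* i ℕ.+ (1 ℕ.+ 2 ℕ.* k)
      lemma = ℕ-solve-∀

    -- Consecutive coefficients of `pVec` are two apart in `y`, so `cone-lym` is applied twice,
    -- through `y (2i+2)`. For weight `2n+2` the product of the two ratios is `(n-i)/(i+1)` times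
    -- `c′/c ≥ 1`; `k` is chosen so that `n - i = 2 + i + k`.
    pVec-lym : ∀ i k → n ≡ 2 ℕ.+ (2 ℕ.* i ℕ.+ k) → + (2 ℕ.+ (i ℕ.+ k)) * pVec n E i ≤ + suc i * pVec n E (suc i)
    pVec-lym i k n≡ = ℤₚ.*-cancelˡ-≤-pos _ _ (+ 2 * + c) (begin
      + 2 * + c * (+ a * p₀) ≡⟨ exchange (+ c) (+ a) p₀ ⟩
      + 2 * + a * (+ c * p₀) ≤⟨ ℤₚ.*-monoˡ-≤-nonNeg (+ 2 * + a) (ℤₚ.*-monoʳ-≤-nonNeg p₀ {{ℤ.nonNegative (pVec-nonneg i)}} (+≤+ c≤c′)) ⟩
      + 2 * + a * (+ c′ * p₀) ≤⟨ ℤₚ.*-monoˡ-≤-nonNeg (+ 2 * + a) step₁ ⟩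
      + 2 * + a * (+ 2 * + suc i * p₁) ≡⟨ exchange′ (+ 2 * + a) (+ 2 * + suc i) p₁ ⟩
      + 2 * + suc i * (+ 2 * + a * p₁) ≤⟨ ℤₚ.*-monoˡ-≤-nonNeg (+ 2 * + suc i) step₂ ⟩
      + 2 * + suc i * (+ c * p₂) ≡⟨ exchange (+ suc i) (+ c) p₂ ⟩
      + 2 * + c * (+ suc i * p₂) ∎)
      where
      open ℤₚ.≤-Reasoning
      a = 2 ℕ.+ (i ℕ.+ k)
      c = 3 ℕ.+ 2 ℕ.* i
      c′ = 5 ℕ.+ 2 ℕ.* (i ℕ.+ k)
      d = suc n ℕ.+ suc n
      p₀ = pVec n E i
      p₁ = y (2 ℕ.+ 2 ℕ.* i)
      p₂ = pVec n E (suc i)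
      exchange : ∀ c a p → + 2 * c * (a * p) ≡ + 2 * a * (c * p)
      exchange = solve-∀
      exchange′ : ∀ a b p → a * (b * p) ≡ b * (a * p)
      exchange′ = solve-∀
      c≤c′ : c ℕ.≤ c′
      c≤c′ = ℕₚ.+-mono-≤ {3} {5} (s≤s (s≤s (s≤s z≤n))) (ℕₚ.*-monoʳ-≤ 2 (ℕₚ.m≤m+n i k))
      d≡ : d ≡ 6 ℕ.+ 4 ℕ.* i ℕ.+ 2 ℕ.* k
      d≡ = trans (cong (λ n → suc n ℕ.+ suc n) n≡) (lemma i k)
        where
        lemma : ∀ i k → 1 ℕ.+ (2 ℕ.+ (2 ℕ.* i ℕ.+ k)) ℕ.+ (1 ℕ.+ (2 ℕ.+ (2 ℕ.* i ℕ.+ k))) ≡ 6 ℕ.+ 4 ℕ.* i ℕ.+ 2 ℕ.* k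
        lemma = ℕ-solve-∀
      gap : ∀ x m → d ≡ m ℕ.+ x → + d - + x ≡ + m
      gap x m e = trans (cong (λ d → + d - + x) e) (lemma (+ m) (+ x))
        where
        lemma : ∀ m x → m + x - x ≡ m
        lemma = solve-∀
      gap₁ : d ≡ c′ ℕ.+ suc (2 ℕ.* i)
      gap₁ = trans d≡ (lemma i k)
        where
        lemma : ∀ i k → 6 ℕ.+ 4 ℕ.* i ℕ.+ 2 ℕ.* k ≡ 5 ℕ.+ 2 ℕ.* (i ℕ.+ k) ℕ.+ (1 ℕ.+ 2 ℕ.* i)
        lemma = ℕ-solve-∀
      gap₂ : d ≡ 2 ℕ.* a ℕ.+ (2 ℕ.+ 2 ℕ.* i)
      gap₂ = trans d≡ (lemma i k)
        where
        lemma : ∀ i k → 6 ℕ.+ 4 ℕ.* i ℕ.+ 2 ℕ.* k ≡ 2 ℕ.* (2 ℕ.+ (i ℕ.+ k)) ℕ.+ (2 ℕ.+ 2 ℕ.* i)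
        lemma = ℕ-solve-∀
      bound : 2 ℕ.* (2 ℕ.+ 2 ℕ.* i) ℕ.+ 1 ℕ.≤ d
      bound = ℕₚ.≤-trans (ℕₚ.m≤m+n (2 ℕ.* (2 ℕ.+ 2 ℕ.* i) ℕ.+ 1) (1 ℕ.+ 2 ℕ.* k)) (ℕₚ.≤-reflexive (sym (trans d≡ (lemma i k))))
        where
        lemma : ∀ i k → 6 ℕ.+ 4 ℕ.* i ℕ.+ 2 ℕ.* k ≡ 2 ℕ.* (2 ℕ.+ 2 ℕ.* i) ℕ.+ 1 ℕ.+ (1 ℕ.+ 2 ℕ.* k)
        lemma = ℕ-solve-∀
      double-suc : ∀ i → 2 ℕ.+ 2 ℕ.* i ≡ 2 ℕ.* (1 ℕ.+ i)
      double-suc = ℕ-solve-∀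
      step₁ : + c′ * p₀ ≤ + 2 * + suc i * p₁
      step₁ = subst₂ _≤_ (cong₂ _*_ (gap (suc (2 ℕ.* i)) c′ gap₁) (y≡p i)) (cong (_* p₁) (trans (cong +_ (double-suc i)) (ℤₚ.pos-* 2 (suc i))))
        (cone-lym y-cone (suc (2 ℕ.* i)) (ℕₚ.≤-trans (ℕₚ.+-monoˡ-≤ 1 (ℕₚ.*-monoʳ-≤ 2 (ℕₚ.n≤1+n (suc (2 ℕ.* i))))) bound))
      step₂ : + 2 * + a * p₁ ≤ + c * p₂
      step₂ = subst₂ _≤_ (cong (_* p₁) (trans (gap (2 ℕ.+ 2 ℕ.* i) (2 ℕ.* a) gap₂) (ℤₚ.pos-* 2 a))) (cong (_*_ (+ c)) (trans (cong (y ∘ suc) (double-suc i)) (y≡p (suc i))))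
        (cone-lym y-cone (2 ℕ.+ 2 ℕ.* i) bound)

  odd^ : ℕ → Seq
  odd^ n j = (+ (2 ℕ.* j ℕ.+ 1)) ℤ.^ n

  byOdd : Seq → Seq
  byOdd u j = + (2 ℕ.* j ℕ.+ 1) * u j

  odd-suc-ℤ : ∀ i → + (2 ℕ.* suc i ℕ.+ 1) ≡ + 2 + + (2 ℕ.* i ℕ.+ 1)
  odd-suc-ℤ i = cong +_ (lemma i)
    where
    lemma : ∀ i → 2 ℕ.* (1 ℕ.+ i) ℕ.+ 1 ≡ 2 ℕ.+ (2 ℕ.* i ℕ.+ 1)
    lemma = ℕ-solve-∀

  Δ-byOdd : ∀ u → Δ (byOdd u) ≗ byOdd (Δ u) ⊕ scale (+ 2) (shift u)
  Δ-byOdd u zero    = lemma (u 0)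
    where
    lemma : ∀ x → 1ℤ * x - 0ℤ ≡ 1ℤ * (x - 0ℤ) + + 2 * 0ℤ
    lemma = solve-∀
  Δ-byOdd u (suc i) = subst (λ c → c * u (suc i) - + (2 ℕ.* i ℕ.+ 1) * u i ≡ c * (u (suc i) - u i) + + 2 * u i)
      (sym (odd-suc-ℤ i)) (lemma (+ (2 ℕ.* i ℕ.+ 1)) (u (suc i)) (u i))
    where
    lemma : ∀ k x y → (+ 2 + k) * x - k * y ≡ (+ 2 + k) * (x - y) + + 2 * y
    lemma = solve-∀

  Δ-shift : ∀ a → Δ (shift a) ≗ shift (Δ a)
  Δ-shift a zero    = refl
  Δ-shift a (suc i) = refl

  -- A discrete Leibniz rule: the factor `2j+1` is linear in `j`, so a single correction term
  -- survives, and each application of `Δ` adds 2 to its coefficient.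
  iterΔ-byOdd : ∀ m u → iter Δ (suc m) (byOdd u) ≗ byOdd (iter Δ (suc m) u) ⊕ scale (+ (2 ℕ.* suc m)) (shift (iter Δ m u))
  iterΔ-byOdd zero    u i = Δ-byOdd u i
  iterΔ-byOdd (suc m) u i = begin
    Δ (iter Δ (suc m) (byOdd u)) i
      ≡⟨ Δ-cong (iterΔ-byOdd m u) i ⟩
    Δ (byOdd w ⊕ scale k (shift v)) i
      ≡⟨ Δ-⊕ (byOdd w) (scale k (shift v)) i ⟩
    Δ (byOdd w) i + Δ (scale k (shift v)) i
      ≡⟨ cong₂ _+_ (Δ-byOdd w i) (trans (Δ-scale k (shift v) i) (cong (_*_ k) (Δ-shift v i))) ⟩
    byOdd (Δ w) i + + 2 * shift w i + k * shift w i
      ≡⟨ lemma (byOdd (Δ w) i) (shift w i) k ⟩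
    byOdd (Δ w) i + (+ 2 + k) * shift w i
      ≡⟨ cong (λ c → byOdd (Δ w) i + + c * shift w i) (coef m) ⟩
    byOdd (Δ w) i + + (2 ℕ.* suc (suc m)) * shift w i ∎
    where
    open ≡-Reasoning
    v = iter Δ m u
    w = iter Δ (suc m) u
    k = + (2 ℕ.* suc m)
    lemma : ∀ a b k → a + + 2 * b + k * b ≡ a + (+ 2 + k) * b
    lemma = solve-∀
    coef : ∀ m → 2 ℕ.+ 2 ℕ.* (1 ℕ.+ m) ≡ 2 ℕ.* (2 ℕ.+ m)
    coef = ℕ-solve-∀

  odd^-eulerian : ∀ n k → iter Δ (suc n) (odd^ n) k ≡ + B n k
  odd^-eulerian zero    zero    = refl
  odd^-eulerian zero    (suc k) = refl
  odd^-eulerian (suc n) k = begin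
    iter Δ (2 ℕ.+ n) (byOdd (odd^ n)) k
      ≡⟨ iterΔ-byOdd (suc n) (odd^ n) k ⟩
    + (2 ℕ.* k ℕ.+ 1) * Δ w k + + (2 ℕ.* (2 ℕ.+ n)) * shift w k
      ≡⟨ cong₂ (λ a b → + (2 ℕ.* k ℕ.+ 1) * a + + (2 ℕ.* (2 ℕ.+ n)) * b) (Δ-cong (odd^-eulerian n) k) (shift-cong (odd^-eulerian n) k) ⟩
    + (2 ℕ.* k ℕ.+ 1) * Δ b k + + (2 ℕ.* (2 ℕ.+ n)) * shift b k
      ≡⟨ recurrence k ⟩
    + B (suc n) k ∎
    where
    open ≡-Reasoning
    w = iter Δ (suc n) (odd^ n)
    b : Seq
    b k = + B n k
    recurrence : ∀ k → + (2 ℕ.* k ℕ.+ 1) * Δ b k + + (2 ℕ.* (2 ℕ.+ n)) * shift b k ≡ + B (suc n) k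
    recurrence zero = lemma (+ (2 ℕ.* (2 ℕ.+ n))) (+ B n 0)
      where
      lemma : ∀ a x → 1ℤ * (x - 0ℤ) + a * 0ℤ ≡ x
      lemma = solve-∀
    recurrence (suc k) with k ℕₚ.≤? n
    -- For `k > n` the truncated subtraction in `B` is harmless, since both Eulerian numbers vanish.
    ... | no k≰n rewrite B-above n k (ℕₚ.≰⇒> k≰n) | B-above n (suc k) (ℕₚ.m≤n⇒m≤1+n (ℕₚ.≰⇒> k≰n))
                       | ℕₚ.*-zeroʳ (2 ℕ.* suc k ℕ.+ 1) | ℕₚ.*-zeroʳ (2 ℕ.* (n ∸ k) ℕ.+ 1)
                       | ℤₚ.*-zeroʳ (+ (2 ℕ.* (2 ℕ.+ n))) = refl
    ... | yes k≤n = begin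
      + (2 ℕ.* suc k ℕ.+ 1) * (+ x - + z) + + (2 ℕ.* (2 ℕ.+ n)) * + z
        ≡⟨ cong (λ c → + (2 ℕ.* suc k ℕ.+ 1) * (+ x - + z) + + c * + z) coef ⟩
      + c₁ * (+ x - + z) + (+ c₁ + + c₂) * + z
        ≡⟨ lemma (+ c₁) (+ c₂) (+ x) (+ z) ⟩
      + c₁ * + x + + c₂ * + z
        ≡⟨ cong₂ _+_ (sym (ℤₚ.pos-* c₁ x)) (sym (ℤₚ.pos-* c₂ z)) ⟩
      + (c₁ ℕ.* x ℕ.+ c₂ ℕ.* z) ∎
      where
      x = B n (suc k)
      z = B n k
      c₁ = 2 ℕ.* suc k ℕ.+ 1
      c₂ = 2 ℕ.* (n ∸ k) ℕ.+ 1
      lemma : ∀ c d x z → c * (x - z) + (c + d) * z ≡ c * x + d * z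
      lemma = solve-∀
      coef-id : ∀ k m → 2 ℕ.* (2 ℕ.+ (k ℕ.+ m)) ≡ 2 ℕ.* (1 ℕ.+ k) ℕ.+ 1 ℕ.+ (2 ℕ.* m ℕ.+ 1)
      coef-id = ℕ-solve-∀
      coef : 2 ℕ.* (2 ℕ.+ n) ≡ c₁ ℕ.+ c₂
      coef = trans (cong (λ m → 2 ℕ.* (2 ℕ.+ m)) (sym (ℕₚ.m+[n∸m]≡n k≤n))) (coef-id k (n ∸ k))

  pVec-[] : ∀ n i → pVec n [] i ≡ + B n i
  pVec-[] n i = trans (iter-cong Δ-cong (suc n) (λ j → sumVec-1 n (2 ℕ.* j ℕ.+ 1)) i) (odd^-eulerian n i)

  iterΔ-minus : ∀ m (a b : Seq) i → iter Δ m (λ j → a j - b j) i ≡ iter Δ m a i - iter Δ m b i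
  iterΔ-minus m a b i = begin
    iter Δ m (λ j → a j - b j) i ≡⟨ iter-cong Δ-cong m (λ j → lemma (a j) (b j)) i ⟩
    iter Δ m (a ⊕ scale -1ℤ b) i ≡⟨ iterΔ-⊕ m a (scale -1ℤ b) i ⟩
    iter Δ m a i + iter Δ m (scale -1ℤ b) i ≡⟨ cong (_+_ (iter Δ m a i)) (iterΔ-scale m -1ℤ b i) ⟩
    iter Δ m a i + -1ℤ * iter Δ m b i ≡⟨ sym (lemma (iter Δ m a i) (iter Δ m b i)) ⟩
    iter Δ m a i - iter Δ m b i ∎
    where
    open ≡-Reasoning
    lemma : ∀ x y → x - y ≡ x + (ℤ.- 1ℤ) * y
    lemma = solve-∀

  pVec-loop : ∀ n e E → proj₁ e ≡ proj₂ e → ∀ i → pVec n (e ∷ E) i ≡ 0ℤ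
  pVec-loop n e E p i = trans (iter-cong Δ-cong (suc n) (λ j → properCount-loop n e E (2 ℕ.* j ℕ.+ 1) p) i) (iterΔ-0 (suc n) i)

  module _ {n} (e : Edge (suc n)) t (r : Fin (suc n)) (t≢r : t ≢ suc r) (e≡ : e ≡ (t , suc r) ⊎ e ≡ (suc r , t)) (E : List (Edge (suc n))) where

    odd-link : ∀ j → oddSample (properCount (suc n) (e ∷ E)) j ≡ oddSample (properCount (suc n) E) j - oddSample (properCount n (contract t r t≢r E)) j
    odd-link j rewrite odd≡ j = properCount-link n e t r t≢r e≡ E (2 ℕ.* j)

    pVec-link : ∀ i → pVec (suc n) (e ∷ E) i ≡ pVec (suc n) E i - Δ (pVec n (contract t r t≢r E)) i
    pVec-link i = trans (iter-cong Δ-cong (2 ℕ.+ n) odd-link i) (iterΔ-minus (2 ℕ.+ n) _ _ i)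

  -- Only `n` factors `1 - t` are used: for loopless `E` the two leading terms cancel, and the
  -- difference has degree below `n`.
  hVec : ∀ n → List (Edge n) → Seq
  hVec n E = iter Δ n (λ j → odd^ n j - oddSample (properCount n E) j)

  hVec-[] : ∀ n i → hVec n [] i ≡ 0ℤ
  hVec-[] n i = trans (iter-cong Δ-cong n (λ j → trans (cong (_-_ (odd^ n j)) (sumVec-1 n (2 ℕ.* j ℕ.+ 1))) (ℤₚ.+-inverseʳ (odd^ n j))) i) (iterΔ-0 n i)

  -- One more factor `1 - t` gives each of the two series its own numerator. Since `pVec` is
  -- nonnegative, consecutive differences of `hVec` are bounded by Eulerian numbers.
  hVec-Δ : ∀ n E i → Δ (hVec n E) i ≡ + B n i - pVec n E i
  hVec-Δ n E i = trans (iterΔ-minus (suc n) (odd^ n) (oddSample (properCount n E)) i) (cong (_- pVec n E i) (odd^-eulerian n i))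

  hVec-link : ∀ {n} e t (r : Fin (suc n)) t≢r (e≡ : e ≡ (t , suc r) ⊎ e ≡ (suc r , t)) E i →
              hVec (suc n) (e ∷ E) i ≡ hVec (suc n) E i + pVec n (contract t r t≢r E) i
  hVec-link {n} e t r t≢r e≡ E i = trans
    (iter-cong Δ-cong (suc n) (λ j → trans (cong (_-_ (odd^ (suc n) j)) (odd-link e t r t≢r e≡ E j))
      (lemma (odd^ (suc n) j) (oddSample (properCount (suc n) E) j) (oddSample (properCount n (contract t r t≢r E)) j))) i)
    (iterΔ-⊕ (suc n) (λ j → odd^ (suc n) j - oddSample (properCount (suc n) E) j) (oddSample (properCount n (contract t r t≢r E))) i)
    where
    lemma : ∀ a b c → a - (b - c) ≡ a - b + c
    lemma = solve-∀

  NonLoop : ∀ {n} → Edge n → Set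
  NonLoop e = proj₁ e ≢ proj₂ e

  Different : ∀ {n} → Edge n → Edge n → Set
  Different e f = f ≢ e × f ≢ swap e

  Simple : ∀ {n} → List (Edge n) → Set
  Simple E = All NonLoop E × AllPairs Different E

  -- A contraction identifies only the two ends of `e`, so it creates loops only from edges parallel
  -- to `e`.
  contract-nonLoop : ∀ {n} e t (r : Fin (suc n)) t≢r (e≡ : e ≡ (t , suc r) ⊎ e ≡ (suc r , t)) E →
                     All NonLoop E → All (Different e) E → All NonLoop (contract t r t≢r E)
  contract-nonLoop e t r t≢r e≡ E nl df = Allₚ.map⁺ (All.zipWith (λ { {u , v} (n , d) → step u v e≡ n d }) (nl , df))
    where
    step : ∀ u v → e ≡ (t , suc r) ⊎ e ≡ (suc r , t) → u ≢ v → Different e (u , v) → merge t r t≢r u ≢ merge t r t≢r v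
    step u v e≡ u≢v (d₁ , d₂) p with merge-fiber t r t≢r u v p | e≡
    ... | inj₁ u≡v                  | _         = u≢v u≡v
    ... | inj₂ (inj₁ (refl , refl)) | inj₁ refl = d₁ refl
    ... | inj₂ (inj₁ (refl , refl)) | inj₂ refl = d₂ refl
    ... | inj₂ (inj₂ (refl , refl)) | inj₁ refl = d₂ refl
    ... | inj₂ (inj₂ (refl , refl)) | inj₂ refl = d₁ refl

  -- Adding an edge subtracts `Δ` of the numerator of the contraction, which is nonnegative up to
  -- the middle by `pVec-mirror`; a loop makes the numerator zero.
  pVec-upper : ∀ n E i → 2 ℕ.* i ℕ.≤ n → pVec n E i ≤ + B n i
  pVec-upper n       []      i 2i≤n = ℤₚ.≤-reflexive (pVec-[] n i)
  pVec-upper zero    ((zero , zero) ∷ E) i 2i≤n = subst (_≤ + B zero i) (sym (pVec-loop 0 (zero , zero) E refl i)) (+≤+ z≤n)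
  pVec-upper (suc n) (e ∷ E) i 2i≤n with kind e
  ... | loop p = subst (_≤ + B (suc n) i) (sym (pVec-loop (suc n) e E p i)) (+≤+ z≤n)
  ... | link t r t≢r e≡ = ℤₚ.≤-trans
    (subst (_≤ pVec (suc n) E i) (sym (pVec-link e t r t≢r e≡ E i)) (ℤₚ.i≤j⇒i-k≤j _ {{ℤ.nonNegative (Δ-nonneg i 2i≤n)}} ℤₚ.≤-refl))
    (pVec-upper (suc n) E i 2i≤n)
    where
    q = pVec n (contract t r t≢r E)
    Δ-nonneg : ∀ i → 2 ℕ.* i ℕ.≤ suc n → 0ℤ ≤ Δ q i
    Δ-nonneg zero    _    = subst (0ℤ ≤_) (sym (ℤₚ.+-identityʳ (q 0))) (pVec-nonneg n (contract t r t≢r E) 0)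
    Δ-nonneg (suc i) 2i≤n = ℤₚ.i≤j⇒0≤j-i (pVec-mirror n (contract t r t≢r E) i (suc i) (ℕₚ.n≤1+n i)
      (ℕ.s≤s⁻¹ (subst (ℕ._≤ suc n) (cong suc (cong (λ k → i ℕ.+ suc k) (ℕₚ.+-identityʳ i))) 2i≤n)))

  -- A union bound: each edge lowers the numerator by at most the corresponding coefficient of the
  -- contraction, which `pVec-upper` bounds by `B n i`.
  pVec-lower : ∀ n E i → All NonLoop E → 2 ℕ.* i ℕ.≤ n → + B (suc n) i ≤ pVec (suc n) E i + + (length E ℕ.* B n i)
  pVec-lower n []      i _          2i≤n = ℤₚ.≤-reflexive (sym (trans (ℤₚ.+-identityʳ _) (pVec-[] (suc n) i)))
  pVec-lower n (e ∷ E) i (nl ∷ nls) 2i≤n with kind e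
  ... | loop p = ⊥-elim (nl p)
  ... | link t r t≢r e≡ = ℤₚ.≤-trans (pVec-lower n E i nls 2i≤n) (begin
    p + + (length E ℕ.* B n i) ≤⟨ ℤₚ.+-monoˡ-≤ (+ (length E ℕ.* B n i)) (ℤₚ.i≤j⇒i≤k+j (shift q i) {{ℤ.nonNegative (shift-nonneg i)}} ℤₚ.≤-refl) ⟩
    shift q i + p + + (length E ℕ.* B n i) ≡⟨ lemma₁ (shift q i) p (q i) (+ (length E ℕ.* B n i)) ⟩
    (p - (q i - shift q i)) + (q i + + (length E ℕ.* B n i)) ≤⟨ ℤₚ.+-monoʳ-≤ (p - Δ q i) (ℤₚ.+-monoˡ-≤ (+ (length E ℕ.* B n i)) (pVec-upper n (contract t r t≢r E) i 2i≤n)) ⟩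
    (p - Δ q i) + (+ B n i + + (length E ℕ.* B n i)) ≡⟨ cong (_+ + (B n i ℕ.+ length E ℕ.* B n i)) (sym (pVec-link e t r t≢r e≡ E i)) ⟩
    pVec (suc n) (e ∷ E) i + + (B n i ℕ.+ length E ℕ.* B n i) ∎)
    where
    open ℤₚ.≤-Reasoning
    p = pVec (suc n) E i
    q = pVec n (contract t r t≢r E)
    shift-nonneg : ∀ i → 0ℤ ≤ shift q i
    shift-nonneg zero    = +≤+ z≤n
    shift-nonneg (suc i) = pVec-nonneg n (contract t r t≢r E) i
    lemma₁ : ∀ s p q l → s + p + l ≡ (p - (q - s)) + (q + l)
    lemma₁ = solve-∀

  -- hVec is a sum of pVec's of contractions, one for each edge.
  hVec-ind : ∀ n (P : Seq → Set) → (∀ {a b} → a ≗ b → P a → P b) → P (λ _ → 0ℤ) →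
             (∀ {a} E → P a → P (a ⊕ pVec n E)) → ∀ E → All NonLoop E → P (hVec (suc n) E)
  hVec-ind n P P-resp P-0 P-add []      _          = P-resp (λ i → sym (hVec-[] (suc n) i)) P-0
  hVec-ind n P P-resp P-0 P-add (e ∷ E) (nl ∷ nls) with kind e
  ... | loop p = ⊥-elim (nl p)
  ... | link t r t≢r e≡ = P-resp (λ i → sym (hVec-link e t r t≢r e≡ E i))
      (P-add (contract t r t≢r E) (hVec-ind n P P-resp P-0 P-add E nls))

  hVec-nonneg : ∀ n E → All NonLoop E → ∀ i → 0ℤ ≤ hVec (suc n) E i
  hVec-nonneg n = hVec-ind n (λ a → ∀ i → 0ℤ ≤ a i) (λ e p i → subst (0ℤ ≤_) (e i) (p i)) (λ _ → +≤+ z≤n)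
    (λ E p i → ℤₚ.+-mono-≤ (p i) (pVec-nonneg n E i))

  hVec-mirror : ∀ n E → All NonLoop E → ∀ i k → i ℕ.≤ k → i ℕ.+ k ℕ.≤ n → hVec (suc n) E i ≤ hVec (suc n) E k
  hVec-mirror n = hVec-ind n (λ a → ∀ i k → i ℕ.≤ k → i ℕ.+ k ℕ.≤ n → a i ≤ a k)
    (λ e p i k i≤k l → subst₂ _≤_ (e i) (e k) (p i k i≤k l)) (λ _ _ _ _ → ℤₚ.≤-refl)
    (λ E p i k i≤k l → ℤₚ.+-mono-≤ (p i k i≤k l) (pVec-mirror n E i k i≤k l))

  hVec-lym : ∀ i k E → let n = 2 ℕ.+ (2 ℕ.* i ℕ.+ k) in All NonLoop E →
             + (2 ℕ.+ (i ℕ.+ k)) * hVec (suc n) E i ≤ + suc i * hVec (suc n) E (suc i)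
  hVec-lym i k = hVec-ind n (λ a → + (2 ℕ.+ (i ℕ.+ k)) * a i ≤ + suc i * a (suc i))
    (λ e p → subst₂ _≤_ (cong (_*_ (+ (2 ℕ.+ (i ℕ.+ k)))) (e i)) (cong (_*_ (+ suc i)) (e (suc i))) p)
    (ℤₚ.≤-reflexive (trans (ℤₚ.*-zeroʳ (+ (2 ℕ.+ (i ℕ.+ k)))) (sym (ℤₚ.*-zeroʳ (+ suc i)))))
    (λ {a} E p → subst₂ _≤_ (sym (ℤₚ.*-distribˡ-+ (+ (2 ℕ.+ (i ℕ.+ k))) (a i) (pVec n E i))) (sym (ℤₚ.*-distribˡ-+ (+ suc i) (a (suc i)) (pVec n E (suc i))))
      (ℤₚ.+-mono-≤ p (pVec-lym n E i k refl)))
    where n = 2 ℕ.+ (2 ℕ.* i ℕ.+ k)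

  hVec-upper : ∀ n E → All NonLoop E → ∀ i → 2 ℕ.* i ℕ.≤ n → hVec (suc n) E i ≤ + (length E ℕ.* B n i)
  hVec-upper n []      _          i l = ℤₚ.≤-reflexive (hVec-[] (suc n) i)
  hVec-upper n (e ∷ E) (nl ∷ nls) i l with kind e
  ... | loop p = ⊥-elim (nl p)
  ... | link t r t≢r e≡ = subst₂ _≤_ (sym (hVec-link e t r t≢r e≡ E i)) (ℤₚ.+-comm (+ (length E ℕ.* B n i)) (+ B n i))
      (ℤₚ.+-mono-≤ (hVec-upper n E nls i l) (pVec-upper n (contract t r t≢r E) i l))

  -- The index `i+1` may lie just past the range of `pVec-upper`. Instead `hVec-Δ` expresses the
  -- coefficient as the Eulerian number plus `h_i - h_(i+1)`, and only `h_i` is kept.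
  pVec-upper-next : ∀ n E → All NonLoop E → ∀ i → 2 ℕ.* i ℕ.≤ n →
                    pVec (suc n) E (suc i) ≤ + (B (suc n) (suc i) ℕ.+ length E ℕ.* B n i)
  pVec-upper-next n E nl i l = begin
    p ≡⟨ lemma p b h₀ h₁ (hVec-Δ (suc n) E (suc i)) ⟩
    b + h₀ - h₁ ≤⟨ ℤₚ.i≤j⇒i-k≤j h₁ {{ℤ.nonNegative (hVec-nonneg n E nl (suc i))}} ℤₚ.≤-refl ⟩
    b + h₀ ≤⟨ ℤₚ.+-monoʳ-≤ b (hVec-upper n E nl i l) ⟩
    b + + (length E ℕ.* B n i) ∎
    where
    open ℤₚ.≤-Reasoning
    p = pVec (suc n) E (suc i)
    b = + B (suc n) (suc i)
    h₀ = hVec (suc n) E i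
    h₁ = hVec (suc n) E (suc i)
    expand : ∀ p b → p ≡ b - (b - p)
    expand = solve-∀
    collect : ∀ b h₀ h₁ → b - (h₁ - h₀) ≡ b + h₀ - h₁
    collect = solve-∀
    lemma : ∀ p b h₀ h₁ → h₁ - h₀ ≡ b - p → p ≡ b + h₀ - h₁
    lemma p b h₀ h₁ e = trans (expand p b) (trans (cong (_-_ b) (sym e)) (collect b h₀ h₁))

  -- The binomial coefficient `C(m, 2)`, which counts pairs of edges.
  triangle : ℕ → ℕ
  triangle zero    = 0
  triangle (suc m) = m ℕ.+ triangle m

  module _ (n : ℕ) (i : ℕ) (2i≤n : 2 ℕ.* i ℕ.≤ n) where

    -- A Bonferroni inequality of second order: the contraction at an edge loses at most `B n i` for
    -- every edge after it, which adds up to one loss per pair. Simplicity keeps the contractions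
    -- loopless, as `pVec-lower` requires.
    hVec-lower : ∀ E → Simple E →
      + (length E ℕ.* B (suc n) i) ≤ hVec (2 ℕ.+ n) E i + + (triangle (length E) ℕ.* B n i)
    hVec-lower []      _ = ℤₚ.≤-reflexive (sym (trans (ℤₚ.+-identityʳ _) (hVec-[] (2 ℕ.+ n) i)))
    hVec-lower (e ∷ E) (nl ∷ nls , df ∷ dfs) with kind e
    ... | loop p = ⊥-elim (nl p)
    ... | link t r t≢r e≡ = begin
      + (B (suc n) i ℕ.+ length E ℕ.* B (suc n) i)
        ≤⟨ ℤₚ.+-mono-≤ (pVec-lower n E′ i (contract-nonLoop e t r t≢r e≡ E nls df) 2i≤n) (hVec-lower E (nls , dfs)) ⟩
      pVec (suc n) E′ i + + (length E′ ℕ.* B n i) + (hVec (2 ℕ.+ n) E i + + (triangle (length E) ℕ.* B n i))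
        ≡⟨ cong (λ l → pVec (suc n) E′ i + + (l ℕ.* B n i) + (hVec (2 ℕ.+ n) E i + + (triangle (length E) ℕ.* B n i))) (Listₚ.length-map _ E) ⟩
      pVec (suc n) E′ i + + (length E ℕ.* B n i) + (hVec (2 ℕ.+ n) E i + + (triangle (length E) ℕ.* B n i))
        ≡⟨ lemma (pVec (suc n) E′ i) (+ (length E ℕ.* B n i)) (hVec (2 ℕ.+ n) E i) (+ (triangle (length E) ℕ.* B n i)) ⟩
      hVec (2 ℕ.+ n) E i + pVec (suc n) E′ i + (+ (length E ℕ.* B n i) + + (triangle (length E) ℕ.* B n i))
        ≡⟨ cong₂ _+_ (sym (hVec-link e t r t≢r e≡ E i)) (cong +_ (sym (ℕₚ.*-distribʳ-+ (B n i) (length E) (triangle (length E))))) ⟩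
      hVec (2 ℕ.+ n) (e ∷ E) i + + (triangle (suc (length E)) ℕ.* B n i) ∎
      where
      open ℤₚ.≤-Reasoning
      E′ = contract t r t≢r E
      lemma : ∀ a b c d → a + b + (c + d) ≡ c + a + (b + d)
      lemma = solve-∀

    -- With at most `2i+1` edges the correction in `pVec-upper-next` is at most `(2i+1) B n i`,
    -- which `B-grow` absorbs into `B (n+1) i`.
    hVec-upper-next : ∀ E → Simple E → length E ℕ.≤ 2 ℕ.* i ℕ.+ 1 →
      hVec (2 ℕ.+ n) E (suc i) ≤ + (length E ℕ.* (B (suc n) (suc i) ℕ.+ B (suc n) i))
    hVec-upper-next []      _ _ = ℤₚ.≤-reflexive (hVec-[] (2 ℕ.+ n) (suc i))
    hVec-upper-next (e ∷ E) (nl ∷ nls , df ∷ dfs) l with kind e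
    ... | loop p = ⊥-elim (nl p)
    ... | link t r t≢r e≡ = subst₂ _≤_ (sym (hVec-link e t r t≢r e≡ E (suc i))) (ℤₚ.+-comm (+ (length E ℕ.* b)) (+ b))
      (ℤₚ.+-mono-≤ (hVec-upper-next E (nls , dfs) (ℕₚ.≤-trans (ℕₚ.n≤1+n _) l))
        (ℤₚ.≤-trans (pVec-upper-next n E′ (contract-nonLoop e t r t≢r e≡ E nls df) i 2i≤n)
          (+≤+ (ℕₚ.+-monoʳ-≤ (B (suc n) (suc i)) few))))
      where
      E′ = contract t r t≢r E
      b = B (suc n) (suc i) ℕ.+ B (suc n) i
      few : length E′ ℕ.* B n i ℕ.≤ B (suc n) i
      few = ℕₚ.≤-trans (ℕₚ.*-monoˡ-≤ (B n i) (ℕₚ.≤-trans (ℕₚ.≤-reflexive (Listₚ.length-map _ E)) (ℕₚ.≤-trans (ℕₚ.n≤1+n _) l))) (B-grow n i)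

-- Matroid rank, Whitney's expansion and the count of proper colorings.

module Rank where

  open import Defs
  open Sequences
  open ColoringSums
  open GraphColorings
  open import Data.Nat as ℕ using (ℕ; zero; suc; z≤n; s≤s; _∸_)
  import Data.Nat.Properties as ℕₚ
  open import Data.Integer as ℤ using (ℤ; +_; 0ℤ; 1ℤ; +≤+)
  import Data.Integer.Properties as ℤₚ
  open import Data.Integer.Tactic.RingSolver using (solve-∀)
  open import Data.Rational as ℚ using (ℚ; 0ℚ; 1ℚ)
  import Data.Rational.Properties as ℚₚ
  open import Data.Rational.Solver using (module +-*-Solver)
  open import Data.Empty using (⊥-elim)
  open import Data.Product using (∃; _×_; _,_; proj₁; proj₂)
  open import Data.Sum using (_⊎_; inj₁; inj₂)
  open import Data.Fin as Fin using (Fin; zero; suc; punchIn)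
  import Data.Fin.Properties as Finₚ
  open import Data.Vec using (Vec; []; _∷_; insertAt)
  open import Data.List using (List; []; _∷_; _++_; map; length; lookup)
  import Data.List.Properties as Listₚ
  open import Data.List.Relation.Binary.Sublist.Propositional using (_⊆_; []; _∷_; _∷ʳ_; ⊆-trans; ⊆-refl)
  open import Function using (_∘_; id)
  open import Relation.Nullary using (yes; no)
  open import Relation.Binary.PropositionalEquality using (_≡_; _≢_; refl; sym; trans; cong; cong₂; subst; subst₂; module ≡-Reasoning)

  mutual
    -- The dimension of the intersection of the hyperplanes, or the number of components that avoid
    -- the ground. The view of the first edge is an argument of `nullity-∷` so that inductions can
    -- match on it.
    nullity : ∀ n → List (Edge n) → ℕ
    nullity n []      = n
    nullity n (e ∷ E) = nullity-∷ n (kind e) E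

    nullity-∷ : ∀ n {e : Edge n} → Kind e → List (Edge n) → ℕ
    nullity-∷ n       (loop _)         E = nullity n E
    nullity-∷ (suc n) (link t r t≢r _) E = nullity n (contract t r t≢r E)

  agree : ∀ {n} → List (Edge n) → Vec ℕ n → ℤ
  agree []      c = 1ℤ
  agree (e ∷ E) c = equal e c ℤ.* agree E c

  agree-merge : ∀ {n} t (r : Fin (suc n)) t≢r E c → agree E (insertAt c r (color c (merge t r t≢r t))) ≡ agree (contract t r t≢r E) c
  agree-merge t r t≢r []            c = refl
  agree-merge t r t≢r ((u , v) ∷ E) c = cong₂ ℤ._*_
    (cong₂ (λ a b → ind (a ℕₚ.≟ b)) (color-merge t r t≢r c u) (color-merge t r t≢r c v)) (agree-merge t r t≢r E c)

  mutual
    agree-count : ∀ n E x → sumVec n (suc x) (agree E) ≡ (+ suc x) ℤ.^ nullity n E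
    agree-count n []      x = sumVec-1 n (suc x)
    agree-count n (e ∷ E) x = agree-count-∷ n (kind e) E x

    agree-count-∷ : ∀ n {e : Edge n} (k : Kind e) E x → sumVec n (suc x) (agree (e ∷ E)) ≡ (+ suc x) ℤ.^ nullity-∷ n k E
    agree-count-∷ n {e} (loop p) E x = trans
      (sumVec-cong n (suc x) (λ c _ → trans (cong (ℤ._* agree E c) (equal-loop e c p)) (ℤₚ.*-identityˡ _)))
      (agree-count n E x)
    agree-count-∷ (suc n) (link t r t≢r e≡) E x = trans
      (sumVec-cong (suc n) (suc x) (λ c _ → cong (ℤ._* agree E c) (equal-link e≡ c)))
      (trans (sumVec-equal t r t≢r x (agree E))
      (trans (sumVec-cong n (suc x) (λ c _ → agree-merge t r t≢r E c)) (agree-count n (contract t r t≢r E) x)))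

  sum<-mono : ∀ x {φ ψ : Seq} → (∀ y → φ y ℤ.≤ ψ y) → sum< x φ ℤ.≤ sum< x ψ
  sum<-mono zero    p = ℤₚ.≤-refl
  sum<-mono (suc x) p = ℤₚ.+-mono-≤ (p 0) (sum<-mono x (p ∘ suc))

  sumVec-mono : ∀ n x {φ ψ : Vec ℕ n → ℤ} → (∀ c → φ c ℤ.≤ ψ c) → sumVec n x φ ℤ.≤ sumVec n x ψ
  sumVec-mono zero    x p = p []
  sumVec-mono (suc n) x p = sum<-mono x (λ y → sumVec-mono n x (λ c → p (y ∷ c)))

  ind-*-mono : ∀ {P : Set} (p? : Relation.Nullary.Dec P) {a b} → 0ℤ ℤ.≤ b → a ℤ.≤ b → ind p? ℤ.* a ℤ.≤ b
  ind-*-mono (yes _) {a} 0≤b a≤b = subst (ℤ._≤ _) (sym (ℤₚ.*-identityˡ a)) a≤b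
  ind-*-mono (no _)      0≤b a≤b = 0≤b

  agree-nonneg : ∀ {n} (E : List (Edge n)) c → 0ℤ ℤ.≤ agree E c
  agree-nonneg []            c = +≤+ z≤n
  agree-nonneg ((u , v) ∷ E) c with color c u ℕₚ.≟ color c v
  ... | yes _ = subst (0ℤ ℤ.≤_) (sym (ℤₚ.*-identityˡ (agree E c))) (agree-nonneg E c)
  ... | no _  = ℤₚ.≤-refl

  agree-⊆ : ∀ {Y : Set} {n} (f : Y → Edge n) {T S} → T ⊆ S → ∀ c → agree (map f S) c ℤ.≤ agree (map f T) c
  agree-⊆ f []          c = ℤₚ.≤-refl
  agree-⊆ f (_∷ʳ_ {xs = T} h p) c = ind-*-mono (color c (proj₁ (f h)) ℕₚ.≟ color c (proj₂ (f h))) (agree-nonneg (map f T) c) (agree-⊆ f p c)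
  agree-⊆ f {h ∷ T} (refl ∷ p) c with color c (proj₁ (f h)) ℕₚ.≟ color c (proj₂ (f h))
  ... | yes _ = subst₂ ℤ._≤_ (sym (ℤₚ.*-identityˡ _)) (sym (ℤₚ.*-identityˡ _)) (agree-⊆ f p c)
  ... | no _  = ℤₚ.≤-refl

  pos-^ : ∀ x k → (+ x) ℤ.^ k ≡ + (x ℕ.^ k)
  pos-^ x zero    = refl
  pos-^ x (suc k) = trans (cong (ℤ._*_ (+ x)) (pos-^ x k)) (sym (ℤₚ.pos-* x (x ℕ.^ k)))

  -- With two colors, the colorings constant on all edges number `2^nullity`, and additional edges
  -- leave fewer of them.
  nullity-⊆ : ∀ {Y : Set} {n} (f : Y → Edge n) {T S} → T ⊆ S → nullity n (map f S) ℕ.≤ nullity n (map f T)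
  nullity-⊆ {n = n} f {T} {S} p with nullity n (map f S) ℕₚ.≤? nullity n (map f T)
  ... | yes q = q
  ... | no ¬q = ⊥-elim (ℕₚ.<⇒≱ (ℕₚ.^-monoʳ-< 2 (s≤s (s≤s z≤n)) (ℕₚ.≰⇒> ¬q))
    (ℤ.drop‿+≤+ (subst₂ ℤ._≤_ (trans (agree-count n (map f S) 1) (pos-^ 2 (nullity n (map f S)))) (trans (agree-count n (map f T) 1) (pos-^ 2 (nullity n (map f T))))
      (sumVec-mono n 2 (agree-⊆ f p)))))

  -- A linear relation among the normals is tested on all potentials ψ on the vertices;
  -- contracting an edge (t, suc r) restricts to the potentials with ψ t = ψ (suc r).
  module _ {Y : Set} where

    pairing : ∀ {n} → (Y → Edge n) → (T : List Y) → (Fin (length T) → ℚ) → (Fin (suc n) → ℚ) → ℚ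
    pairing f []      c ψ = 0ℚ
    pairing f (h ∷ T) c ψ = c zero ℚ.* (ψ (proj₁ (f h)) ℚ.- ψ (proj₂ (f h))) ℚ.+ pairing f T (c ∘ suc) ψ

    DualIndependent : ∀ {n} → (Y → Edge n) → List Y → Set
    DualIndependent f T = ∀ c → (∀ ψ → pairing f T c ψ ≡ 0ℚ) → ∀ k → c k ≡ 0ℚ

    pairing-cong : ∀ {n} (f : Y → Edge n) T c {ψ ψ′} → (∀ u → ψ u ≡ ψ′ u) → pairing f T c ψ ≡ pairing f T c ψ′
    pairing-cong f []      c p = refl
    pairing-cong f (h ∷ T) c p = cong₂ ℚ._+_ (cong (ℚ._*_ (c zero)) (cong₂ ℚ._-_ (p _) (p _))) (pairing-cong f T (c ∘ suc) p)

    pairing-0 : ∀ {n} (f : Y → Edge n) T c ψ → (∀ k → c k ≡ 0ℚ) → pairing f T c ψ ≡ 0ℚ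
    pairing-0 f []      c ψ p = refl
    pairing-0 f (h ∷ T) c ψ p rewrite p zero | pairing-0 f T (c ∘ suc) ψ (p ∘ suc) =
      trans (ℚₚ.+-identityʳ (0ℚ ℚ.* (ψ (proj₁ (f h)) ℚ.- ψ (proj₂ (f h))))) (ℚₚ.*-zeroˡ (ψ (proj₁ (f h)) ℚ.- ψ (proj₂ (f h))))

    pairing-linear : ∀ {n} (f : Y → Edge n) T c (ψ ψ′ : Fin (suc n) → ℚ) k →
      pairing f T c (λ u → ψ u ℚ.+ k ℚ.* ψ′ u) ≡ pairing f T c ψ ℚ.+ k ℚ.* pairing f T c ψ′
    pairing-linear f []      c ψ ψ′ k = sym (trans (ℚₚ.+-identityˡ _) (ℚₚ.*-zeroʳ k))
    pairing-linear f (h ∷ T) c ψ ψ′ k rewrite pairing-linear f T (c ∘ suc) ψ ψ′ k =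
      lemma (c zero) (ψ (proj₁ (f h))) (ψ (proj₂ (f h))) (ψ′ (proj₁ (f h))) (ψ′ (proj₂ (f h))) k (pairing f T (c ∘ suc) ψ) (pairing f T (c ∘ suc) ψ′)
      where
      open +-*-Solver
      lemma : ∀ c a b a′ b′ k x y → c ℚ.* ((a ℚ.+ k ℚ.* a′) ℚ.- (b ℚ.+ k ℚ.* b′)) ℚ.+ (x ℚ.+ k ℚ.* y) ≡ (c ℚ.* (a ℚ.- b) ℚ.+ x) ℚ.+ k ℚ.* (c ℚ.* (a′ ℚ.- b′) ℚ.+ y)
      lemma = solve 8 (λ c a b a′ b′ k x y → c :* ((a :+ k :* a′) :- (b :+ k :* b′)) :+ (x :+ k :* y) := (c :* (a :- b) :+ x) :+ k :* (c :* (a′ :- b′) :+ y)) refl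

    pairing-map : ∀ {m n} (f : Y → Edge m) (π : Fin (suc m) → Fin (suc n)) T c ψ →
      pairing (mapEdge π ∘ f) T c ψ ≡ pairing f T c (ψ ∘ π)
    pairing-map f π []      c ψ = refl
    pairing-map f π (h ∷ T) c ψ = cong (ℚ._+_ (c zero ℚ.* (ψ (π (proj₁ (f h))) ℚ.- ψ (π (proj₂ (f h)))))) (pairing-map f π T (c ∘ suc) ψ)

    cons : ∀ {k} → ℚ → (Fin k → ℚ) → Fin (suc k) → ℚ
    cons a c zero    = a
    cons a c (suc k) = c k

    independent⇒nonLoop : ∀ {n} (f : Y → Edge n) h T → DualIndependent f (h ∷ T) → proj₁ (f h) ≢ proj₂ (f h)
    independent⇒nonLoop f h T ind p with ind (cons 1ℚ (λ _ → 0ℚ)) vanish zero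
      where
      vanish : ∀ ψ → pairing f (h ∷ T) (cons 1ℚ (λ _ → 0ℚ)) ψ ≡ 0ℚ
      vanish ψ = trans (cong₂ ℚ._+_ (trans (ℚₚ.*-identityˡ _) (trans (cong (λ u → ψ u ℚ.- ψ (proj₂ (f h))) p) (ℚₚ.+-inverseʳ (ψ (proj₂ (f h)))))) (pairing-0 f T _ ψ (λ _ → refl))) refl
    ... | ()

    module _ {n} (f : Y → Edge (suc n)) (h : Y) (T : List Y) {t r} (t≢r : t ≢ suc r) (e≡ : f h ≡ (t , suc r) ⊎ f h ≡ (suc r , t)) where
      private
        π = merge t r t≢r
        ξ : Fin (2 ℕ.+ n) → ℚ
        ξ w with suc r Fin.≟ w
        ... | yes _ = 1ℚ
        ... | no _  = 0ℚ

        ξ-removed : ξ (suc r) ≡ 1ℚ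
        ξ-removed with suc r Fin.≟ suc r
        ... | yes _ = refl
        ... | no ¬p = ⊥-elim (¬p refl)

        ξ-target : ξ t ≡ 0ℚ
        ξ-target with suc r Fin.≟ t
        ... | yes p = ⊥-elim (t≢r (sym p))
        ... | no _  = refl

        -- Every potential is one pulled back along the contraction plus a multiple of the indicator
        -- `ξ` of the deleted vertex.
        decompose : ∀ (ψ : Fin (2 ℕ.+ n) → ℚ) w → ψ w ≡ ψ (punchIn (suc r) (π w)) ℚ.+ (ψ (suc r) ℚ.- ψ t) ℚ.* ξ w
        decompose ψ w with suc r Fin.≟ w
        ... | yes refl = trans (lemma (ψ (suc r)) (ψ t)) (cong (λ z → ψ z ℚ.+ (ψ (suc r) ℚ.- ψ t) ℚ.* 1ℚ) (sym (Finₚ.punchIn-punchOut (t≢r ∘ sym))))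
          where
          open +-*-Solver
          lemma : ∀ a b → a ≡ b ℚ.+ (a ℚ.- b) ℚ.* 1ℚ
          lemma = solve 2 (λ a b → a := b :+ (a :- b) :* con 1ℚ) refl
        ... | no r≢w = trans (sym (trans (cong (ℚ._+_ (ψ w)) (ℚₚ.*-zeroʳ (ψ (suc r) ℚ.- ψ t))) (ℚₚ.+-identityʳ (ψ w))))
                            (cong (λ z → ψ z ℚ.+ (ψ (suc r) ℚ.- ψ t) ℚ.* 0ℚ) (sym (Finₚ.punchIn-punchOut r≢w)))

        swapSign : f h ≡ (t , suc r) ⊎ f h ≡ (suc r , t) → ∀ L → ∃ λ a → ∀ (ψ : Fin (2 ℕ.+ n) → ℚ) →
                   a ℚ.* (ψ (proj₁ (f h)) ℚ.- ψ (proj₂ (f h))) ℚ.+ (ψ (suc r) ℚ.- ψ t) ℚ.* L ≡ 0ℚ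
        swapSign (inj₁ p) L = L , λ ψ → trans (cong (λ e → L ℚ.* (ψ (proj₁ e) ℚ.- ψ (proj₂ e)) ℚ.+ (ψ (suc r) ℚ.- ψ t) ℚ.* L) p) (lemma L (ψ t) (ψ (suc r)))
          where
          open +-*-Solver
          lemma : ∀ L a b → L ℚ.* (a ℚ.- b) ℚ.+ (b ℚ.- a) ℚ.* L ≡ 0ℚ
          lemma = solve 3 (λ L a b → L :* (a :- b) :+ (b :- a) :* L := con 0ℚ) refl
        swapSign (inj₂ p) L = ℚ.- L , λ ψ → trans (cong (λ e → (ℚ.- L) ℚ.* (ψ (proj₁ e) ℚ.- ψ (proj₂ e)) ℚ.+ (ψ (suc r) ℚ.- ψ t) ℚ.* L) p) (lemma L (ψ t) (ψ (suc r)))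
          where
          open +-*-Solver
          lemma : ∀ L a b → (ℚ.- L) ℚ.* (b ℚ.- a) ℚ.+ (b ℚ.- a) ℚ.* L ≡ 0ℚ
          lemma = solve 3 (λ L a b → (:- L) :* (b :- a) :+ (b :- a) :* L := con 0ℚ) refl

      -- A relation after contraction extends to a relation before it: by `decompose`, only its
      -- value `L` on `ξ` is left, and the coefficient of `h`, which is `L` up to sign, cancels it.
      independent-contract : DualIndependent f (h ∷ T) → DualIndependent (mapEdge π ∘ f) T
      independent-contract ind c rel k = ind (cons a c) vanish (suc k)
        where
        L = pairing f T c ξ
        a = proj₁ (swapSign e≡ L)
        vanish : ∀ ψ → pairing f (h ∷ T) (cons a c) ψ ≡ 0ℚ
        vanish ψ = trans (cong (ℚ._+_ (a ℚ.* (ψ (proj₁ (f h)) ℚ.- ψ (proj₂ (f h))))) expand) (proj₂ (swapSign e≡ L) ψ)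
          where
          expand : pairing f T c ψ ≡ (ψ (suc r) ℚ.- ψ t) ℚ.* L
          expand = trans (pairing-cong f T c (decompose ψ)) (trans (pairing-linear f T c (ψ ∘ punchIn (suc r) ∘ π) ξ (ψ (suc r) ℚ.- ψ t))
            (trans (cong (ℚ._+ ((ψ (suc r) ℚ.- ψ t) ℚ.* L)) (trans (sym (pairing-map f π T c (ψ ∘ punchIn (suc r)))) (rel (ψ ∘ punchIn (suc r)))))
                   (ℚₚ.+-identityˡ _)))

      -- Potentials pulled back from the contraction do not see `h`, so all other coefficients
      -- vanish; then `ξ` isolates the coefficient of `h`.
      independent-extend : DualIndependent (mapEdge π ∘ f) T → DualIndependent f (h ∷ T)
      independent-extend ind c rel = λ { zero → head≡0 ; (suc k) → tail≡0 k }
        where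
        same : ∀ (ψ : Fin (suc n) → ℚ) → f h ≡ (t , suc r) ⊎ f h ≡ (suc r , t) → ψ (π (proj₁ (f h))) ≡ ψ (π (proj₂ (f h)))
        same ψ (inj₁ p) rewrite p = cong ψ (merge-target t r t≢r)
        same ψ (inj₂ p) rewrite p = cong ψ (sym (merge-target t r t≢r))
        tail≡0 : ∀ k → c (suc k) ≡ 0ℚ
        tail≡0 = ind (c ∘ suc) (λ ψ → trans (pairing-map f π T (c ∘ suc) ψ) (trans (sym (ℚₚ.+-identityˡ _))
          (trans (cong (ℚ._+ pairing f T (c ∘ suc) (ψ ∘ π)) (sym (trans (cong (λ z → c zero ℚ.* (z ℚ.- ψ (π (proj₂ (f h))))) (same ψ e≡))
            (trans (cong (ℚ._*_ (c zero)) (ℚₚ.+-inverseʳ (ψ (π (proj₂ (f h)))))) (ℚₚ.*-zeroʳ (c zero)))))) (rel (ψ ∘ π)))))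
        head-ξ : c zero ℚ.* (ξ (proj₁ (f h)) ℚ.- ξ (proj₂ (f h))) ≡ 0ℚ
        head-ξ = trans (sym (trans (cong (ℚ._+_ a) (pairing-0 f T (c ∘ suc) ξ tail≡0)) (ℚₚ.+-identityʳ a))) (rel ξ)
          where a = c zero ℚ.* (ξ (proj₁ (f h)) ℚ.- ξ (proj₂ (f h)))
        unit : f h ≡ (t , suc r) ⊎ f h ≡ (suc r , t) → c zero ≡ 0ℚ
        unit (inj₁ p) = trans (lemma (c zero)) (cong ℚ.-_ (trans (sym (trans (cong (λ e → c zero ℚ.* (ξ (proj₁ e) ℚ.- ξ (proj₂ e))) p)
                          (cong₂ (λ a b → c zero ℚ.* (a ℚ.- b)) ξ-target ξ-removed))) head-ξ))
          where
          open +-*-Solver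
          lemma : ∀ a → a ≡ ℚ.- (a ℚ.* (0ℚ ℚ.- 1ℚ))
          lemma = solve 1 (λ a → a := :- (a :* (con 0ℚ :- con 1ℚ))) refl
        unit (inj₂ p) = trans (lemma (c zero)) (trans (sym (trans (cong (λ e → c zero ℚ.* (ξ (proj₁ e) ℚ.- ξ (proj₂ e))) p)
                          (cong₂ (λ a b → c zero ℚ.* (a ℚ.- b)) ξ-removed ξ-target))) head-ξ)
          where
          open +-*-Solver
          lemma : ∀ a → a ≡ a ℚ.* (1ℚ ℚ.- 0ℚ)
          lemma = solve 1 (λ a → a := a :* (con 1ℚ :- con 0ℚ)) refl
        head≡0 : c zero ≡ 0ℚ
        head≡0 = unit e≡

    contract-map : ∀ {n} (f : Y → Edge (suc n)) t r t≢r T → contract t r t≢r (map f T) ≡ map (mapEdge (merge t r t≢r) ∘ f) T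
    contract-map f t r t≢r T = sym (Listₚ.map-∘ T)

    mutual
      independent-nullity : ∀ n (f : Y → Edge n) T → DualIndependent f T → nullity n (map f T) ℕ.+ length T ≡ n
      independent-nullity n f []      ind = ℕₚ.+-identityʳ n
      independent-nullity n f (h ∷ T) ind = independent-nullity-∷ n f h T (kind (f h)) ind

      independent-nullity-∷ : ∀ n (f : Y → Edge n) h T (k : Kind (f h)) → DualIndependent f (h ∷ T) →
                              nullity-∷ n k (map f T) ℕ.+ suc (length T) ≡ n
      independent-nullity-∷ n f h T (loop p) ind = ⊥-elim (independent⇒nonLoop f h T ind p)
      independent-nullity-∷ (suc n) f h T (link t r t≢r e≡) ind = trans (ℕₚ.+-suc _ (length T)) (cong suc (trans
        (cong (λ E → nullity n E ℕ.+ length T) (contract-map f t r t≢r T))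
        (independent-nullity n (mapEdge (merge t r t≢r) ∘ f) T (independent-contract f h T t≢r e≡ ind))))

    mutual
      -- The greedy construction of a spanning forest: an edge is kept unless the edges kept before
      -- have turned it into a loop.
      spanning : ∀ n (f : Y → Edge n) S → ∃ λ T → T ⊆ S × DualIndependent f T × nullity n (map f S) ℕ.+ length T ≡ n
      spanning n f []      = [] , [] , (λ c _ ()) , ℕₚ.+-identityʳ n
      spanning n f (h ∷ S) = spanning-∷ n f h S (kind (f h))

      spanning-∷ : ∀ n (f : Y → Edge n) h S (k : Kind (f h)) →
                   ∃ λ T → T ⊆ h ∷ S × DualIndependent f T × nullity-∷ n k (map f S) ℕ.+ length T ≡ n
      spanning-∷ n f h S (loop p) = let (T , sub , ind , eq) = spanning n f S in T , h ∷ʳ sub , ind , eq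
      spanning-∷ (suc n) f h S (link t r t≢r e≡) =
        let (T , sub , ind , eq) = spanning n (mapEdge (merge t r t≢r) ∘ f) S in
        h ∷ T , refl ∷ sub , independent-extend f h T t≢r e≡ ind ,
        trans (ℕₚ.+-suc _ (length T)) (cong suc (trans (cong (λ E → nullity n E ℕ.+ length T) (contract-map f t r t≢r S)) eq))

  toEdge : ∀ {n} → Hyp n → Edge n
  toEdge (eqH i j _) = suc i , suc j
  toEdge (coordH i)  = suc i , zero

  unit : ∀ {n} → Fin n → Fin (suc n) → ℚ
  unit m zero    = 0ℚ
  unit m (suc i) = toℚ (δ i m)

  normal-unit : ∀ {n} (h : Hyp n) m → toℚ (normal h m) ≡ unit m (proj₁ (toEdge h)) ℚ.- unit m (proj₂ (toEdge h))
  normal-unit (eqH i j _) m with i Fin.≟ m | j Fin.≟ m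
  ... | yes _ | yes _ = refl
  ... | yes _ | no _  = refl
  ... | no _  | yes _ = refl
  ... | no _  | no _  = refl
  normal-unit (coordH i) m = sym (trans (cong (ℚ._+_ (toℚ (δ i m))) refl) (ℚₚ.+-identityʳ _))

  combo-∷ : ∀ {n} (h : Hyp n) T c m → combo (h ∷ T) c m ≡ c zero ℚ.* toℚ (normal h m) ℚ.+ combo T (c ∘ suc) m
  combo-∷ h T c m = cong (λ l → c zero ℚ.* toℚ (normal h m) ℚ.+ sumℚ l)
    (trans (Listₚ.map-tabulate suc (λ k → c k ℚ.* toℚ (normal (lookup (h ∷ T) k) m)))
           (sym (Listₚ.map-tabulate id (λ k → c (suc k) ℚ.* toℚ (normal (lookup T k) m)))))

  combo-pairing : ∀ {n} (T : List (Hyp n)) c m → combo T c m ≡ pairing toEdge T c (unit m)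
  combo-pairing []      c m = refl
  combo-pairing (h ∷ T) c m = trans (combo-∷ h T c m) (cong₂ ℚ._+_ (cong (ℚ._*_ (c zero)) (normal-unit h m)) (combo-pairing T (c ∘ suc) m))

  sumFin : ∀ n → (Fin n → ℚ) → ℚ
  sumFin zero    g = 0ℚ
  sumFin (suc n) g = g zero ℚ.+ sumFin n (g ∘ suc)

  sumFin-cong : ∀ n {g g′ : Fin n → ℚ} → (∀ m → g m ≡ g′ m) → sumFin n g ≡ sumFin n g′
  sumFin-cong zero    p = refl
  sumFin-cong (suc n) p = cong₂ ℚ._+_ (p zero) (sumFin-cong n (p ∘ suc))

  sumFin-0 : ∀ n (d : Fin n → ℚ) → sumFin n (λ m → d m ℚ.* 0ℚ) ≡ 0ℚ
  sumFin-0 zero    d = refl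
  sumFin-0 (suc n) d = trans (cong₂ ℚ._+_ (ℚₚ.*-zeroʳ (d zero)) (sumFin-0 n (d ∘ suc))) (ℚₚ.+-identityʳ 0ℚ)

  sumFin-linear : ∀ n k (g g′ : Fin n → ℚ) → sumFin n (λ m → k ℚ.* g m ℚ.+ g′ m) ≡ k ℚ.* sumFin n g ℚ.+ sumFin n g′
  sumFin-linear zero    k g g′ = sym (trans (ℚₚ.+-identityʳ _) (ℚₚ.*-zeroʳ k))
  sumFin-linear (suc n) k g g′ rewrite sumFin-linear n k (g ∘ suc) (g′ ∘ suc) =
    lemma k (g zero) (g′ zero) (sumFin n (g ∘ suc)) (sumFin n (g′ ∘ suc))
    where
    open +-*-Solver
    lemma : ∀ k a b x y → (k ℚ.* a ℚ.+ b) ℚ.+ (k ℚ.* x ℚ.+ y) ≡ k ℚ.* (a ℚ.+ x) ℚ.+ (b ℚ.+ y)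
    lemma = solve 5 (λ k a b x y → (k :* a :+ b) :+ (k :* x :+ y) := k :* (a :+ x) :+ (b :+ y)) refl

  δ-suc : ∀ {n} (i m : Fin n) → δ (suc i) (suc m) ≡ δ i m
  δ-suc i m with i Fin.≟ m
  ... | yes _ = refl
  ... | no _  = refl

  sumFin-δ : ∀ n (i : Fin n) (d : Fin n → ℚ) → sumFin n (λ m → d m ℚ.* toℚ (δ i m)) ≡ d i
  sumFin-δ (suc n) zero    d = trans (cong₂ ℚ._+_ (ℚₚ.*-identityʳ (d zero)) (sumFin-0 n (d ∘ suc))) (ℚₚ.+-identityʳ _)
  sumFin-δ (suc n) (suc i) d = trans (cong₂ ℚ._+_ (ℚₚ.*-zeroʳ (d zero))
    (trans (sumFin-cong n (λ m → cong (λ z → d (suc m) ℚ.* toℚ z) (δ-suc i m))) (sumFin-δ n i (d ∘ suc)))) (ℚₚ.+-identityˡ _)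

  -- Only differences of potentials enter, so `ψ` may be normalized to 0 at the ground; it is then a
  -- combination of the `unit` potentials, whose pairings are the coordinates of the linear
  -- combination of normals.
  pairing-expand : ∀ {n} (T : List (Hyp n)) c ψ → pairing toEdge T c ψ ≡ sumFin n (λ m → (ψ (suc m) ℚ.- ψ zero) ℚ.* pairing toEdge T c (unit m))
  pairing-expand {n} []      c ψ = sym (sumFin-0 n (λ m → ψ (suc m) ℚ.- ψ zero))
  pairing-expand {n} (h ∷ T) c ψ = sym (begin
    sumFin n (λ m → d (suc m) ℚ.* (c zero ℚ.* N m ℚ.+ pairing toEdge T (c ∘ suc) (unit m)))
      ≡⟨ sumFin-cong n (λ m → distribute (d (suc m)) (c zero) (N m) (pairing toEdge T (c ∘ suc) (unit m))) ⟩
    sumFin n (λ m → c zero ℚ.* (d (suc m) ℚ.* N m) ℚ.+ d (suc m) ℚ.* pairing toEdge T (c ∘ suc) (unit m))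
      ≡⟨ sumFin-linear n (c zero) (λ m → d (suc m) ℚ.* N m) (λ m → d (suc m) ℚ.* pairing toEdge T (c ∘ suc) (unit m)) ⟩
    c zero ℚ.* sumFin n (λ m → d (suc m) ℚ.* N m) ℚ.+ sumFin n (λ m → d (suc m) ℚ.* pairing toEdge T (c ∘ suc) (unit m))
      ≡⟨ cong₂ (λ a b → c zero ℚ.* a ℚ.+ b) difference (sym (pairing-expand T (c ∘ suc) ψ)) ⟩
    c zero ℚ.* (ψ u ℚ.- ψ v) ℚ.+ pairing toEdge T (c ∘ suc) ψ ∎)
    where
    open ≡-Reasoning
    u = proj₁ (toEdge h)
    v = proj₂ (toEdge h)
    d : Fin (suc n) → ℚ
    d w = ψ w ℚ.- ψ zero
    N : Fin n → ℚ
    N m = unit m u ℚ.- unit m v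
    module S = +-*-Solver
    distribute : ∀ d c x y → d ℚ.* (c ℚ.* x ℚ.+ y) ≡ c ℚ.* (d ℚ.* x) ℚ.+ d ℚ.* y
    distribute = S.solve 4 (λ d c x y → d S.:* (c S.:* x S.:+ y) S.:= c S.:* (d S.:* x) S.:+ d S.:* y) refl
    split : ∀ d x y → d ℚ.* (x ℚ.- y) ≡ ℚ.- 1ℚ ℚ.* (d ℚ.* y) ℚ.+ d ℚ.* x
    split = S.solve 3 (λ d x y → d S.:* (x S.:- y) S.:= (S.:- S.con 1ℚ) S.:* (d S.:* y) S.:+ d S.:* x) refl
    cancel : ∀ a b z → ℚ.- 1ℚ ℚ.* (b ℚ.- z) ℚ.+ (a ℚ.- z) ≡ a ℚ.- b
    cancel = S.solve 3 (λ a b z → (S.:- S.con 1ℚ) S.:* (b S.:- z) S.:+ (a S.:- z) S.:= a S.:- b) refl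
    evaluate : ∀ w → sumFin n (λ m → d (suc m) ℚ.* unit m w) ≡ d w
    evaluate zero    = trans (sumFin-0 n (d ∘ suc)) (sym (ℚₚ.+-inverseʳ (ψ zero)))
    evaluate (suc i) = sumFin-δ n i (d ∘ suc)
    difference : sumFin n (λ m → d (suc m) ℚ.* N m) ≡ ψ u ℚ.- ψ v
    difference = trans (sumFin-cong n (λ m → split (d (suc m)) (unit m u) (unit m v)))
      (trans (sumFin-linear n (ℚ.- 1ℚ) (λ m → d (suc m) ℚ.* unit m v) (λ m → d (suc m) ℚ.* unit m u))
      (trans (cong₂ (λ a b → ℚ.- 1ℚ ℚ.* a ℚ.+ b) (evaluate v) (evaluate u)) (cancel (ψ u) (ψ v) (ψ zero))))

  independent⇒dual : ∀ {n} (T : List (Hyp n)) → Independent T → DualIndependent toEdge T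
  independent⇒dual T ind c rel = ind c (λ m → trans (combo-pairing T c m) (rel (unit m)))

  dual⇒independent : ∀ {n} (T : List (Hyp n)) → DualIndependent toEdge T → Independent T
  dual⇒independent {n} T ind c rel = ind c (λ ψ → trans (pairing-expand T c ψ)
    (trans (sumFin-cong n (λ m → cong (ℚ._*_ (ψ (suc m) ℚ.- ψ zero)) (trans (sym (combo-pairing T c m)) (rel m)))) (sumFin-0 n (λ m → ψ (suc m) ℚ.- ψ zero))))

  -- A maximal independent `T₀` is compared with a spanning `T`: monotonicity of the nullity gives
  -- one inequality, and maximality of `T₀` against `T` the other.
  rank-nullity : ∀ {n} (S : List (Hyp n)) k → IsRank S k → nullity n (map toEdge S) ℕ.+ k ≡ n
  rank-nullity {n} S k ((T₀ , T₀⊆S , ind₀ , refl) , max) with spanning n toEdge S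
  ... | T , T⊆S , ind , eq = ℕₚ.≤-antisym
    (subst (nullity n (map toEdge S) ℕ.+ length T₀ ℕ.≤_) (independent-nullity n toEdge T₀ (independent⇒dual T₀ ind₀))
      (ℕₚ.+-monoˡ-≤ (length T₀) (nullity-⊆ toEdge T₀⊆S)))
    (subst (ℕ._≤ nullity n (map toEdge S) ℕ.+ length T₀) eq (ℕₚ.+-monoʳ-≤ (nullity n (map toEdge S)) (max T T⊆S (dual⇒independent T ind))))

  module _ {X : Set} where

    sumSubsets : (List X → ℤ) → List X → ℤ
    sumSubsets φ A = sumℤ (map φ (subsets A))

    sumℤ-++ : ∀ xs ys → sumℤ (xs ++ ys) ≡ sumℤ xs ℤ.+ sumℤ ys
    sumℤ-++ []       ys = sym (ℤₚ.+-identityˡ _)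
    sumℤ-++ (x ∷ xs) ys = trans (cong (ℤ._+_ x) (sumℤ-++ xs ys)) (sym (ℤₚ.+-assoc x _ _))

    sumSubsets-∷ : ∀ φ x A → sumSubsets φ (x ∷ A) ≡ sumSubsets φ A ℤ.+ sumSubsets (φ ∘ (x ∷_)) A
    sumSubsets-∷ φ x A = trans (cong sumℤ (Listₚ.map-++ φ (subsets A) (map (x ∷_) (subsets A))))
      (trans (sumℤ-++ (map φ (subsets A)) _) (cong (λ l → sumSubsets φ A ℤ.+ sumℤ l) (sym (Listₚ.map-∘ (subsets A)))))

    sumSubsets-cong : ∀ A {φ ψ : List X → ℤ} → (∀ S → S ⊆ A → φ S ≡ ψ S) → sumSubsets φ A ≡ sumSubsets ψ A
    sumSubsets-cong []      p = cong (ℤ._+ 0ℤ) (p [] [])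
    sumSubsets-cong (x ∷ A) {φ} {ψ} p = trans (sumSubsets-∷ φ x A)
      (trans (cong₂ ℤ._+_ (sumSubsets-cong A (λ S s → p S (x ∷ʳ s))) (sumSubsets-cong A (λ S s → p (x ∷ S) (refl ∷ s))))
             (sym (sumSubsets-∷ ψ x A)))

    sumSubsets-*ʳ : ∀ k φ A → sumSubsets φ A ℤ.* k ≡ sumSubsets (λ S → φ S ℤ.* k) A
    sumSubsets-*ʳ k φ []      = trans (cong (ℤ._* k) (ℤₚ.+-identityʳ (φ []))) (sym (ℤₚ.+-identityʳ _))
    sumSubsets-*ʳ k φ (x ∷ A) = trans (cong (ℤ._* k) (sumSubsets-∷ φ x A)) (trans (ℤₚ.*-distribʳ-+ k (sumSubsets φ A) _)
      (trans (cong₂ ℤ._+_ (sumSubsets-*ʳ k φ A) (sumSubsets-*ʳ k (φ ∘ (x ∷_)) A)) (sym (sumSubsets-∷ _ x A))))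

  sumSubsets-map : ∀ {X Z : Set} (f : X → Z) φ A → sumSubsets φ (map f A) ≡ sumSubsets (φ ∘ map f) A
  sumSubsets-map f φ []      = refl
  sumSubsets-map f φ (x ∷ A) = trans (sumSubsets-∷ φ (f x) (map f A))
    (trans (cong₂ ℤ._+_ (sumSubsets-map f φ A) (sumSubsets-map f (φ ∘ (f x ∷_)) A)) (sym (sumSubsets-∷ (φ ∘ map f) x A)))

  whitneyTerm : ∀ n → ℕ → List (Edge n) → ℤ
  whitneyTerm n x S = sign (length S) ℤ.* (+ suc x) ℤ.^ nullity n S

  sign-suc : ∀ k y → sign (suc k) ℤ.* y ≡ (sign k ℤ.* y) ℤ.* -1ℤ
  sign-suc k y = lemma (sign k) y
    where
    lemma : ∀ s y → ((ℤ.- 1ℤ) ℤ.* s) ℤ.* y ≡ s ℤ.* y ℤ.* (ℤ.- 1ℤ)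
    lemma = solve-∀

  mutual
    -- Subsets without and with the first edge reproduce deletion and contraction; if that edge is a
    -- loop they cancel in pairs.
    whitney : ∀ n E x → sumSubsets (whitneyTerm n x) E ≡ properCount n E (suc x)
    whitney n []      x = trans (ℤₚ.+-identityʳ _) (trans (ℤₚ.*-identityˡ _) (sym (sumVec-1 n (suc x))))
    whitney n (e ∷ E) x = trans (sumSubsets-∷ (whitneyTerm n x) e E) (whitney-∷ n (kind e) E x)

    whitney-∷ : ∀ n {e : Edge n} (k : Kind e) E x →
      sumSubsets (whitneyTerm n x) E ℤ.+ sumSubsets (λ S → sign (suc (length S)) ℤ.* (+ suc x) ℤ.^ nullity-∷ n k S) E ≡ properCount n (e ∷ E) (suc x)
    whitney-∷ n {e} (loop p) E x = trans
      (cong (ℤ._+_ (sumSubsets (whitneyTerm n x) E)) (trans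
        (sumSubsets-cong E (λ S _ → sign-suc (length S) ((+ suc x) ℤ.^ nullity n S)))
        (sym (sumSubsets-*ʳ -1ℤ (whitneyTerm n x) E))))
      (trans (cancel (sumSubsets (whitneyTerm n x) E)) (sym (properCount-loop n e E (suc x) p)))
      where
      cancel : ∀ a → a ℤ.+ a ℤ.* (ℤ.- 1ℤ) ≡ 0ℤ
      cancel = solve-∀
    whitney-∷ (suc n) {e} (link t r t≢r e≡) E x = trans
      (cong₂ ℤ._+_ (whitney (suc n) E x) (trans
        (sumSubsets-cong E (λ S _ → trans (sign-suc (length S) ((+ suc x) ℤ.^ nullity n (contract t r t≢r S)))
          (cong (λ l → (sign l ℤ.* (+ suc x) ℤ.^ nullity n (contract t r t≢r S)) ℤ.* -1ℤ) (sym (Listₚ.length-map (mapEdge (merge t r t≢r)) S)))))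
        (trans (sym (sumSubsets-*ʳ -1ℤ (whitneyTerm n x ∘ contract t r t≢r) E))
        (trans (cong (ℤ._* -1ℤ) (trans (sym (sumSubsets-map (mapEdge (merge t r t≢r)) (whitneyTerm n x) E)) (whitney n (contract t r t≢r E) x)))
               (trans (ℤₚ.*-comm (properCount n (contract t r t≢r E) (suc x)) -1ℤ) (ℤₚ.-1*i≡-i _))))))
      (sym (properCount-link n e t r t≢r e≡ E x))

  fval-properCount : ∀ n rk (A : List (Hyp n)) → (∀ S → S ⊆ A → IsRank S (rk S)) → ∀ x →
    fval n rk A (+ suc x) ≡ (+ suc x) ℤ.^ n ℤ.- properCount n (map toEdge A) (suc x)
  fval-properCount n rk A isRank x = cong (ℤ._-_ ((+ suc x) ℤ.^ n)) (begin
    χ rk A y ℤ.* y ℤ.^ (n ∸ rk A)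
      ≡⟨ sumSubsets-*ʳ (y ℤ.^ (n ∸ rk A)) (λ S → sign (length S) ℤ.* y ℤ.^ (rk A ∸ rk S)) A ⟩
    sumSubsets (λ S → sign (length S) ℤ.* y ℤ.^ (rk A ∸ rk S) ℤ.* y ℤ.^ (n ∸ rk A)) A
      ≡⟨ sumSubsets-cong A term ⟩
    sumSubsets (whitneyTerm n x ∘ map toEdge) A
      ≡⟨ sym (sumSubsets-map toEdge (whitneyTerm n x) A) ⟩
    sumSubsets (whitneyTerm n x) (map toEdge A)
      ≡⟨ whitney n (map toEdge A) x ⟩
    properCount n (map toEdge A) (suc x) ∎)
    where
    open ≡-Reasoning
    y = + suc x
    rk≤ : ∀ S → S ⊆ A → rk S ℕ.≤ rk A
    rk≤ S s with isRank S s
    ... | (T , T⊆S , ind , eq) , _ = subst (ℕ._≤ rk A) eq (proj₂ (isRank A ⊆-refl) T (⊆-trans T⊆S s) ind)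
    -- The factor `x^(n-r)` turns Whitney's exponent into `n - r(S)`. The truncated subtractions are
    -- exact because `r(S) ≤ r(A) ≤ n`.
    exponent : ∀ S → S ⊆ A → (rk A ∸ rk S) ℕ.+ (n ∸ rk A) ≡ nullity n (map toEdge S)
    exponent S s = ℕₚ.+-cancelʳ-≡ (rk S) _ _ (begin
      (rk A ∸ rk S) ℕ.+ (n ∸ rk A) ℕ.+ rk S ≡⟨ cong (ℕ._+ rk S) (ℕₚ.+-comm (rk A ∸ rk S) (n ∸ rk A)) ⟩
      (n ∸ rk A) ℕ.+ (rk A ∸ rk S) ℕ.+ rk S ≡⟨ ℕₚ.+-assoc (n ∸ rk A) (rk A ∸ rk S) (rk S) ⟩
      (n ∸ rk A) ℕ.+ ((rk A ∸ rk S) ℕ.+ rk S) ≡⟨ cong (n ∸ rk A ℕ.+_) (ℕₚ.m∸n+n≡m (rk≤ S s)) ⟩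
      (n ∸ rk A) ℕ.+ rk A ≡⟨ ℕₚ.m∸n+n≡m (subst (rk A ℕ.≤_) (rank-nullity A (rk A) (isRank A ⊆-refl)) (ℕₚ.m≤n+m (rk A) _)) ⟩
      n ≡⟨ sym (rank-nullity S (rk S) (isRank S s)) ⟩
      nullity n (map toEdge S) ℕ.+ rk S ∎)
    term : ∀ S → S ⊆ A → sign (length S) ℤ.* y ℤ.^ (rk A ∸ rk S) ℤ.* y ℤ.^ (n ∸ rk A) ≡ whitneyTerm n x (map toEdge S)
    term S s = trans (ℤₚ.*-assoc (sign (length S)) _ _) (cong₂ (λ k z → sign k ℤ.* z) (sym (Listₚ.length-map toEdge S))
      (trans (sym (ℤₚ.^-distribˡ-+-* y (rk A ∸ rk S) (n ∸ rk A))) (cong (y ℤ.^_) (exponent S s))))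

-- Binomial representations and a criterion for Macaulay's bound.

module Macaulay where

  open import Defs
  open Eulerian using (rising)
  open import Data.Nat
  open import Data.Nat.Properties
  open import Data.Nat.Combinatorics using (_C_; nCk+nC[k+1]≡[n+1]C[k+1]; nC1≡n; k>n⇒nCk≡0)
  open import Data.Nat.Tactic.RingSolver using (solve-∀)
  open import Data.Empty using (⊥-elim)
  open import Data.List using ([]; _∷_)
  open import Data.Product using (_,_)
  open import Relation.Nullary using (yes; no)
  open import Relation.Binary.PropositionalEquality using (_≡_; refl; sym; trans; cong; cong₂; subst; subst₂; module ≡-Reasoning)

  pascal : ∀ n k → suc n C suc k ≡ n C k + n C suc k
  pascal n k = sym (nCk+nC[k+1]≡[n+1]C[k+1] n k)

  C-absorb : ∀ n k → suc k * (n C suc k) + k * (n C k) ≡ n * (n C k)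
  C-absorb zero    zero    = refl
  C-absorb zero    (suc k) rewrite k>n⇒nCk≡0 {0} {suc (suc k)} (s≤s z≤n) | k>n⇒nCk≡0 {0} {suc k} (s≤s z≤n) | *-zeroʳ k = refl
  C-absorb (suc n) zero    = trans (+-identityʳ _) (trans (+-identityʳ _) (trans (nC1≡n (suc n)) (sym (*-identityʳ (suc n)))))
  C-absorb (suc n) (suc k) = begin
    suc (suc k) * (suc n C suc (suc k)) + suc k * (suc n C suc k)
      ≡⟨ cong₂ (λ x y → suc (suc k) * x + suc k * y) (pascal n (suc k)) (pascal n k) ⟩
    suc (suc k) * (p₁ + p₂) + suc k * (p₀ + p₁)
      ≡⟨ lemma₁ k p₀ p₁ p₂ ⟩
    (suc (suc k) * p₂ + suc k * p₁) + (suc k * p₁ + k * p₀) + (p₁ + p₀)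
      ≡⟨ cong₂ (λ x y → x + y + (p₁ + p₀)) (C-absorb n (suc k)) (C-absorb n k) ⟩
    n * p₁ + n * p₀ + (p₁ + p₀)
      ≡⟨ lemma₂ n p₀ p₁ ⟩
    suc n * (p₀ + p₁)
      ≡⟨ cong (suc n *_) (sym (pascal n k)) ⟩
    suc n * (suc n C suc k) ∎
    where
    open ≡-Reasoning
    p₀ = n C k
    p₁ = n C suc k
    p₂ = n C suc (suc k)
    lemma₁ : ∀ k a b c → (2 + k) * (b + c) + (1 + k) * (a + b) ≡ ((2 + k) * c + (1 + k) * b) + ((1 + k) * b + k * a) + (b + a)
    lemma₁ = solve-∀
    lemma₂ : ∀ n a b → n * b + n * a + (b + a) ≡ (1 + n) * (a + b)
    lemma₂ = solve-∀

  C-absorb-suc : ∀ n k → suc k * (suc n C suc k) ≡ suc n * (n C k)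
  C-absorb-suc n k = begin
    suc k * (suc n C suc k) ≡⟨ cong (suc k *_) (pascal n k) ⟩
    suc k * (n C k + n C suc k) ≡⟨ lemma₁ k (n C k) (n C suc k) ⟩
    n C k + (suc k * (n C suc k) + k * (n C k)) ≡⟨ cong (n C k +_) (C-absorb n k) ⟩
    suc n * (n C k) ∎
    where
    open ≡-Reasoning
    lemma₁ : ∀ k a b → (1 + k) * (a + b) ≡ a + ((1 + k) * b + k * a)
    lemma₁ = solve-∀

  rising-C : ∀ b k → k ! * ((b + k) C k) ≡ rising (suc b) k
  rising-C b zero    = refl
  rising-C b (suc k) = begin
    suc k * k ! * ((b + suc k) C suc k) ≡⟨ cong (λ m → suc k * k ! * (m C suc k)) (+-suc b k) ⟩
    suc k * k ! * (suc (b + k) C suc k) ≡⟨ lemma₁ (suc k) (k !) (suc (b + k) C suc k) ⟩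
    k ! * (suc k * (suc (b + k) C suc k)) ≡⟨ cong (k ! *_) (C-absorb-suc (b + k) k) ⟩
    k ! * (suc (b + k) * ((b + k) C k)) ≡⟨ lemma₂ (k !) (suc (b + k)) ((b + k) C k) ⟩
    k ! * ((b + k) C k) * suc (b + k) ≡⟨ cong (_* suc (b + k)) (rising-C b k) ⟩
    rising (suc b) k * suc (b + k) ∎
    where
    open ≡-Reasoning
    lemma₁ : ∀ a b c → a * b * c ≡ b * (a * c)
    lemma₁ = solve-∀
    lemma₂ : ∀ a b c → a * (b * c) ≡ a * c * b
    lemma₂ = solve-∀

  C-step-≤ : ∀ n k → n C k ≤ suc n C k
  C-step-≤ n zero    = ≤-refl
  C-step-≤ n (suc k) = ≤-trans (m≤n+m (n C suc k) (n C k)) (≤-reflexive (sym (pascal n k)))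

  C-monoˡ-≤ : ∀ {m n} k → m ≤ n → m C k ≤ n C k
  C-monoˡ-≤ {m} k m≤n = subst (λ n → m C k ≤ n C k) (m+[n∸m]≡n m≤n) (go (_ ∸ m))
    where
    go : ∀ d → m C k ≤ (m + d) C k
    go zero    = ≤-reflexive (cong (_C k) (sym (+-identityʳ m)))
    go (suc d) = ≤-trans (go d) (≤-trans (C-step-≤ (m + d) k) (≤-reflexive (cong (_C k) (sym (+-suc m d)))))

  C-pos : ∀ n k → k ≤ n → 0 < n C k
  C-pos n       zero    _         = s≤s z≤n
  C-pos (suc n) (suc k) (s≤s k≤n) = ≤-trans (C-pos n k k≤n) (≤-trans (m≤m+n (n C k) (n C suc k)) (≤-reflexive (sym (pascal n k))))

  -- The terms after the first start at some `b < a`, so by induction their sum is below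
  -- `C(b+1, k-1)` and hence below `C(a, k-1)`; Pascal's rule finishes.
  binSum-< : ∀ k a as → Valid k (a ∷ as) → binSum k (a ∷ as) < suc a C k
  binSum-< (suc k) a []       (_ , k<a) = subst₂ _<_ (sym (+-identityʳ (a C suc k))) (sym (pascal a k))
    (m<n+m (a C suc k) (C-pos a k (<⇒≤ k<a)))
  binSum-< (suc k) a (b ∷ as) (_ , k<a , b<a , v) = begin-strict
    a C suc k + binSum k (b ∷ as) <⟨ +-monoʳ-< (a C suc k) (binSum-< k b as v) ⟩
    a C suc k + suc b C k ≤⟨ +-monoʳ-≤ (a C suc k) (C-monoˡ-≤ k b<a) ⟩
    a C suc k + a C k ≡⟨ +-comm (a C suc k) (a C k) ⟩
    a C k + a C suc k ≡⟨ sym (pascal a k) ⟩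
    suc a C suc k ∎
    where open ≤-Reasoning

  -- If the leading index of g is a, then g < C(a+1,i), while g^⟨i⟩ ≥ C(a+1,i+1) = C(a+1,i) (a+1-i)/(i+1).
  macaulay-criterion : ∀ i b {g g′} → rising b i ≤ i ! * g → suc i * g′ ≤ b * g → MacaulayBound i g g′
  macaulay-criterion i b size ratio [] v refl =
    *-cancelˡ-≤ (suc i) (≤-trans ratio (≤-reflexive (trans (*-zeroʳ b) (sym (*-zeroʳ (suc i))))))
  macaulay-criterion i zero size ratio (a ∷ as) v refl =
    ≤-trans (*-cancelˡ-≤ (suc i) (≤-trans ratio (≤-reflexive (sym (*-zeroʳ (suc i)))))) z≤n
  macaulay-criterion i (suc b) {g} {g′} size ratio (a ∷ as) v refl = ≤-trans (*-cancelˡ-≤ (suc i) (begin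
    suc i * g′ ≤⟨ ratio ⟩
    suc b * g ≤⟨ *-monoʳ-≤ (suc b) (<⇒≤ (binSum-< i a as v)) ⟩
    suc b * (suc a C i) ≤⟨ +-cancelʳ-≤ (i * (suc a C i)) _ _ (begin
      suc b * (suc a C i) + i * (suc a C i) ≡⟨ sym (*-distribʳ-+ (suc a C i) (suc b) i) ⟩
      suc (b + i) * (suc a C i) ≤⟨ *-monoˡ-≤ (suc a C i) (s≤s b+i≤a) ⟩
      suc a * (suc a C i) ≡⟨ sym (C-absorb (suc a) i) ⟩
      suc i * (suc a C suc i) + i * (suc a C i) ∎) ⟩
    suc i * (suc a C suc i) ∎)) (m≤m+n (suc a C suc i) _)
    where
    open ≤-Reasoning
    C≤g : (b + i) C i ≤ g
    C≤g = *-cancelˡ-≤ (i !) {{i !≢0}} (≤-trans (≤-reflexive (rising-C b i)) size)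
    -- `C(b+i, i) ≤ g < C(a+1, i)`, and binomial coefficients are monotone in the upper index.
    b+i≤a : b + i ≤ a
    b+i≤a with b + i ≤? a
    ... | yes p = p
    ... | no ¬p = ⊥-elim (<⇒≱ (binSum-< i a as v) (≤-trans (C-monoˡ-≤ i (≰⇒> ¬p)) C≤g))

-- Macaulay's bound for consecutive differences of `hVec`.

module Growth where

  open import Defs
  open Sequences
  open ColoringSums
  open Eulerian
  open GraphColorings
  open HVectors
  open Macaulay
  open import Data.Nat using (ℕ; zero; suc; z≤n; s≤s; _≤_; _<_; _+_; _*_; _^_; _!; >-nonZero)
  open import Data.Nat.Properties
  open import Data.Nat.Tactic.RingSolver using (solve-∀)
  open import Data.Integer as ℤ using (+_)
  import Data.Integer.Properties as ℤₚ
  open import Data.Integer.Tactic.RingSolver using () renaming (solve-∀ to ℤ-solve-∀)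
  open import Data.Empty using (⊥-elim)
  open import Data.List using (List; []; _∷_; length)
  open import Data.List.Relation.Unary.All using (All; []; _∷_)
  open import Data.List.Relation.Unary.AllPairs using ([]; _∷_)
  open import Data.Product using (∃; _×_; _,_; proj₁)
  open import Relation.Nullary using (yes; no)
  open import Relation.Binary.PropositionalEquality using (_≡_; refl; sym; trans; cong; cong₂; subst; subst₂; module ≡-Reasoning)

  triangle-double : ∀ m → 2 * triangle (suc m) ≡ suc m * m
  triangle-double zero    = refl
  triangle-double (suc m) = trans (lemma₁ m (triangle (suc m))) (trans (cong (_+_ (2 * suc m)) (triangle-double m)) (lemma₂ m))
    where
    lemma₁ : ∀ m t → 2 * (suc m + t) ≡ 2 * suc m + 2 * t
    lemma₁ m t = *-distribˡ-+ 2 (suc m) t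
    lemma₂ : ∀ m → 2 * (1 + m) + (1 + m) * m ≡ (2 + m) * (1 + m)
    lemma₂ = solve-∀

  hVec-tail : ∀ n e E i → NonLoop e → hVec (suc n) E i ℤ.≤ hVec (suc n) (e ∷ E) i
  hVec-tail n e E i nl with kind e
  ... | loop p = ⊥-elim (nl p)
  ... | link t r t≢r e≡ = subst (hVec (suc n) E i ℤ.≤_) (sym (hVec-link e t r t≢r e≡ E i))
    (ℤₚ.i≤i+j (hVec (suc n) E i) (pVec n (contract t r t≢r E) i) {{ℤ.nonNegative (pVec-nonneg n (contract t r t≢r E) i)}})

  -- The quadratic correction in `hVec-lower` overtakes the linear term when there are many edges.
  -- Deleting edges only lowers `hVec`, so the bound can be used with a favorable number of them.
  hVec-suffix : ∀ n k E i → Simple E → k ≤ length E →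
                ∃ λ E′ → Simple E′ × length E′ ≡ k × hVec (suc n) E′ i ℤ.≤ hVec (suc n) E i
  hVec-suffix n zero    []      i S _ = [] , S , refl , ℤₚ.≤-refl
  hVec-suffix n k       (e ∷ E) i (nl ∷ nls , df ∷ dfs) k≤ with k ≤? length E
  ... | yes p = let (E′ , S′ , l , h≤) = hVec-suffix n k E i (nls , dfs) p in
                E′ , S′ , l , ℤₚ.≤-trans h≤ (hVec-tail n e E i nl)
  ... | no ¬p = e ∷ E , (nl ∷ nls , df ∷ dfs) , ≤-antisym (≰⇒> ¬p) k≤ , ℤₚ.≤-refl

  -- With n = 2i + 2 + s and m = |E|: few edges make h_{i+1} small, many edges make h_i large.
  module _ (j s : ℕ) where
    private
      i = suc j
      n′ = s + 2 * i
      a = 2 * i + 1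
      c = 2 * i + 3
      K = (2 + s) * c ^ suc s
      Y = B (suc n′) i

      row : s + suc (2 * i) ≡ suc n′
      row = +-suc s (2 * i)

      2i≤n′ : 2 * i ≤ n′
      2i≤n′ = m≤n+m (2 * i) s

    module _ {E : List (Edge (2 + n′))} (S : Simple E) (1≤m : 1 ≤ length E) (H : ℕ → ℕ) (H≡ : ∀ k → + H k ≡ hVec (2 + n′) E k)
             {g g′ : ℕ} (step : H i ≡ H j + g) (step′ : H (suc i) ≡ H i + g′) where

      private
        lower : ∀ k → k ≤ length E → 2 * (k * Y) ≤ 2 * H i + 2 * triangle k * B n′ i
        lower k k≤m = let (E′ , S′ , l , h≤) = hVec-suffix (suc n′) k E i S k≤m in
          ≤-trans (*-monoʳ-≤ 2 (ℤ.drop‿+≤+ (ℤₚ.≤-trans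
            (subst (λ k → + (k * Y) ℤ.≤ hVec (2 + n′) E′ i ℤ.+ + (triangle k * B n′ i)) l (hVec-lower n′ i 2i≤n′ E′ S′))
            (ℤₚ.+-monoˡ-≤ (+ (triangle k * B n′ i)) (ℤₚ.≤-trans h≤ (ℤₚ.≤-reflexive (sym (H≡ i))))))))
          (≤-reflexive (lemma (H i) (triangle k) (B n′ i)))
          where
          lemma : ∀ h t b → 2 * (h + t * b) ≡ 2 * h + 2 * t * b
          lemma = solve-∀

        grow : a * B n′ i ≤ Y
        grow = B-grow n′ i

        h≥Y : Y ≤ H i
        h≥Y = *-cancelˡ-≤ 2 (≤-trans (≤-reflexive (cong (2 *_) (sym (+-identityʳ Y)))) (≤-trans (lower 1 1≤m) (≤-reflexive (+-identityʳ (2 * H i)))))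

        lym : (2 + s) * H i ≤ (i + 2 + s) * g
        lym = +-cancelˡ-≤ (i * H i) _ _ (begin
          i * H i + (2 + s) * H i ≡⟨ lemma₁ i s (H i) ⟩
          (i + 2 + s) * H i ≡⟨ cong ((i + 2 + s) *_) step ⟩
          (i + 2 + s) * (H j + g) ≡⟨ *-distribˡ-+ (i + 2 + s) (H j) g ⟩
          (i + 2 + s) * H j + (i + 2 + s) * g ≤⟨ +-monoˡ-≤ ((i + 2 + s) * g) (≤-trans (≤-reflexive (cong (_* H j) (coef j s))) local) ⟩
          i * H i + (i + 2 + s) * g ∎)
          where
          open ≤-Reasoning
          lemma₁ : ∀ i s h → i * h + (2 + s) * h ≡ (i + 2 + s) * h
          lemma₁ = solve-∀
          coef : ∀ j s → 1 + j + 2 + s ≡ 2 + (j + (1 + s))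
          coef = solve-∀
          dim : ∀ j s → 1 + (s + 2 * (1 + j)) ≡ 2 + (2 * j + (1 + s))
          dim = solve-∀
          localℤ : ∀ n → n ≡ 2 + (2 * j + suc s) → (E : List (Edge (suc n))) → All NonLoop E →
                   + (2 + (j + suc s)) ℤ.* hVec (suc n) E j ℤ.≤ + i ℤ.* hVec (suc n) E i
          localℤ n refl E nl = hVec-lym j (suc s) E nl
          local : (2 + (j + suc s)) * H j ≤ i * H i
          local = ℤ.drop‿+≤+ (subst₂ ℤ._≤_
            (trans (cong (ℤ._*_ (+ (2 + (j + suc s)))) (sym (H≡ j))) (sym (ℤₚ.pos-* (2 + (j + suc s)) (H j))))
            (trans (cong (ℤ._*_ (+ i)) (sym (H≡ i))) (sym (ℤₚ.pos-* i (H i))))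
            (localℤ (suc n′) (dim j s) E (proj₁ S)))

        g′≤B : g′ ≤ B (2 + n′) (suc i)
        g′≤B = ℤ.drop‿+≤+ (ℤₚ.≤-trans (ℤₚ.≤-reflexive (trans (difference (H (suc i)) (H i) g′ step′)
            (trans (cong₂ ℤ._-_ (H≡ (suc i)) (H≡ i)) (hVec-Δ (2 + n′) E (suc i)))))
          (ℤₚ.i≤j⇒i-k≤j (pVec (2 + n′) E (suc i)) {{ℤ.nonNegative (pVec-nonneg (2 + n′) E (suc i))}} ℤₚ.≤-refl))
          where
          lemma : ∀ y z → z ≡ y ℤ.+ z ℤ.- y
          lemma = ℤ-solve-∀
          difference : ∀ x y z → x ≡ y + z → + z ≡ + x ℤ.- + y
          difference _ y z refl = lemma (+ y) (+ z)

        -- The threshold `a = 2i+1` is the factor in `B-grow`: up to `a` edges the correction in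
        -- `lower` costs at most half of the main term. With more edges, `a` of them already give
        -- `h_i ≥ (i+1) Y`, which suffices against the Eulerian bound on `g′`. With fewer, `h_i` is
        -- at least half of `m Y`, and `g′ ≤ h_(i+1)` is bounded in proportion to `m`.
        ratio : suc i * (a ^ s * g′) ≤ K * H i
        ratio with a ≤? length E
        ... | yes a≤m = begin
          suc i * (a ^ s * g′) ≤⟨ *-monoʳ-≤ (suc i) (*-monoʳ-≤ (a ^ s) g′≤B) ⟩
          suc i * (a ^ s * B (2 + n′) (suc i)) ≤⟨ *-monoʳ-≤ (suc i) (subst (λ d → a ^ s * B (suc d) (suc i) ≤ K * B d i) row (B-next-ratio i s)) ⟩
          suc i * (K * Y) ≡⟨ lemma (suc i) K Y ⟩
          K * (suc i * Y) ≤⟨ *-monoʳ-≤ K many ⟩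
          K * H i ∎
          where
          open ≤-Reasoning
          lemma : ∀ x k y → x * (k * y) ≡ k * (x * y)
          lemma = solve-∀
          a≡ : a ≡ suc (2 * i)
          a≡ = +-comm (2 * i) 1
          split : ∀ i y → 2 * ((1 + i) * y) + 2 * i * y ≡ 2 * ((2 * i + 1) * y)
          split = solve-∀
          many : suc i * Y ≤ H i
          many = *-cancelˡ-≤ 2 (+-cancelʳ-≤ (2 * i * Y) _ _ (begin
            2 * (suc i * Y) + 2 * i * Y ≡⟨ split i Y ⟩
            2 * (a * Y) ≤⟨ lower a a≤m ⟩
            2 * H i + 2 * triangle a * B n′ i ≡⟨ cong (λ w → 2 * H i + w * B n′ i) (trans (cong (λ w → 2 * triangle w) a≡) (trans (triangle-double (2 * i)) (trans (cong (_* (2 * i)) (sym a≡)) (*-comm a (2 * i))))) ⟩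
            2 * H i + 2 * i * a * B n′ i ≡⟨ cong (_+_ (2 * H i)) (*-assoc (2 * i) a (B n′ i)) ⟩
            2 * H i + 2 * i * (a * B n′ i) ≤⟨ +-monoʳ-≤ (2 * H i) (*-monoʳ-≤ (2 * i) grow) ⟩
            2 * H i + 2 * i * Y ∎))
        ... | no a≰m = *-cancelˡ-≤ 2 (begin
          2 * (suc i * (a ^ s * g′)) ≡⟨ lemma₁ i (a ^ s) g′ ⟩
          (2 * i + 2) * (a ^ s * g′) ≤⟨ *-monoʳ-≤ (2 * i + 2) (*-monoʳ-≤ (a ^ s) g′≤) ⟩
          (2 * i + 2) * (a ^ s * (m * (X + Y))) ≡⟨ lemma₂ (2 * i + 2) (a ^ s) m (X + Y) ⟩
          m * ((2 * i + 2) * (a ^ s * (X + Y))) ≤⟨ *-monoʳ-≤ m (subst (λ d → (2 * i + 2) * (a ^ s * (B d (suc i) + B d i)) ≤ K * B d i) row (B-sum-ratio i s)) ⟩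
          m * (K * Y) ≡⟨ lemma₃ m K Y ⟩
          K * (m * Y) ≤⟨ *-monoʳ-≤ K (few m ≤-refl m<a) ⟩
          K * (2 * H i) ≡⟨ lemma₃ K 2 (H i) ⟩
          2 * (K * H i) ∎)
          where
          open ≤-Reasoning
          m = length E
          X = B (suc n′) (suc i)
          m<a : m < a
          m<a = ≰⇒> a≰m
          lemma₁ : ∀ i p g → 2 * ((1 + i) * (p * g)) ≡ (2 * i + 2) * (p * g)
          lemma₁ = solve-∀
          lemma₂ : ∀ x p m y → x * (p * (m * y)) ≡ m * (x * (p * y))
          lemma₂ = solve-∀
          lemma₃ : ∀ m k y → m * (k * y) ≡ k * (m * y)
          lemma₃ = solve-∀
          g′≤ : g′ ≤ m * (X + Y)
          g′≤ = ≤-trans (m≤n+m g′ (H i)) (≤-trans (≤-reflexive (sym step′))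
            (ℤ.drop‿+≤+ (ℤₚ.≤-trans (ℤₚ.≤-reflexive (H≡ (suc i))) (hVec-upper-next n′ i 2i≤n′ E S (<⇒≤ m<a)))))
          few : ∀ k → k ≤ m → k < a → k * Y ≤ 2 * H i
          few zero    _   _   = z≤n
          few (suc k) k≤m k<a = +-cancelʳ-≤ (suc k * Y) _ _ (begin
            suc k * Y + suc k * Y ≡⟨ cong (_+_ (suc k * Y)) (sym (+-identityʳ (suc k * Y))) ⟩
            2 * (suc k * Y) ≤⟨ lower (suc k) k≤m ⟩
            2 * H i + 2 * triangle (suc k) * B n′ i ≡⟨ cong (λ w → 2 * H i + w * B n′ i) (triangle-double k) ⟩
            2 * H i + suc k * k * B n′ i ≡⟨ cong (_+_ (2 * H i)) (*-assoc (suc k) k (B n′ i)) ⟩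
            2 * H i + suc k * (k * B n′ i) ≤⟨ +-monoʳ-≤ (2 * H i) (*-monoʳ-≤ (suc k) (≤-trans (*-monoˡ-≤ (B n′ i) (≤-trans (n≤1+n k) (<⇒≤ k<a))) grow)) ⟩
            2 * H i + suc k * Y ∎)

      -- `lym` passes from `h_i` to `g` in both hypotheses of the criterion: `h_i ≥ Y` gives the
      -- size of `g`, and `ratio` gives the quotient. The witness `b` is built to satisfy both.
      macaulay-step : MacaulayBound i g g′
      macaulay-step with growth-witness j s
      ... | b , b-ratio , b-size = macaulay-criterion i b size ratio′
        where
        open ≤-Reasoning
        t = i + 2 + s
        size : rising b i ≤ i ! * g
        size = *-cancelˡ-≤ t (begin
          t * rising b i ≤⟨ subst (λ d → t * rising b i ≤ (2 + s) * (i ! * B d i)) row b-size ⟩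
          (2 + s) * (i ! * Y) ≡⟨ lemma (2 + s) (i !) Y ⟩
          i ! * ((2 + s) * Y) ≤⟨ *-monoʳ-≤ (i !) (≤-trans (*-monoʳ-≤ (2 + s) h≥Y) lym) ⟩
          i ! * (t * g) ≡⟨ lemma (i !) t g ⟩
          t * (i ! * g) ∎)
          where
          lemma : ∀ x f y → x * (f * y) ≡ f * (x * y)
          lemma = solve-∀
        ratio′ : suc i * g′ ≤ b * g
        ratio′ = *-cancelˡ-≤ (a ^ s) {{m^n≢0 a s {{>-nonZero (m≤n⇒m≤o+n (2 * i) (s≤s z≤n))}}}} (begin
          a ^ s * (suc i * g′) ≡⟨ lemma₁ (a ^ s) (suc i) g′ ⟩
          suc i * (a ^ s * g′) ≤⟨ ratio ⟩
          (2 + s) * c ^ suc s * H i ≡⟨ lemma₂ (2 + s) (c ^ suc s) (H i) ⟩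
          c ^ suc s * ((2 + s) * H i) ≤⟨ *-monoʳ-≤ (c ^ suc s) lym ⟩
          c ^ suc s * (t * g) ≡⟨ sym (*-assoc (c ^ suc s) t g) ⟩
          c ^ suc s * t * g ≤⟨ *-monoˡ-≤ g b-ratio ⟩
          b * a ^ s * g ≡⟨ lemma₃ b (a ^ s) g ⟩
          a ^ s * (b * g) ∎)
          where
          lemma₁ : ∀ x f y → x * (f * y) ≡ f * (x * y)
          lemma₁ = solve-∀
          lemma₂ : ∀ x f y → x * f * y ≡ f * (x * y)
          lemma₂ = solve-∀
          lemma₃ : ∀ b p g → b * p * g ≡ p * (b * g)
          lemma₃ = solve-∀

-- Translation of `h''` into `hVec` and assembly of the three claims.

open import Defs
open Sequences
open ColoringSums
open GraphColorings
open HVectors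
open Rank
open Growth
open import Data.Nat using (ℕ; zero; suc; z≤n; s≤s; _≤_; _<_; _+_; _*_; _∸_; _/_)
open import Data.Nat.Properties
open import Data.Nat.Combinatorics using (_C_; k>n⇒nCk≡0; nCk+nC[k+1]≡[n+1]C[k+1])
open import Data.Nat.DivMod using (m/n*n≤m)
open import Data.Nat.Tactic.RingSolver using (solve-∀)
open import Data.Integer as ℤ using (ℤ; +_; 0ℤ; 1ℤ; ∣_∣)
import Data.Integer.Properties as ℤₚ
open import Data.Integer.Tactic.RingSolver using () renaming (solve-∀ to ℤ-solve-∀)
open import Data.Fin using (zero; suc)
import Data.Fin.Properties as Finₚ
open import Data.List using (List; []; _∷_; map; length; upTo; applyUpTo)
import Data.List.Properties as Listₚ
open import Data.List.Relation.Binary.Sublist.Propositional using (_⊆_)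
import Data.List.Relation.Unary.All as All
import Data.List.Relation.Unary.All.Properties as Allₚ
import Data.List.Relation.Unary.AllPairs as AllPairs
import Data.List.Relation.Unary.AllPairs.Properties as AllPairsₚ
open import Data.Product using (_×_; _,_; proj₁)
open import Data.Sum using (inj₁; inj₂)
open import Data.Vec using (Vec; []; _∷_)
open import Function using (_∘_; id)
open import Relation.Binary.PropositionalEquality using (_≡_; _≢_; refl; sym; trans; cong; cong₂; subst; subst₂; module ≡-Reasoning)

iterΔ-δ₀ : ∀ n k → iter Δ n δ₀ k ≡ sign k ℤ.* + (n C k)
iterΔ-δ₀ zero    zero    = refl
iterΔ-δ₀ zero    (suc k) = sym (trans (cong (λ c → sign (suc k) ℤ.* + c) (k>n⇒nCk≡0 {0} {suc k} (s≤s z≤n))) (ℤₚ.*-zeroʳ (sign (suc k))))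
iterΔ-δ₀ (suc n) zero    = trans (ℤₚ.+-identityʳ _) (iterΔ-δ₀ n zero)
iterΔ-δ₀ (suc n) (suc k) = begin
  iter Δ n δ₀ (suc k) ℤ.- iter Δ n δ₀ k ≡⟨ cong₂ ℤ._-_ (iterΔ-δ₀ n (suc k)) (iterΔ-δ₀ n k) ⟩
  (ℤ.- 1ℤ) ℤ.* sign k ℤ.* + (n C suc k) ℤ.- sign k ℤ.* + (n C k) ≡⟨ lemma (sign k) (+ (n C k)) (+ (n C suc k)) ⟩
  sign (suc k) ℤ.* + (n C k + n C suc k) ≡⟨ cong (λ c → sign (suc k) ℤ.* + c) (nCk+nC[k+1]≡[n+1]C[k+1] n k) ⟩
  sign (suc k) ℤ.* + (suc n C suc k) ∎
  where
  open ≡-Reasoning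
  lemma : ∀ s p q → (ℤ.- 1ℤ) ℤ.* s ℤ.* q ℤ.- s ℤ.* p ≡ (ℤ.- 1ℤ) ℤ.* s ℤ.* (p ℤ.+ q)
  lemma = ℤ-solve-∀

conv-sum : ∀ f g i → conv f g i ≡ sum< (suc i) (λ k → f k ℤ.* g (i ∸ k))
conv-sum f g zero    = sym (ℤₚ.+-identityʳ _)
conv-sum f g (suc i) = cong (ℤ._+_ (f 0 ℤ.* g (suc i))) (conv-sum (f ∘ suc) g i)

sumℤ-applyUpTo : ∀ m (f : ℕ → ℕ) (φ : ℕ → ℤ) → sumℤ (map φ (applyUpTo f m)) ≡ sum< m (φ ∘ f)
sumℤ-applyUpTo zero    f φ = refl
sumℤ-applyUpTo (suc m) f φ = cong (ℤ._+_ (φ (f 0))) (sumℤ-applyUpTo m (f ∘ suc) φ)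

iterΔ-sum : ∀ n a i → iter Δ n a i ≡ sumℤ (map (λ k → sign k ℤ.* + (n C k) ℤ.* a (i ∸ k)) (upTo (suc i)))
iterΔ-sum n a i = begin
  iter Δ n a i ≡⟨ cong (λ m → iter Δ m a i) (sym (+-identityʳ n)) ⟩
  iter Δ (n + 0) a i ≡⟨ iter-cong Δ-cong (n + 0) (λ k → sym (conv-δ₀ˡ a k)) i ⟩
  iter Δ (n + 0) (conv δ₀ a) i ≡⟨ iterΔ-conv n 0 δ₀ a i ⟩
  conv (iter Δ n δ₀) a i ≡⟨ conv-cong {b = a} (iterΔ-δ₀ n) (λ _ → refl) i ⟩
  conv (λ k → sign k ℤ.* + (n C k)) a i ≡⟨ conv-sum (λ k → sign k ℤ.* + (n C k)) a i ⟩
  sum< (suc i) (λ k → sign k ℤ.* + (n C k) ℤ.* a (i ∸ k)) ≡⟨ sym (sumℤ-applyUpTo (suc i) id (λ k → sign k ℤ.* + (n C k) ℤ.* a (i ∸ k))) ⟩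
  sumℤ (map (λ k → sign k ℤ.* + (n C k) ℤ.* a (i ∸ k)) (upTo (suc i))) ∎
  where open ≡-Reasoning

h''-hVec : ∀ n rk (A : List (Hyp n)) → (∀ S → S ⊆ A → IsRank S (rk S)) → ∀ i → h'' n rk A i ≡ hVec n (map toEdge A) i
h''-hVec n rk A isRank i = trans
  (sym (iterΔ-sum n (λ j → fval n rk A (+ (2 * j + 1))) i))
  (iter-cong Δ-cong n (λ j → subst (λ x → fval n rk A (+ x) ≡ (+ x) ℤ.^ n ℤ.- properCount n (map toEdge A) x)
    (+-comm 1 (2 * j)) (fval-properCount n rk A isRank (2 * j))) i)

toEdge-nonLoop : ∀ {n} (h : Hyp n) → NonLoop (toEdge h)
toEdge-nonLoop (eqH i j i<j) p = Finₚ.<-irrefl (Finₚ.suc-injective p) i<j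
toEdge-nonLoop (coordH i)    ()

toEdge-different : ∀ {n} {h h′ : Hyp n} → h ≢ h′ → Different (toEdge h) (toEdge h′)
toEdge-different {h = eqH i j p} {eqH _ _ q} h≢h′ =
  (λ { refl → h≢h′ (cong (eqH i j) (Finₚ.<-irrelevant p q)) }) , (λ { refl → Finₚ.<-asym p q })
toEdge-different {h = eqH _ _ _} {coordH _}  _    = (λ ()) , (λ ())
toEdge-different {h = coordH _}  {eqH _ _ _} _    = (λ ()) , (λ ())
toEdge-different {h = coordH i}  {coordH _}  h≢h′ = (λ { refl → h≢h′ refl }) , (λ ())

toEdge-simple : ∀ {n} {A : List (Hyp n)} → Unique A → Simple (map toEdge A)
toEdge-simple {A = A} u = Allₚ.map⁺ (All.universal toEdge-nonLoop A) , AllPairsₚ.map⁺ (AllPairs.map toEdge-different u)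

-- With a single color every vertex has the color of the ground and every edge is constant. Hence
-- `h''_0 = 1` as soon as there is a hyperplane.
properCount-1 : ∀ n e E → properCount n (e ∷ E) 1 ≡ 0ℤ
properCount-1 n (u , v) E = trans (sumVec-cong n 1 (λ c b → cong (λ w → (1ℤ ℤ.- w) ℤ.* proper E c)
    (ind-yes (color c u ≟ color c v) (trans (zero-color c b u) (sym (zero-color c b v)))))) (sumVec-0 n 1)
  where
  zero-color : ∀ (c : Vec ℕ n) → Bounded 1 c → ∀ u → color c u ≡ 0
  zero-color c b zero    = refl
  zero-color c b (suc i) = n<1⇒n≡0 (b i)

iterΔ-at-0 : ∀ n a → iter Δ n a 0 ≡ a 0
iterΔ-at-0 zero    a = refl
iterΔ-at-0 (suc n) a = trans (ℤₚ.+-identityʳ _) (iterΔ-at-0 n a)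

hVec-at-0 : ∀ n e E → hVec n (e ∷ E) 0 ≡ 1ℤ
hVec-at-0 n e E = trans (iterΔ-at-0 n (λ j → odd^ n j ℤ.- oddSample (properCount n (e ∷ E)) j)) (cong₂ ℤ._-_ (ℤₚ.^-zeroˡ n) (properCount-1 n e E))

map-upTo-cong : ∀ {Z : Set} m {f g : ℕ → Z} → (∀ i → i < m → f i ≡ g i) → map f (upTo m) ≡ map g (upTo m)
map-upTo-cong m {f} {g} p = trans (Listₚ.map-upTo f m) (trans (go m p) (sym (Listₚ.map-upTo g m)))
  where
  go : ∀ m {f g : ℕ → _} → (∀ i → i < m → f i ≡ g i) → applyUpTo f m ≡ applyUpTo g m
  go zero    p = refl
  go (suc m) p = cong₂ _∷_ (p 0 (s≤s z≤n)) (go m (λ i i<m → p (suc i) (s≤s i<m)))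

at-upTo : ∀ m (f : ℕ → ℕ) i → i < m → at (map f (upTo m)) i ≡ f i
at-upTo m f i i<m = trans (cong (λ l → at l i) (Listₚ.map-upTo f m)) (go m f i i<m)
  where
  go : ∀ m (f : ℕ → ℕ) i → i < m → at (applyUpTo f m) i ≡ f i
  go (suc m) f zero    _         = refl
  go (suc m) f (suc i) (s≤s i<m) = go m (f ∘ suc) i i<m

double≤ : ∀ {i n} → i ≤ n / 2 → 2 * i ≤ n
double≤ {i} {n} p = ≤-trans (*-monoʳ-≤ 2 p) (≤-trans (≤-reflexive (*-comm 2 (n / 2))) (m/n*n≤m n 2))

module _ {n : ℕ} (h : ℕ → ℤ) (E : List (Edge (suc n))) (S : Simple E) (1≤m : 1 ≤ length E) (h≡ : ∀ i → h i ≡ hVec (suc n) E i) (h₀ : h 0 ≡ 1ℤ) where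
  private
    H : ℕ → ℕ
    H i = ∣ h i ∣

    H≡ : ∀ i → + H i ≡ h i
    H≡ i = ℤₚ.0≤i⇒+∣i∣≡i (subst (0ℤ ℤ.≤_) (sym (h≡ i)) (hVec-nonneg n E (proj₁ S) i))

    -- The truncated subtraction is the true difference up to the middle, and `diffVec` goes no
    -- further.
    G : ℕ → ℕ
    G zero    = H 0
    G (suc i) = H (suc i) ∸ H i

    rise : ∀ i → 2 * suc i ≤ suc n → H i ≤ H (suc i)
    rise i p = ℤ.drop‿+≤+ (subst₂ ℤ._≤_ (sym (trans (H≡ i) (h≡ i))) (sym (trans (H≡ (suc i)) (h≡ (suc i))))
      (hVec-mirror n E (proj₁ S) i (suc i) (n≤1+n i) (≤-pred (≤-trans (≤-reflexive (lemma i)) p))))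
      where
      lemma : ∀ i → 1 + (i + (1 + i)) ≡ 2 * (1 + i)
      lemma = solve-∀

    G-step : ∀ i → 2 * suc i ≤ suc n → H (suc i) ≡ H i + G (suc i)
    G-step i p = sym (m+[n∸m]≡n (rise i p))

    G-diff : ∀ i → 2 * suc i ≤ suc n → + G (suc i) ≡ h (suc i) ℤ.- h i
    G-diff i p = trans (lemma (+ H i) (+ G (suc i))) (cong₂ ℤ._-_ (trans (cong +_ (sym (G-step i p))) (H≡ (suc i))) (H≡ i))
      where
      lemma : ∀ x y → y ≡ x ℤ.+ y ℤ.- x
      lemma = ℤ-solve-∀

    bound : ∀ j → 2 * suc (suc j) ≤ suc n → MacaulayBound (suc j) (G (suc j)) (G (suc (suc j)))
    -- `s` is what remains of the dimension after `2i + 2` with `i = j + 1`. `go` generalizes the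
    -- dimension so that the equation for it can be matched.
    bound j p = go (suc n ∸ (2 + 2 * suc j)) (sym (trans (cong (λ k → 2 + k) (+-comm _ (2 * suc j))) (m+[n∸m]≡n p′))) E S 1≤m (λ k → trans (H≡ k) (h≡ k))
      (G-step j (≤-trans (*-monoʳ-≤ 2 (n≤1+n (suc j))) p)) (G-step (suc j) p)
      where
      p′ : 2 + 2 * suc j ≤ suc n
      p′ = ≤-trans (≤-reflexive (sym (*-suc 2 (suc j)))) p
      go : ∀ s {N} → N ≡ 2 + (s + 2 * suc j) → (E : List (Edge N)) → Simple E → 1 ≤ length E → (∀ k → + H k ≡ hVec N E k) →
           ∀ {g g′} → H (suc j) ≡ H j + g → H (suc (suc j)) ≡ H (suc j) + g′ → MacaulayBound (suc j) g g′
      go s refl E S 1≤m H≡ st st′ = macaulay-step j s S 1≤m H H≡ st st′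

  diffVec-isMVector : IsMVector (diffVec h (suc n / 2))
  diffVec-isMVector = map G (upTo m) , trans (sym (Listₚ.map-∘ (upTo m))) (map-upTo-cong m entry) , inj₂ (G₀ , macaulay)
    where
    m = suc (suc n / 2)
    G₀ : at (map G (upTo m)) 0 ≡ 1
    G₀ = trans (at-upTo m G 0 (s≤s z≤n)) (cong ∣_∣ h₀)
    entry : ∀ i → i < m → + G i ≡ _
    entry zero    _         = H≡ 0
    entry (suc i) (s≤s i<m) = G-diff i (double≤ i<m)
    macaulay : ∀ i → 1 ≤ i → suc i < length (map G (upTo m)) → MacaulayBound i (at (map G (upTo m)) i) (at (map G (upTo m)) (suc i))
    macaulay (suc j) _ p = subst₂ (MacaulayBound (suc j)) (sym (at-upTo m G (suc j) (<⇒≤ p′))) (sym (at-upTo m G (suc (suc j)) p′)) (bound j (double≤ (≤-pred p′)))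
      where
      p′ : suc (suc j) < m
      p′ = subst (suc (suc j) <_) (trans (Listₚ.length-map G (upTo m)) (Listₚ.length-upTo m)) p

diffVec-zero : ∀ h c → (∀ i → h i ≡ 0ℤ) → IsMVector (diffVec h c)
diffVec-zero h c p = map (λ _ → 0) (upTo (suc c)) ,
    trans (sym (Listₚ.map-∘ (upTo (suc c)))) (map-upTo-cong (suc c) entry) ,
    inj₁ (Allₚ.map⁺ (All.universal (λ _ → refl) (upTo (suc c))))
  where
  entry : ∀ i → i < suc c → 0ℤ ≡ _
  entry zero    _ = sym (p 0)
  entry (suc i) _ = sym (cong₂ ℤ._-_ (p (suc i)) (p i))

theorem5p9 : (n : ℕ) (A : List (Hyp n)) → Unique A
    → (rk : List (Hyp n) → ℕ) → (∀ S → S ⊆ A → IsRank S (rk S))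
    → (∀ i → 2 * i + 3 ≤ n → h'' n rk A i ℤ.≤ h'' n rk A (suc i))
    × (∀ i → 2 * i + 1 ≤ n → h'' n rk A i ℤ.≤ h'' n rk A (n ∸ 1 ∸ i))
    × IsMVector (diffVec (h'' n rk A) (n / 2))
-- Without hyperplanes `h''` vanishes identically, and the difference vector is that of the zero
-- quotient; in all other cases it starts with 1.
theorem5p9 n [] u rk isRank =
    (λ i _ → ℤₚ.≤-reflexive (trans (h≡0 i) (sym (h≡0 (suc i)))))
  , (λ i _ → ℤₚ.≤-reflexive (trans (h≡0 i) (sym (h≡0 (n ∸ 1 ∸ i)))))
  , diffVec-zero (h'' n rk []) (n / 2) h≡0
  where
  h≡0 : ∀ i → h'' n rk [] i ≡ 0ℤ
  h≡0 i = trans (h''-hVec n rk [] isRank i) (hVec-[] n i)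
theorem5p9 zero (eqH () _ _ ∷ A) u rk isRank
theorem5p9 zero (coordH () ∷ A) u rk isRank
theorem5p9 (suc n) A@(a ∷ A₀) u rk isRank =
    (λ i p → subst₂ ℤ._≤_ (sym (h≡ i)) (sym (h≡ (suc i)))
      (hVec-mirror n E (proj₁ S) i (suc i) (n≤1+n i) (≤-pred (≤-trans (n≤1+n _) (≤-trans (≤-reflexive (lemma₁ i)) p)))))
  , (λ i p → subst₂ ℤ._≤_ (sym (h≡ i)) (sym (h≡ (n ∸ i)))
      (hVec-mirror n E (proj₁ S) i (n ∸ i) (m+n≤o⇒m≤o∸n i (i+i≤n i p)) (≤-reflexive (m+[n∸m]≡n (m+n≤o⇒m≤o i (i+i≤n i p))))))
  , diffVec-isMVector (h'' (suc n) rk A) E S (s≤s z≤n) h≡ (trans (h≡ 0) (hVec-at-0 (suc n) (toEdge a) (map toEdge A₀)))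
  where
  E = map toEdge A
  S = toEdge-simple u
  h≡ : ∀ i → h'' (suc n) rk A i ≡ hVec (suc n) E i
  h≡ = h''-hVec (suc n) rk A isRank
  lemma₁ : ∀ i → 2 + (i + (1 + i)) ≡ 2 * i + 3
  lemma₁ = solve-∀
  lemma₂ : ∀ i → 2 * i + 1 ≡ 1 + (i + i)
  lemma₂ = solve-∀
  i+i≤n : ∀ i → 2 * i + 1 ≤ suc n → i + i ≤ n
  i+i≤n i p = ≤-pred (≤-trans (≤-reflexive (sym (lemma₂ i))) p)
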